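{- For $|q|<1$ the following two identities hold: $$\sum_{i,j,k\geq 0} \frac{\left(1+q^{2i+4j+6k+2}-q^{3i+6j+9k+5}\right)q^{\binom{i+2j+3k}{2}+i+j^2+2j+2k}}{(q;q)_i(q^2;q^2)_j(q^3;q^3)_k}=\frac{1}{(q^2;q^3)_\infty(q,q^6,q^9;q^{12})_\infty},$$ $$\sum_{i,j,k\geq 0} \frac{\left(1+q+q^{2j+3k+2}\right)q^{\binom{i+2j+3k}{2}+3i+j^2+4j+7k}}{(q;q)_i(q^2;q^2)_j(q^3;q^3)_k}=\frac{1}{(q;q^3)_\infty(q^5,q^6,q^9;q^{12})_\infty}.$$
   Context: Here $q$ is a complex number with $|q|<1$. For a base $p$ with $|p|<1$: $(a;p)_\infty=\prod_{k\ge 0}(1-ap^k)$, $(a;p)_n=\prod_{k=0}^{n-1}(1-ap^k)$ for integers $n\ge 0$, and $(a_1,\dots,a_m;p)_n=(a_1;p)_n\cdots(a_m;p)_n$ for $n\in\mathbb{Z}_{\ge0}\cup\{\infty\}$. Also $\binom{N}{2}=N(N-1)/2$. -}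

module Defs where

open import Level using (0ℓ)
open import Algebra.Bundles using (RawRing)
import Algebra.Definitions.RawSemiring as RawSemiringDefs
open import Data.Nat.Base as ℕ using (ℕ; zero; suc)
import Data.Nat.Properties as ℕ
open import Data.Rational.Base
open import Data.Rational.Properties
open import Data.Rational.Solver using (module +-*-Solver)
open import Data.Product using (∃; _×_; _,_)
open import Data.List.Base using (List; []; _∷_; map; foldr)
open import Data.List.Relation.Binary.Pointwise using (Pointwise)
open import Data.List.Relation.Binary.Subset.Propositional using (_⊆_)
open import Data.List.Relation.Unary.Unique.Propositional using (Unique)
open import Relation.Nullary using (yes; no)
open import Data.Empty using (⊥-elim)
open import Relation.Binary.PropositionalEquality
  using (_≡_; refl; sym; trans; cong; cong₂; subst)

0<1 : 0ℚ < 1ℚ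
0<1 = positive⁻¹ 1ℚ

0<a*b : ∀ {a b} → 0ℚ < a → 0ℚ < b → 0ℚ < a * b
0<a*b {a} {b} 0<a 0<b =
  positive⁻¹ (a * b) {{pos*pos⇒pos a {{positive 0<a}} b {{positive 0<b}}}}

0<a+b : ∀ {a b} → 0ℚ < a → 0ℚ ≤ b → 0ℚ < a + b
0<a+b 0<a 0≤b = +-mono-<-≤ 0<a 0≤b

*-mono-≤ : ∀ {a b c d} → 0ℚ ≤ b → 0ℚ ≤ c → a ≤ b → c ≤ d → a * c ≤ b * d
*-mono-≤ {a} {b} {c} {d} 0≤b 0≤c a≤b c≤d = ≤-trans
  (*-monoʳ-≤-nonNeg c {{nonNegative 0≤c}} a≤b)
  (*-monoˡ-≤-nonNeg b {{nonNegative 0≤b}} c≤d)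

0≤a*a : ∀ a → 0ℚ ≤ a * a
0≤a*a a = subst (0ℚ ≤_) ∣a∣²≡a² (*-mono-≤ {0ℚ} (0≤∣p∣ a) ≤-refl (0≤∣p∣ a) (0≤∣p∣ a))
  where
  open import Data.Sum.Base using (inj₁; inj₂)
  open +-*-Solver
  ∣a∣²≡a² : ∣ a ∣ * ∣ a ∣ ≡ a * a
  ∣a∣²≡a² with ∣p∣≡p∨∣p∣≡-p a
  ... | inj₁ e = cong₂ _*_ e e
  ... | inj₂ e = trans (cong₂ _*_ e e) (solve 1 (λ x → (:- x) :* (:- x) := x :* x) refl a)

scale : ∀ {A ε} → 0ℚ < A → 0ℚ < ε → ∃ λ η → 0ℚ < η × A * η ≡ ε
scale {A} {ε} 0<A 0<ε = 1/ A * ε , 0<a*b 0<1/A 0<ε , eq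
  where
  instance
    A⁺ = positive 0<A
    A≢0 = pos⇒nonZero A
  0<1/A : 0ℚ < 1/ A
  0<1/A = positive⁻¹ (1/ A) {{1/pos⇒pos A}}
  eq : A * (1/ A * ε) ≡ ε
  eq = trans (sym (*-assoc A (1/ A) ε))
      (trans (cong (_* ε) (*-inverseʳ A)) (*-identityˡ ε))

-- Total on ℚ so that reciprocals of real numbers can be taken termwise.
inv : ℚ → ℚ
inv p with p ≟ 0ℚ
... | yes _  = 0ℚ
... | no p≢0 = (1/ p) {{≢-nonZero p≢0}}

inv-inverseʳ : ∀ p → 0ℚ < p → p * inv p ≡ 1ℚ
inv-inverseʳ p 0<p with p ≟ 0ℚ
... | yes p≡0 = ⊥-elim (<-irrefl (sym p≡0) 0<p)
... | no p≢0  = *-inverseʳ p {{≢-nonZero p≢0}}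

-- Cauchy reals: the modulus of convergence is part of the data, and equality
-- of real numbers is ≈ʳ, not ≡.
Cauchy : (ℕ → ℚ) → Set
Cauchy s = ∀ ε → 0ℚ < ε → ∃ λ N → ∀ m n → N ℕ.≤ m → N ℕ.≤ n → ∣ s m - s n ∣ ≤ ε

record ℝ : Set where
  constructor real
  field
    seq    : ℕ → ℚ
    cauchy : Cauchy seq

open ℝ public

infix 4 _≈ʳ_ _<ʳ_

_≈ʳ_ : ℝ → ℝ → Set
x ≈ʳ y = ∀ ε → 0ℚ < ε → ∃ λ N → ∀ n → N ℕ.≤ n → ∣ seq x n - seq y n ∣ ≤ ε

_<ʳ_ : ℝ → ℝ → Set
x <ʳ y = ∃ λ ε → 0ℚ < ε × ∃ λ N → ∀ n → N ℕ.≤ n → seq x n + ε ≤ seq y n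

cauchy-const : ∀ p → Cauchy (λ _ → p)
cauchy-const p ε 0<ε = 0 , λ _ _ _ _ →
  subst (_≤ ε) (sym (cong ∣_∣ (+-inverseʳ p))) (<⇒≤ 0<ε)

cauchy-+ : ∀ {s t} → Cauchy s → Cauchy t → Cauchy (λ n → s n + t n)
cauchy-+ {s} {t} cs ct ε 0<ε with scale {1ℚ + 1ℚ} (0<a+b 0<1 (<⇒≤ 0<1)) 0<ε
... | η , 0<η , 2η≡ε with cs η 0<η | ct η 0<η
... | M , hM | N , hN = M ℕ.⊔ N , λ m n m≥ n≥ → begin
  ∣ (s m + t m) - (s n + t n) ∣       ≡⟨ cong ∣_∣ (rearrange (s m) (t m) (s n) (t n)) ⟩
  ∣ (s m - s n) + (t m - t n) ∣       ≤⟨ ∣p+q∣≤∣p∣+∣q∣ (s m - s n) (t m - t n) ⟩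
  ∣ s m - s n ∣ + ∣ t m - t n ∣       ≤⟨ +-mono-≤
      (hM m n (ℕ.m⊔n≤o⇒m≤o M N m≥) (ℕ.m⊔n≤o⇒m≤o M N n≥))
      (hN m n (ℕ.m⊔n≤o⇒n≤o M N m≥) (ℕ.m⊔n≤o⇒n≤o M N n≥)) ⟩
  η + η                               ≡⟨ solve 1 (λ x → x :+ x := (con 1ℚ :+ con 1ℚ) :* x) refl η ⟩
  (1ℚ + 1ℚ) * η                       ≡⟨ 2η≡ε ⟩
  ε                                   ∎
  where
  open ≤-Reasoning
  open +-*-Solver
  rearrange : ∀ a b c d → (a + b) - (c + d) ≡ (a - c) + (b - d)
  rearrange = solve 4 (λ a b c d → (a :+ b) :- (c :+ d) := (a :- c) :+ (b :- d)) refl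

cauchy-neg : ∀ {s} → Cauchy s → Cauchy (λ n → - s n)
cauchy-neg {s} cs ε 0<ε with cs ε 0<ε
... | N , h = N , λ m n m≥ n≥ → subst (_≤ ε)
  (trans (sym (∣-p∣≡∣p∣ (s m - s n))) (cong ∣_∣ (neg-diff (s m) (s n))))
  (h m n m≥ n≥)
  where
  open +-*-Solver
  neg-diff : ∀ a b → - (a - b) ≡ - a - - b
  neg-diff = solve 2 (λ a b → :- (a :- b) := (:- a) :- (:- b)) refl

cauchy⇒bounded : ∀ {s} → Cauchy s →
  ∃ λ B → 0ℚ < B × ∃ λ N → ∀ n → N ℕ.≤ n → ∣ s n ∣ ≤ B
cauchy⇒bounded {s} cs with cs 1ℚ 0<1
... | N , h = 1ℚ + ∣ s N ∣ , 0<a+b 0<1 (0≤∣p∣ (s N)) , N , λ n n≥ → begin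
  ∣ s n ∣                   ≡⟨ cong ∣_∣ (split (s n) (s N)) ⟩
  ∣ (s n - s N) + s N ∣     ≤⟨ ∣p+q∣≤∣p∣+∣q∣ (s n - s N) (s N) ⟩
  ∣ s n - s N ∣ + ∣ s N ∣   ≤⟨ +-monoˡ-≤ ∣ s N ∣ (h n N n≥ ℕ.≤-refl) ⟩
  1ℚ + ∣ s N ∣              ∎
  where
  open ≤-Reasoning
  open +-*-Solver
  split : ∀ a b → a ≡ (a - b) + b
  split = solve 2 (λ a b → a := (a :- b) :+ b) refl

*-diff-bound : ∀ a b c d {A B η} → 0ℚ ≤ A → 0ℚ ≤ η →
  ∣ a ∣ ≤ A → ∣ d ∣ ≤ B → ∣ a - c ∣ ≤ η → ∣ b - d ∣ ≤ η →
  ∣ a * b - c * d ∣ ≤ (A + B) * η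
*-diff-bound a b c d {A} {B} {η} 0≤A 0≤η a≤A d≤B ac bd = begin
  ∣ a * b - c * d ∣
    ≡⟨ cong ∣_∣ (solve 4 (λ a b c d → a :* b :- c :* d := a :* (b :- d) :+ (a :- c) :* d)
                  refl a b c d) ⟩
  ∣ a * (b - d) + (a - c) * d ∣
    ≤⟨ ∣p+q∣≤∣p∣+∣q∣ (a * (b - d)) ((a - c) * d) ⟩
  ∣ a * (b - d) ∣ + ∣ (a - c) * d ∣
    ≡⟨ cong₂ _+_ (∣p*q∣≡∣p∣*∣q∣ a (b - d)) (∣p*q∣≡∣p∣*∣q∣ (a - c) d) ⟩
  ∣ a ∣ * ∣ b - d ∣ + ∣ a - c ∣ * ∣ d ∣
    ≤⟨ +-mono-≤
         (*-mono-≤ {∣ a ∣} {A} {∣ b - d ∣} {η} 0≤A (0≤∣p∣ (b - d)) a≤A bd)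
         (*-mono-≤ {∣ a - c ∣} {η} {∣ d ∣} {B} 0≤η (0≤∣p∣ d) ac d≤B) ⟩
  A * η + η * B
    ≡⟨ solve 3 (λ a b x → a :* x :+ x :* b := (a :+ b) :* x) refl A B η ⟩
  (A + B) * η ∎
  where
  open ≤-Reasoning
  open +-*-Solver

cauchy-* : ∀ {s t} → Cauchy s → Cauchy t → Cauchy (λ n → s n * t n)
cauchy-* {s} {t} cs ct ε 0<ε = bounds (cauchy⇒bounded {s} cs) (cauchy⇒bounded {t} ct)
  where
  Bounded : (ℕ → ℚ) → Set
  Bounded u = ∃ λ B → 0ℚ < B × ∃ λ N → ∀ n → N ℕ.≤ n → ∣ u n ∣ ≤ B

  Close : (ℕ → ℚ) → ℚ → Set
  Close u η = ∃ λ N → ∀ m n → N ℕ.≤ m → N ℕ.≤ n → ∣ u m - u n ∣ ≤ η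

  combine : ∀ {η} ((A , _) : Bounded s) ((B , _) : Bounded t) →
    0ℚ < η → (A + B) * η ≡ ε → Close s η → Close t η → Close (λ n → s n * t n) ε
  combine {η} (A , 0<A , K , hK) (B , 0<B , L , hL) 0<η eq (M , hM) (N , hN) =
    (K ℕ.⊔ L) ℕ.⊔ (M ℕ.⊔ N) , λ m n m≥ n≥ →
    let m≥KL = ℕ.m⊔n≤o⇒m≤o (K ℕ.⊔ L) (M ℕ.⊔ N) m≥
        n≥KL = ℕ.m⊔n≤o⇒m≤o (K ℕ.⊔ L) (M ℕ.⊔ N) n≥
        m≥MN = ℕ.m⊔n≤o⇒n≤o (K ℕ.⊔ L) (M ℕ.⊔ N) m≥
        n≥MN = ℕ.m⊔n≤o⇒n≤o (K ℕ.⊔ L) (M ℕ.⊔ N) n≥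
    in subst (∣ s m * t m - s n * t n ∣ ≤_) eq
      (*-diff-bound (s m) (t m) (s n) (t n) {A} {B} {η} (<⇒≤ 0<A) (<⇒≤ 0<η)
        (hK m (ℕ.m⊔n≤o⇒m≤o K L m≥KL))
        (hL n (ℕ.m⊔n≤o⇒n≤o K L n≥KL))
        (hM m n (ℕ.m⊔n≤o⇒m≤o M N m≥MN) (ℕ.m⊔n≤o⇒m≤o M N n≥MN))
        (hN m n (ℕ.m⊔n≤o⇒n≤o M N m≥MN) (ℕ.m⊔n≤o⇒n≤o M N n≥MN)))

  bounds : Bounded s → Bounded t → Close (λ n → s n * t n) ε
  bounds b@(A , 0<A , _) b′@(B , 0<B , _) =
    let η , 0<η , eq = scale {A + B} {ε} (0<a+b {A} {B} 0<A (<⇒≤ 0<B)) 0<ε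
    in combine b b′ 0<η eq (cs η 0<η) (ct η 0<η)

cauchy-inv : ∀ {s} → Cauchy s →
  (∃ λ δ → 0ℚ < δ × ∃ λ N → ∀ n → N ℕ.≤ n → 0ℚ + δ ≤ s n) → Cauchy (λ n → inv (s n))
cauchy-inv {s} cs (δ , 0<δ , N , hN) ε 0<ε with cs (ε * (δ * δ)) (0<a*b 0<ε (0<a*b 0<δ 0<δ))
... | M , hM = N ℕ.⊔ M , λ m n m≥ n≥ →
  bound (s m) (s n)
    (subst (_≤ s m) (+-identityˡ δ) (hN m (ℕ.m⊔n≤o⇒m≤o N M m≥)))
    (subst (_≤ s n) (+-identityˡ δ) (hN n (ℕ.m⊔n≤o⇒m≤o N M n≥)))
    (hM n m (ℕ.m⊔n≤o⇒n≤o N M n≥) (ℕ.m⊔n≤o⇒n≤o N M m≥))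
  where
  open ≤-Reasoning
  open +-*-Solver
  bound : ∀ a b → δ ≤ a → δ ≤ b → ∣ b - a ∣ ≤ ε * (δ * δ) → ∣ inv a - inv b ∣ ≤ ε
  bound a b δ≤a δ≤b h = *-cancelʳ-≤-pos (a * b) {{positive 0<ab}} (begin
    ∣ inv a - inv b ∣ * (a * b)
      ≡⟨ cong (∣ inv a - inv b ∣ *_) (sym (0≤p⇒∣p∣≡p (<⇒≤ 0<ab))) ⟩
    ∣ inv a - inv b ∣ * ∣ a * b ∣
      ≡⟨ sym (∣p*q∣≡∣p∣*∣q∣ (inv a - inv b) (a * b)) ⟩
    ∣ (inv a - inv b) * (a * b) ∣
      ≡⟨ cong ∣_∣ (solve 4 (λ x y a b → (x :- y) :* (a :* b) := (a :* x) :* b :- (b :* y) :* a)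
                    refl (inv a) (inv b) a b) ⟩
    ∣ (a * inv a) * b - (b * inv b) * a ∣
      ≡⟨ cong ∣_∣ (cong₂ (λ x y → x * b - y * a) (inv-inverseʳ a 0<a) (inv-inverseʳ b 0<b)) ⟩
    ∣ 1ℚ * b - 1ℚ * a ∣
      ≡⟨ cong ∣_∣ (cong₂ _-_ (*-identityˡ b) (*-identityˡ a)) ⟩
    ∣ b - a ∣
      ≤⟨ h ⟩
    ε * (δ * δ)
      ≤⟨ *-monoˡ-≤-nonNeg ε {{nonNegative (<⇒≤ 0<ε)}}
           (*-mono-≤ (<⇒≤ 0<a) (<⇒≤ 0<δ) δ≤a δ≤b) ⟩
    ε * (a * b) ∎)
    where
    0<a = <-≤-trans 0<δ δ≤a
    0<b = <-≤-trans 0<δ δ≤b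
    0<ab = 0<a*b 0<a 0<b

infixl 6 _+ʳ_
infixl 7 _*ʳ_
infix  8 -ʳ_

fromℚ : ℚ → ℝ
fromℚ p = real (λ _ → p) (cauchy-const p)

0ʳ 1ʳ : ℝ
0ʳ = fromℚ 0ℚ
1ʳ = fromℚ 1ℚ

_+ʳ_ _*ʳ_ : ℝ → ℝ → ℝ
x +ʳ y = real (λ n → seq x n + seq y n) (cauchy-+ {seq x} {seq y} (cauchy x) (cauchy y))
x *ʳ y = real (λ n → seq x n * seq y n) (cauchy-* {seq x} {seq y} (cauchy x) (cauchy y))

-ʳ_ : ℝ → ℝ
-ʳ x = real (λ n → - seq x n) (cauchy-neg {seq x} (cauchy x))

invʳ : (x : ℝ) → 0ʳ <ʳ x → ℝ
invʳ x 0<x = real (λ n → inv (seq x n)) (cauchy-inv {seq x} (cauchy x) 0<x)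

record ℂ : Set where
  constructor _+i_
  field
    re im : ℝ

open ℂ public

infix  4 _≈ᶜ_ ∣_∣<_ _#0
infixl 6 _+ᶜ_ _-ᶜ_
infixl 7 _*ᶜ_ _/ᶜ_[_]
infix  8 -ᶜ_

_≈ᶜ_ : ℂ → ℂ → Set
z ≈ᶜ w = re z ≈ʳ re w × im z ≈ʳ im w

0ᶜ 1ᶜ : ℂ
0ᶜ = 0ʳ +i 0ʳ
1ᶜ = 1ʳ +i 0ʳ

_+ᶜ_ _*ᶜ_ : ℂ → ℂ → ℂ
z +ᶜ w = (re z +ʳ re w) +i (im z +ʳ im w)
z *ᶜ w = (re z *ʳ re w +ʳ -ʳ (im z *ʳ im w)) +i (re z *ʳ im w +ʳ im z *ʳ re w)

-ᶜ_ : ℂ → ℂ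
-ᶜ z = (-ʳ re z) +i (-ʳ im z)

_-ᶜ_ : ℂ → ℂ → ℂ
z -ᶜ w = z +ᶜ -ᶜ w

ℂ-rawRing : RawRing 0ℓ 0ℓ
ℂ-rawRing = record
  { Carrier = ℂ ; _≈_ = _≈ᶜ_ ; _+_ = _+ᶜ_ ; _*_ = _*ᶜ_ ; -_ = -ᶜ_ ; 0# = 0ᶜ ; 1# = 1ᶜ }

open RawSemiringDefs (RawRing.rawSemiring ℂ-rawRing) public
  using () renaming (_^_ to infixr 8 _^ᶜ_)

normSq : ℂ → ℝ
normSq z = re z *ʳ re z +ʳ im z *ʳ im z

-- |z| < r for a positive rational r; both sides are squared, which avoids
-- the real square root in |z| = √(re z ² + im z ²).
∣_∣<_ : ℂ → ℚ → Set
∣ z ∣< r = normSq z <ʳ fromℚ (r * r)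

-- z ≠ 0 in the constructive sense: |z| is bounded away from 0.
_#0 : ℂ → Set
z #0 = 0ʳ <ʳ normSq z

recip : (z : ℂ) → z #0 → ℂ
recip z z#0 = (re z *ʳ r) +i (-ʳ im z *ʳ r)
  where r = invʳ (normSq z) z#0

_/ᶜ_[_] : (z w : ℂ) → w #0 → ℂ
z /ᶜ w [ w#0 ] = z *ᶜ recip w w#0

sumᶜ productᶜ : List ℂ → ℂ
sumᶜ     = foldr _+ᶜ_ 0ᶜ
productᶜ = foldr _*ᶜ_ 1ᶜ

infix 4 _⟶_

_⟶_ : (ℕ → ℂ) → ℂ → Set
s ⟶ l = ∀ ε → 0ℚ < ε → ∃ λ N → ∀ n → N ℕ.≤ n → ∣ s n -ᶜ l ∣< ε

-- Unconditional convergence of Σ_{i ∈ I} f i to S: the sums over finite sets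
-- (duplicate-free lists) of indices converge to S along inclusion.
HasSum : {I : Set} → (I → ℂ) → ℂ → Set
HasSum {I} f S = ∀ ε → 0ℚ < ε → ∃ λ (F₀ : List I) →
  ∀ F → Unique F → F₀ ⊆ F → ∣ sumᶜ (map f F) -ᶜ S ∣< ε

-- (a;p)_n
⟨_⨾_⟩_ : ℂ → ℂ → ℕ → ℂ
⟨ a ⨾ p ⟩ zero  = 1ᶜ
⟨ a ⨾ p ⟩ suc n = ⟨ a ⨾ p ⟩ n *ᶜ (1ᶜ -ᶜ a *ᶜ p ^ᶜ n)

-- Each (aᵢ;p)_∞ converges, and (a₁,…,aₘ;p)_∞ = (a₁;p)_∞ ⋯ (aₘ;p)_∞ equals P.
⟨_⨾_⟩∞≈_ : List ℂ → ℂ → ℂ → Set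
⟨ as ⨾ p ⟩∞≈ P = ∃ λ Ps →
  Pointwise (λ a A → (⟨ a ⨾ p ⟩_) ⟶ A) as Ps × P ≈ᶜ productᶜ Ps

infix 9 ⟨_⨾_⟩_
infix 4 ⟨_⨾_⟩∞≈_

normSqℚ : ℚ → ℚ → ℚ
normSqℚ a b = a * a + b * b

0≤normSqℚ : ∀ a b → 0ℚ ≤ normSqℚ a b
0≤normSqℚ a b = +-mono-≤ (0≤a*a a) (0≤a*a b)

normSqℚ-* : ∀ a b c d →
  normSqℚ (a * c + - (b * d)) (a * d + b * c) ≡ normSqℚ a b * normSqℚ c d
normSqℚ-* = solve 4 (λ a b c d →
  (a :* c :+ :- (b :* d)) :* (a :* c :+ :- (b :* d)) :+ (a :* d :+ b :* c) :* (a :* d :+ b :* c)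
  := (a :* a :+ b :* b) :* (c :* c :+ d :* d)) refl
  where open +-*-Solver

normSqAt : ℂ → ℕ → ℚ
normSqAt z n = seq (normSq z) n

EventuallyInDisc : ℂ → Set
EventuallyInDisc z = ∃ λ N → ∀ n → N ℕ.≤ n → normSqAt z n ≤ 1ℚ

∣z∣<1⇒inDisc : ∀ z → ∣ z ∣< 1ℚ → EventuallyInDisc z
∣z∣<1⇒inDisc z (ε , 0<ε , N , h) = N , λ n n≥ → begin
  normSqAt z n          ≡⟨ sym (+-identityʳ (normSqAt z n)) ⟩
  normSqAt z n + 0ℚ     ≤⟨ +-monoʳ-≤ (normSqAt z n) (<⇒≤ 0<ε) ⟩
  normSqAt z n + ε      ≤⟨ h n n≥ ⟩
  1ℚ                    ∎
  where open ≤-Reasoning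

∣zw∣<1 : ∀ z w → ∣ z ∣< 1ℚ → EventuallyInDisc w → ∣ z *ᶜ w ∣< 1ℚ
∣zw∣<1 z w (ε , 0<ε , N , hN) (M , hM) = ε , 0<ε , N ℕ.⊔ M , λ n n≥ →
  let a = seq (re z) n ; b = seq (im z) n ; c = seq (re w) n ; d = seq (im w) n in begin
  normSqAt (z *ᶜ w) n + ε               ≡⟨ cong (_+ ε) (normSqℚ-* a b c d) ⟩
  normSqℚ a b * normSqℚ c d + ε         ≤⟨ +-monoˡ-≤ ε
      (*-mono-≤ (0≤normSqℚ a b) (0≤normSqℚ c d) ≤-refl (hM n (ℕ.m⊔n≤o⇒n≤o N M n≥))) ⟩
  normSqℚ a b * 1ℚ + ε                  ≡⟨ cong (_+ ε) (*-identityʳ (normSqℚ a b)) ⟩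
  normSqℚ a b + ε                       ≤⟨ hN n (ℕ.m⊔n≤o⇒m≤o N M n≥) ⟩
  1ℚ                                    ∎
  where open ≤-Reasoning

^-inDisc : ∀ z → ∣ z ∣< 1ℚ → ∀ n → EventuallyInDisc (z ^ᶜ n)
^-inDisc z h zero    = 0 , λ _ _ → ≤-refl
^-inDisc z h (suc n) = ∣z∣<1⇒inDisc (z ^ᶜ suc n) (∣zw∣<1 z (z ^ᶜ n) h (^-inDisc z h n))

∣z^[1+n]∣<1 : ∀ z → ∣ z ∣< 1ℚ → ∀ n → ∣ z ^ᶜ suc n ∣< 1ℚ
∣z^[1+n]∣<1 z h n = ∣zw∣<1 z (z ^ᶜ n) h (^-inDisc z h n)

1#0 : 1ᶜ #0
1#0 = 1ℚ , 0<1 , 0 , λ _ _ → ≤-refl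

*-#0 : ∀ z w → z #0 → w #0 → (z *ᶜ w) #0
*-#0 z w (δ , 0<δ , N , hN) (η , 0<η , M , hM) = δ * η , 0<a*b 0<δ 0<η , N ℕ.⊔ M , λ n n≥ →
  let a = seq (re z) n ; b = seq (im z) n ; c = seq (re w) n ; d = seq (im w) n in begin
  0ℚ + δ * η                  ≡⟨ +-identityˡ (δ * η) ⟩
  δ * η                       ≤⟨ *-mono-≤ (0≤normSqℚ a b) (<⇒≤ 0<η)
      (subst (_≤ normSqℚ a b) (+-identityˡ δ) (hN n (ℕ.m⊔n≤o⇒m≤o N M n≥)))
      (subst (_≤ normSqℚ c d) (+-identityˡ η) (hM n (ℕ.m⊔n≤o⇒n≤o N M n≥))) ⟩
  normSqℚ a b * normSqℚ c d   ≡⟨ sym (normSqℚ-* a b c d) ⟩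
  normSqAt (z *ᶜ w) n         ∎
  where open ≤-Reasoning

1-z#0 : ∀ z → ∣ z ∣< 1ℚ → (1ᶜ -ᶜ z) #0
1-z#0 z (ε , 0<ε , N , h) = ½ * ε * (½ * ε) , 0<a*b 0<½ε 0<½ε , N , λ n n≥ →
  let a = seq (re z) n ; b = seq (im z) n
      ½ε≤1-a : ½ * ε ≤ 1ℚ - a
      ½ε≤1-a = gap a b (h n n≥)
  in begin
  0ℚ + ½ * ε * (½ * ε)        ≡⟨ +-identityˡ (½ * ε * (½ * ε)) ⟩
  ½ * ε * (½ * ε)             ≤⟨ *-mono-≤ (≤-trans (<⇒≤ 0<½ε) ½ε≤1-a) (<⇒≤ 0<½ε) ½ε≤1-a ½ε≤1-a ⟩
  (1ℚ - a) * (1ℚ - a)         ≡⟨ sym (+-identityʳ _) ⟩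
  (1ℚ - a) * (1ℚ - a) + 0ℚ    ≤⟨ +-monoʳ-≤ ((1ℚ - a) * (1ℚ - a)) (0≤a*a (0ℚ - b)) ⟩
  normSqAt (1ᶜ -ᶜ z) n        ∎
  where
  open ≤-Reasoning
  open +-*-Solver
  0<½ε : 0ℚ < ½ * ε
  0<½ε = 0<a*b (positive⁻¹ ½) 0<ε
  gap : ∀ a b → a * a + b * b + ε ≤ 1ℚ → ½ * ε ≤ 1ℚ - a
  gap a b le = begin
    ½ * ε
      ≡⟨ sym (+-identityʳ _) ⟩
    ½ * ε + 0ℚ
      ≤⟨ +-monoʳ-≤ (½ * ε) (*-mono-≤ {0ℚ} {½} {0ℚ} (<⇒≤ (positive⁻¹ ½)) ≤-refl
           (<⇒≤ (positive⁻¹ ½)) (+-mono-≤ (0≤a*a (1ℚ - a)) (0≤a*a b))) ⟩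
    ½ * ε + ½ * ((1ℚ - a) * (1ℚ - a) + b * b)
      ≡⟨ solve 3 (λ a b e → con ½ :* e :+ con ½ :* ((con 1ℚ :- a) :* (con 1ℚ :- a) :+ b :* b)
           := con ½ :* (a :* a :+ b :* b :+ e) :+ (con ½ :- a)) refl a b ε ⟩
    ½ * (a * a + b * b + ε) + (½ - a)
      ≤⟨ +-monoˡ-≤ (½ - a) (*-monoˡ-≤-nonNeg ½ le) ⟩
    ½ * 1ℚ + (½ - a)
      ≡⟨ solve 1 (λ a → con ½ :* con 1ℚ :+ (con ½ :- a) := con 1ℚ :- a) refl a ⟩
    1ℚ - a ∎

⟨p⨾p⟩n#0 : ∀ p → ∣ p ∣< 1ℚ → ∀ n → ⟨ p ⨾ p ⟩ n #0
⟨p⨾p⟩n#0 p h zero    = 1#0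
⟨p⨾p⟩n#0 p h (suc n) = *-#0 (⟨ p ⨾ p ⟩ n) (1ᶜ -ᶜ p ^ᶜ suc n)
  (⟨p⨾p⟩n#0 p h n) (1-z#0 (p ^ᶜ suc n) (∣z^[1+n]∣<1 p h n))

-- (q;q)_i (q²;q²)_j (q³;q³)_k
denominator : ℂ → ℕ → ℕ → ℕ → ℂ
denominator q i j k = ⟨ q ⨾ q ⟩ i *ᶜ ⟨ q ^ᶜ 2 ⨾ q ^ᶜ 2 ⟩ j *ᶜ ⟨ q ^ᶜ 3 ⨾ q ^ᶜ 3 ⟩ k

denominator#0 : ∀ q → ∣ q ∣< 1ℚ → ∀ i j k → denominator q i j k #0
denominator#0 q h i j k =
  *-#0 (⟨ q ⨾ q ⟩ i *ᶜ ⟨ q ^ᶜ 2 ⨾ q ^ᶜ 2 ⟩ j) (⟨ q ^ᶜ 3 ⨾ q ^ᶜ 3 ⟩ k)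
    (*-#0 (⟨ q ⨾ q ⟩ i) (⟨ q ^ᶜ 2 ⨾ q ^ᶜ 2 ⟩ j)
      (⟨p⨾p⟩n#0 q h i) (⟨p⨾p⟩n#0 (q ^ᶜ 2) (∣z^[1+n]∣<1 q h 1) j))
    (⟨p⨾p⟩n#0 (q ^ᶜ 3) (∣z^[1+n]∣<1 q h 2) k)

{-# OPTIONS --safe #-}
-- Summing over i by Euler's theorem leaves a double sum; inserting x^(j+k) into it gives a function E(x)
-- which, by a creative-telescoping certificate, satisfies a second-order q⁶-difference equation.  The same
-- equation holds for (-qx;q⁶)∞ ₂φ₁(q^(a+1), q⁵; q^(a+2); q⁶; -qx), with a = 0 for the first identity and
-- a = 8 for the second, and at x = 1 that series is summed by the Bailey–Daum theorem; the products then
-- combine by dissection modulo 2 and 3.  All of this takes place in a commutative ring in which q is nilpotent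
-- and every 1 - q^(m+1) is invertible, such as ℚ[[X]]/X^M, so every sum and product is finite.
--
-- Hence A·B·Σ - 1, cut off to finitely many factors and terms, is a power series divisible by X^M.  Its
-- coefficients are dominated by those of a series which converges at every s < 1, uniformly in the cut-off,
-- so at rational approximations of q its value tends to 0.  A diagonal of these approximations gives
-- the statement over ℂ.
module Submission where

open import Level using (0ℓ)
open import Algebra.Bundles using (CommutativeRing)

-- Both difference equations contain the ratio q·q^(a+1)/q⁶ = q^(a-4), a negative power for a = 0. A
-- nilpotent q cannot be inverted, so the ratio is carried as a pair ν, μ: (q⁴, 1) for the first
-- identity, (1, q⁴) for the second. Sampled at x = q^(6r), the equation becomes a recurrence giving
-- ν times the value at r from those at r + 1 and r + 2. For large r the variable x is 0; there the
-- two solutions are compared directly, and one descends to r = 0. Each step costs a factor ν. For ν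
-- = q⁴ the outcome is multiplied by q^(4d), which is affordable because d steps reach x = 0 when
-- q^(6d) = 0: of 6d coefficients 2d survive.
--
-- On the analytic side, differences of partial products and defects of partial sums are treated
-- alike, as values of series divisible by X^M; taking |q| ≤ s² leaves a spare factor s^M after the
-- majorant at s has been used. That A·B is apart from 0 is read off from the identity itself: A·B·Σ
-- is near 1 while Σ is bounded.

-- Polynomial identities with integer coefficients in an arbitrary commutative ring.

module IntegerSolver (R : CommutativeRing 0ℓ 0ℓ) where

  open CommutativeRing R
  open import Algebra.Properties.Ring ring using (-‿distribˡ-*; -‿distribʳ-*; -‿involutive; -0#≈0#; -‿+-comm)
  open import Algebra.Properties.Semiring.Mult.TCOptimised semiring using (1+×; ×-homo-+; ×1-homo-*) renaming (_×_ to _·_)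
  import Algebra.Solver.Ring as RingSolver
  import Algebra.Solver.Ring.AlmostCommutativeRing as ACR
  open ACR using (_-Raw-AlmostCommutative⟶_)
  open import Data.Nat.Base as ℕ using (ℕ; zero; suc)
  import Data.Nat.Properties as ℕ
  import Data.Integer.Base as ℤ
  open ℤ using (ℤ; +_; -[1+_]; +0; +[1+_]; _⊖_)
  import Data.Integer.Properties as ℤ
  open import Data.Maybe.Base using (Maybe; just; nothing)
  open import Relation.Nullary using (yes; no)
  import Relation.Binary.PropositionalEquality as ≡
  open import Relation.Binary.Reasoning.Setoid setoid

  -- The optimised multiple sends 0 and 1 to the ring's zero and one by computation, so that
  -- `0-homo` and `1-homo` are reflexivity.
  fromℕ : ℕ → Carrier
  fromℕ n = n · 1#

  fromℤ : ℤ → Carrier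
  fromℤ (+ n)    = fromℕ n
  fromℤ -[1+ n ] = - fromℕ (suc n)

  private
    cancel-suc : ∀ a b → (1# + a) + - (1# + b) ≈ a + - b
    cancel-suc a b = begin
      (1# + a) + - (1# + b)      ≈⟨ +-cong (+-comm 1# a) (sym (-‿+-comm 1# b)) ⟩
      (a + 1#) + (- 1# + - b)    ≈⟨ +-assoc a 1# _ ⟩
      a + (1# + (- 1# + - b))    ≈⟨ +-congˡ (sym (+-assoc 1# (- 1#) _)) ⟩
      a + ((1# + - 1#) + - b)    ≈⟨ +-congˡ (+-congʳ (-‿inverseʳ 1#)) ⟩
      a + (0# + - b)             ≈⟨ +-congˡ (+-identityˡ _) ⟩
      a + - b                    ∎

  fromℤ-⊖ : ∀ m n → fromℤ (m ⊖ n) ≈ fromℕ m + - fromℕ n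
  fromℤ-⊖ m zero = sym (trans (+-congˡ -0#≈0#) (+-identityʳ _))
  fromℤ-⊖ zero (suc n) = sym (+-identityˡ _)
  fromℤ-⊖ (suc m) (suc n) = begin
    fromℤ (suc m ⊖ suc n)              ≡⟨ ≡.cong fromℤ (ℤ.[1+m]⊖[1+n]≡m⊖n m n) ⟩
    fromℤ (m ⊖ n)                      ≈⟨ fromℤ-⊖ m n ⟩
    fromℕ m + - fromℕ n                ≈⟨ sym (cancel-suc _ _) ⟩
    (1# + fromℕ m) + - (1# + fromℕ n)  ≈⟨ sym (+-cong (1+× m 1#) (-‿cong (1+× n 1#))) ⟩
    fromℕ (suc m) + - fromℕ (suc n)    ∎

  fromℤ-+ : ∀ x y → fromℤ (x ℤ.+ y) ≈ fromℤ x + fromℤ y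
  fromℤ-+ (+ m) (+ n) = ×-homo-+ 1# m n
  fromℤ-+ (+ m) -[1+ n ] = fromℤ-⊖ m (suc n)
  fromℤ-+ -[1+ m ] (+ n) = trans (fromℤ-⊖ n (suc m)) (+-comm _ _)
  fromℤ-+ -[1+ m ] -[1+ n ] = begin
    - fromℕ (suc (suc (m ℕ.+ n)))        ≡⟨ ≡.cong (λ k → - fromℕ (suc k)) (≡.sym (ℕ.+-suc m n)) ⟩
    - fromℕ (suc m ℕ.+ suc n)            ≈⟨ -‿cong (×-homo-+ 1# (suc m) (suc n)) ⟩
    - (fromℕ (suc m) + fromℕ (suc n))    ≈⟨ sym (-‿+-comm _ _) ⟩
    - fromℕ (suc m) + - fromℕ (suc n)    ∎

  fromℤ-neg : ∀ x → fromℤ (ℤ.- x) ≈ - fromℤ x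
  fromℤ-neg +0       = sym -0#≈0#
  fromℤ-neg +[1+ n ] = refl
  fromℤ-neg -[1+ n ] = sym (-‿involutive _)

  private
    fromℤ-*⁺ : ∀ m n → fromℤ (+ m ℤ.* + n) ≈ fromℕ m * fromℕ n
    fromℤ-*⁺ m n = trans (reflexive (≡.cong fromℤ (≡.sym (ℤ.pos-* m n)))) (×1-homo-* m n)

  fromℤ-* : ∀ x y → fromℤ (x ℤ.* y) ≈ fromℤ x * fromℤ y
  fromℤ-* (+ m) (+ n) = fromℤ-*⁺ m n
  fromℤ-* (+ m) -[1+ n ] = begin
    fromℤ (+ m ℤ.* -[1+ n ])          ≡⟨ ≡.cong fromℤ (≡.sym (ℤ.neg-distribʳ-* (+ m) +[1+ n ])) ⟩
    fromℤ (ℤ.- (+ m ℤ.* +[1+ n ]))    ≈⟨ fromℤ-neg (+ m ℤ.* +[1+ n ]) ⟩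
    - fromℤ (+ m ℤ.* +[1+ n ])        ≈⟨ -‿cong (fromℤ-*⁺ m (suc n)) ⟩
    - (fromℕ m * fromℕ (suc n))       ≈⟨ -‿distribʳ-* _ _ ⟩
    fromℕ m * - fromℕ (suc n)         ∎
  fromℤ-* -[1+ m ] (+ n) = begin
    fromℤ (-[1+ m ] ℤ.* + n)          ≡⟨ ≡.cong fromℤ (≡.sym (ℤ.neg-distribˡ-* +[1+ m ] (+ n))) ⟩
    fromℤ (ℤ.- (+[1+ m ] ℤ.* + n))    ≈⟨ fromℤ-neg (+[1+ m ] ℤ.* + n) ⟩
    - fromℤ (+[1+ m ] ℤ.* + n)        ≈⟨ -‿cong (fromℤ-*⁺ (suc m) n) ⟩
    - (fromℕ (suc m) * fromℕ n)       ≈⟨ -‿distribˡ-* _ _ ⟩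
    - fromℕ (suc m) * fromℕ n         ∎
  fromℤ-* -[1+ m ] -[1+ n ] = begin
    fromℤ (-[1+ m ] ℤ.* -[1+ n ])          ≈⟨ fromℤ-*⁺ (suc m) (suc n) ⟩
    fromℕ (suc m) * fromℕ (suc n)          ≈⟨ sym (-‿involutive _) ⟩
    - - (fromℕ (suc m) * fromℕ (suc n))    ≈⟨ -‿cong (-‿distribˡ-* _ _) ⟩
    - (- fromℕ (suc m) * fromℕ (suc n))    ≈⟨ -‿distribʳ-* _ _ ⟩
    - fromℕ (suc m) * - fromℕ (suc n)      ∎

  morphism : ℤ.+-*-rawRing -Raw-AlmostCommutative⟶ ACR.fromCommutativeRing R
  morphism = record
    { ⟦_⟧ = fromℤ ; +-homo = fromℤ-+ ; *-homo = fromℤ-* ; -‿homo = fromℤ-neg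
    ; 0-homo = refl ; 1-homo = refl }

  private
    fromℤ-≟ : ∀ x y → Maybe (fromℤ x ≈ fromℤ y)
    fromℤ-≟ x y with x ℤ.≟ y
    ... | yes ≡.refl = just refl
    ... | no _       = nothing

  open RingSolver ℤ.+-*-rawRing (ACR.fromCommutativeRing R) morphism fromℤ-≟ public

-- Finite sums and products: shifts of the index and splitting by residue classes.

module FiniteSums (R : CommutativeRing 0ℓ 0ℓ) where

  open CommutativeRing R
  open import Algebra.Properties.CommutativeSemiring.Exp commutativeSemiring
  open IntegerSolver R
  open import Data.Nat.Base as ℕ using (ℕ; zero; suc)
  import Data.Nat.Properties as ℕ
  open import Data.Nat.Solver using (module +-*-Solver)
  open +-*-Solver using () renaming (solve to solveℕ; _:+_ to _⊕_; _:=_ to _⊜_; con to nat)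
  open import Data.Integer.Base using (+_)
  import Relation.Binary.PropositionalEquality as ≡
  open import Relation.Binary.Reasoning.Setoid setoid

  one : ∀ {n} → Polynomial n
  one = con (+ 1)

  Σ[_] : ℕ → (ℕ → Carrier) → Carrier
  Σ[ zero ]  f = 0#
  Σ[ suc n ] f = Σ[ n ] f + f n

  Σ-cong : ∀ n {f g} → (∀ i → f i ≈ g i) → Σ[ n ] f ≈ Σ[ n ] g
  Σ-cong zero    f≈g = refl
  Σ-cong (suc n) f≈g = +-cong (Σ-cong n f≈g) (f≈g n)

  Σ-zero : ∀ n → Σ[ n ] (λ _ → 0#) ≈ 0#
  Σ-zero zero    = refl
  Σ-zero (suc n) = trans (+-identityʳ _) (Σ-zero n)

  Σ-+ : ∀ n f g → Σ[ n ] (λ i → f i + g i) ≈ Σ[ n ] f + Σ[ n ] g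
  Σ-+ zero    f g = sym (+-identityˡ 0#)
  Σ-+ (suc n) f g = trans (+-congʳ (Σ-+ n f g))
    (solve 4 (λ a b c d → (a :+ b) :+ (c :+ d) := (a :+ c) :+ (b :+ d)) refl _ _ _ _)

  Σ-* : ∀ n c f → Σ[ n ] (λ i → c * f i) ≈ c * Σ[ n ] f
  Σ-* zero    c f = sym (zeroʳ c)
  Σ-* (suc n) c f = trans (+-congʳ (Σ-* n c f)) (sym (distribˡ c _ _))

  Σ-swap : ∀ m n (f : ℕ → ℕ → Carrier) →
    Σ[ m ] (λ i → Σ[ n ] (f i)) ≈ Σ[ n ] (λ j → Σ[ m ] (λ i → f i j))
  Σ-swap zero    n f = sym (Σ-zero n)
  Σ-swap (suc m) n f = trans (+-congʳ (Σ-swap m n f)) (sym (Σ-+ n _ _))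

  Σ-head : ∀ n f → Σ[ suc n ] f ≈ f 0 + Σ[ n ] (λ i → f (suc i))
  Σ-head zero    f = +-comm 0# (f 0)
  Σ-head (suc n) f = trans (+-congʳ (Σ-head n f)) (+-assoc _ _ _)

  -- Later shifts of a summation index rest on this. Typically the term at 0 vanishes through a
  -- factor 1 - 1 and the term at n through a power of q that is 0.
  Σ-shift : ∀ n f → f 0 ≈ 0# → f n ≈ 0# → Σ[ n ] f ≈ Σ[ n ] (λ i → f (suc i))
  Σ-shift n f f0 fn = begin
    Σ[ n ] f                             ≈⟨ sym (+-identityʳ _) ⟩
    Σ[ n ] f + 0#                        ≈⟨ +-congˡ (sym fn) ⟩
    Σ[ suc n ] f                         ≈⟨ Σ-head n f ⟩
    f 0 + Σ[ n ] (λ i → f (suc i))       ≈⟨ +-congʳ f0 ⟩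
    0# + Σ[ n ] (λ i → f (suc i))        ≈⟨ +-identityˡ _ ⟩
    Σ[ n ] (λ i → f (suc i))             ∎

  Σ-only-head : ∀ n f → (∀ i → f (suc i) ≈ 0#) → Σ[ suc n ] f ≈ f 0
  Σ-only-head n f f≈0 = begin
    Σ[ suc n ] f                     ≈⟨ Σ-head n f ⟩
    f 0 + Σ[ n ] (λ i → f (suc i))   ≈⟨ +-congˡ (trans (Σ-cong n f≈0) (Σ-zero n)) ⟩
    f 0 + 0#                         ≈⟨ +-identityʳ _ ⟩
    f 0                              ∎

  Σ² : ℕ → (ℕ → ℕ → Carrier) → Carrier
  Σ² n f = Σ[ n ] (λ i → Σ[ n ] (f i))

  Σ²-cong : ∀ n {f g} → (∀ i j → f i j ≈ g i j) → Σ² n f ≈ Σ² n g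
  Σ²-cong n f≈g = Σ-cong n (λ i → Σ-cong n (f≈g i))

  Σ²-+ : ∀ n f g → Σ² n (λ i j → f i j + g i j) ≈ Σ² n f + Σ² n g
  Σ²-+ n f g = trans (Σ-cong n (λ i → Σ-+ n (f i) (g i))) (Σ-+ n _ _)

  Σ²-* : ∀ n c f → Σ² n (λ i j → c * f i j) ≈ c * Σ² n f
  Σ²-* n c f = trans (Σ-cong n (λ i → Σ-* n c (f i))) (Σ-* n c _)

  Σ²-shiftˡ : ∀ n f → (∀ j → f 0 j ≈ 0#) → (∀ j → f n j ≈ 0#) →
    Σ² n f ≈ Σ² n (λ i j → f (suc i) j)
  Σ²-shiftˡ n f f0 fn = Σ-shift n _ (trans (Σ-cong n f0) (Σ-zero n)) (trans (Σ-cong n fn) (Σ-zero n))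

  Σ²-shiftʳ : ∀ n f → (∀ i → f i 0 ≈ 0#) → (∀ i → f i n ≈ 0#) →
    Σ² n f ≈ Σ² n (λ i j → f i (suc j))
  Σ²-shiftʳ n f f0 fn = Σ-cong n (λ i → Σ-shift n (f i) (f0 i) (fn i))

  ^-split : ∀ x {m n} → m ℕ.≤ n → x ^ n ≈ x ^ m * x ^ (n ℕ.∸ m)
  ^-split x {m} {n} m≤n = trans (^-congʳ x (≡.sym (ℕ.m+[n∸m]≡n m≤n))) (^-homo-* x m (n ℕ.∸ m))

  Π[_] : ℕ → (ℕ → Carrier) → Carrier
  Π[ zero ]  f = 1#
  Π[ suc n ] f = Π[ n ] f * f n

  Π-cong : ∀ n {f g} → (∀ i → f i ≈ g i) → Π[ n ] f ≈ Π[ n ] g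
  Π-cong zero    f≈g = refl
  Π-cong (suc n) f≈g = *-cong (Π-cong n f≈g) (f≈g n)

  Π-head : ∀ n f → Π[ suc n ] f ≈ f 0 * Π[ n ] (λ i → f (suc i))
  Π-head zero    f = *-comm 1# (f 0)
  Π-head (suc n) f = trans (*-congʳ (Π-head n f)) (*-assoc _ _ _)

  Π-double : ∀ n f → Π[ n ℕ.+ n ] f ≈ Π[ n ] (λ i → f (i ℕ.+ i)) * Π[ n ] (λ i → f (suc (i ℕ.+ i)))
  Π-double zero    f = sym (*-identityˡ 1#)
  Π-double (suc n) f rewrite ℕ.+-suc n n = trans (*-congʳ (*-congʳ (Π-double n f)))
    (solve 4 (λ a b c d → a :* b :* c :* d := (a :* c) :* (b :* d)) refl _ _ _ _)

  Π-stable : ∀ m n f → (∀ i → m ℕ.≤ i → f i ≈ 1#) → Π[ n ℕ.+ m ] f ≈ Π[ m ] f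
  Π-stable m zero    f f≈1 = refl
  Π-stable m (suc n) f f≈1 =
    trans (*-cong (Π-stable m n f f≈1) (f≈1 (n ℕ.+ m) (ℕ.m≤n+m m n))) (*-identityʳ _)

  Π-triple : ∀ n f → Π[ n ℕ.+ n ℕ.+ n ] f ≈ Π[ n ] (λ i → f (i ℕ.+ i ℕ.+ i))
    * Π[ n ] (λ i → f (suc (i ℕ.+ i ℕ.+ i))) * Π[ n ] (λ i → f (suc (suc (i ℕ.+ i ℕ.+ i))))
  Π-triple zero    f = solve 0 (one := one :* one :* one) refl
  Π-triple (suc n) f = begin
    Π[ suc n ℕ.+ suc n ℕ.+ suc n ] f    ≡⟨ ≡.cong (λ m → Π[ m ] f)
      (solveℕ 1 (λ n → (nat 1 ⊕ n) ⊕ (nat 1 ⊕ n) ⊕ (nat 1 ⊕ n) ⊜ nat 3 ⊕ (n ⊕ n ⊕ n)) ≡.refl n) ⟩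
    Π[ n ℕ.+ n ℕ.+ n ] f * a * b * c    ≈⟨ *-congʳ (*-congʳ (*-congʳ (Π-triple n f))) ⟩
    (_ * _ * _) * a * b * c
      ≈⟨ solve 6 (λ x y z a b c → (x :* y :* z) :* a :* b :* c := (x :* a) :* (y :* b) :* (z :* c)) refl _ _ _ a b c ⟩
    _ ∎
    where
    a = f (n ℕ.+ n ℕ.+ n)
    b = f (suc (n ℕ.+ n ℕ.+ n))
    c = f (suc (suc (n ℕ.+ n ℕ.+ n)))

  Σ³ : ℕ → (ℕ → ℕ → ℕ → Carrier) → Carrier
  Σ³ n f = Σ[ n ] (λ i → Σ² n (f i))

  Σ³-rotate : ∀ n f → Σ³ n f ≈ Σ² n (λ j k → Σ[ n ] (λ i → f i j k))
  Σ³-rotate n f = trans (Σ-swap n n _) (Σ-cong n (λ j → Σ-swap n n (λ i → f i j)))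

  1^n≈1 : ∀ n → 1# ^ n ≈ 1#
  1^n≈1 zero    = refl
  1^n≈1 (suc n) = trans (*-identityˡ _) (1^n≈1 n)

-- q-series with nilpotent q: telescoping, descent, Euler's theorem, the q-binomial theorem.

module QSeries (R : CommutativeRing 0ℓ 0ℓ) where

  open CommutativeRing R
  open import Algebra.Properties.CommutativeSemiring.Exp commutativeSemiring
  open IntegerSolver R
  open FiniteSums R
  open import Data.Nat.Base as ℕ using (ℕ; zero; suc)
  open import Data.Nat.Combinatorics using (_C_; nC1≡n; nCk+nC[k+1]≡[n+1]C[k+1])
  import Data.Nat.Properties as ℕ
  open import Data.Nat.Solver using (module +-*-Solver)
  open +-*-Solver using () renaming (solve to solveℕ; _:+_ to _⊕_; _:*_ to _⊗_; _:=_ to _⊜_; con to nat; _:^_ to _⊛_)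
  open import Data.Integer.Base using (+_)
  open import Relation.Binary.PropositionalEquality as ≡ using (_≡_)
  open import Relation.Binary.Reasoning.Setoid setoid

  C2-suc : ∀ n → suc n C 2 ≡ n C 2 ℕ.+ n
  C2-suc n = ≡.trans (≡.sym (nCk+nC[k+1]≡[n+1]C[k+1] n 1))
    (≡.trans (≡.cong (ℕ._+ n C 2) (nC1≡n n)) (ℕ.+-comm n (n C 2)))

  C2-+ : ∀ i n → (i ℕ.+ n) C 2 ≡ i C 2 ℕ.+ n C 2 ℕ.+ i ℕ.* n
  C2-+ zero    n = ≡.sym (ℕ.+-identityʳ (n C 2))
  C2-+ (suc i) n = ≡.trans (C2-suc (i ℕ.+ n)) (≡.trans (≡.cong (ℕ._+ (i ℕ.+ n)) (C2-+ i n))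
    (≡.trans (solveℕ 4 (λ a b i n → a ⊕ b ⊕ i ⊗ n ⊕ (i ⊕ n) ⊜ a ⊕ i ⊕ b ⊕ (nat 1 ⊕ i) ⊗ n) ≡.refl (i C 2) (n C 2) i n)
      (≡.cong (λ m → m ℕ.+ n C 2 ℕ.+ suc i ℕ.* n) (≡.sym (C2-suc i)))))

  -- Shifting a + g in j and g in k, then summing the pointwise relation, gives Σa + Σb = -Σy; a
  -- shift of y in j gives Σc = Σy. At j = 0 only the sum a + g has to vanish, so that g may absorb
  -- the boundary term of a.
  telescope : ∀ n (a b c g y : ℕ → ℕ → Carrier) →
    (∀ k → a 0 k + g 0 k ≈ 0#) → (∀ k → a n k + g n k ≈ 0#) →
    (∀ j → g j 0 ≈ 0#) → (∀ j → g j n ≈ 0#) →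
    (∀ k → y 0 k ≈ 0#) → (∀ k → y n k ≈ 0#) →
    (∀ j k → b j k + (a (suc j) k + g (suc j) k) - g j (suc k) ≈ - y j k) →
    (∀ j k → c j k ≈ y (suc j) k) →
    Σ² n a + Σ² n b + Σ² n c ≈ 0#
  telescope n a b c g y ag0 agn g0 gn y0 yn step c≈y = begin
    Σ² n a + Σ² n b + Σ² n c
      ≈⟨ solve 4 (λ a b c g → a :+ b :+ c := (b :+ (a :+ g) :+ (:- one) :* g) :+ c) refl _ _ _ _ ⟩
    (Σ² n b + (Σ² n a + Σ² n g) + - 1# * Σ² n g) + Σ² n c
      ≈⟨ +-cong (+-cong (+-congˡ (trans (sym (Σ²-+ n a g)) (Σ²-shiftˡ n _ ag0 agn)))
           (trans (*-congˡ (Σ²-shiftʳ n g g0 gn)) (sym (Σ²-* n _ _))))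
           (trans (Σ²-cong n c≈y) (sym (Σ²-shiftˡ n y y0 yn))) ⟩
    (Σ² n b + Σ² n (λ j k → a (suc j) k + g (suc j) k) + Σ² n (λ j k → - 1# * g j (suc k))) + Σ² n y
      ≈⟨ sym (trans (Σ²-+ n _ _) (+-congʳ (trans (Σ²-+ n _ _) (+-congʳ (Σ²-+ n _ _))))) ⟩
    Σ² n (λ j k → (b j k + (a (suc j) k + g (suc j) k) + - 1# * g j (suc k)) + y j k)
      ≈⟨ Σ²-cong n (λ j k → trans (+-congʳ (trans (+-congˡ (solve 1 (λ g → (:- one) :* g := :- g) refl _)) (step j k))) (-‿inverseˡ _)) ⟩
    Σ² n (λ _ _ → 0#)   ≈⟨ trans (Σ-cong n (λ _ → Σ-zero n)) (Σ-zero n) ⟩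
    0#                  ∎

  -- Powers of ν are collected instead of cancelled, since ν may be nilpotent. The induction is on
  -- the number m of steps left, under the invariant d ≤ m + r; the values at r + 1 and r + 2 both
  -- need only ν^m.
  descend : ∀ ν (D s t : ℕ → Carrier) d →
    (∀ r → ν * D r ≈ s r * D (suc r) - t r * D (suc (suc r))) →
    (∀ r → d ℕ.≤ r → D r ≈ 0#) → ν ^ d * D 0 ≈ 0#
  descend ν D s t d step D≈0 = go d 0 (ℕ.m≤m+n d 0)
    where
    go : ∀ m r → d ℕ.≤ m ℕ.+ r → ν ^ m * D r ≈ 0#
    go zero    r d≤r = trans (*-identityˡ _) (D≈0 r d≤r)
    go (suc m) r d≤r = begin
      ν * ν ^ m * D r        ≈⟨ solve 3 (λ a b c → a :* b :* c := b :* (a :* c)) refl _ _ _ ⟩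
      ν ^ m * (ν * D r)      ≈⟨ *-congˡ (step r) ⟩
      ν ^ m * (s r * D (suc r) - t r * D (suc (suc r)))
        ≈⟨ solve 5 (λ n s a t b → n :* (s :* a :- t :* b) := s :* (n :* a) :- t :* (n :* b)) refl _ _ _ _ _ ⟩
      s r * (ν ^ m * D (suc r)) - t r * (ν ^ m * D (suc (suc r)))
        ≈⟨ +-cong (*-congˡ (go m (suc r) d≤₁)) (-‿cong (*-congˡ (go m (suc (suc r)) d≤₂))) ⟩
      s r * 0# - t r * 0#
        ≈⟨ solve 2 (λ s t → s :* con (+ 0) :- t :* con (+ 0) := con (+ 0)) refl _ _ ⟩
      0#                     ∎
      where
      d≤₁ : d ℕ.≤ m ℕ.+ suc r
      d≤₁ = ℕ.≤-trans d≤r (ℕ.≤-reflexive (≡.sym (ℕ.+-suc m r)))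
      d≤₂ : d ℕ.≤ m ℕ.+ suc (suc r)
      d≤₂ = ℕ.≤-trans d≤₁ (ℕ.+-monoʳ-≤ m (ℕ.n≤1+n (suc r)))

  module Nilpotent
    (q : Carrier) (inv : ℕ → Carrier) (inv-spec : ∀ m → (1# - q ^ suc m) * inv m ≈ 1#)
    (l : ℕ) (nil : q ^ suc l ≈ 0#) where

    -- One number is both the nilpotency order and the length of the sums and products below, so
    -- that the omitted terms are exactly 0 and the omitted factors exactly 1.
    L : ℕ
    L = suc l

    q^-vanish : ∀ n z → L ℕ.≤ n → q ^ n * z ≈ 0#
    q^-vanish n z L≤n = trans (*-congʳ (trans (^-split q L≤n) (trans (*-congʳ nil) (zeroˡ _)))) (zeroˡ z)

    q^-zero : ∀ n → L ℕ.≤ n → q ^ n ≈ 0#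
    q^-zero n L≤n = trans (sym (*-identityʳ _)) (q^-vanish n 1# L≤n)

    -- u c n = 1 / (q^(c+1);q^(c+1))ₙ
    u : ℕ → ℕ → Carrier
    u c zero    = 1#
    u c (suc n) = u c n * inv (n ℕ.+ c ℕ.* suc n)

    u-spec : ∀ c n → (1# - q ^ (suc c ℕ.* suc n)) * u c (suc n) ≈ u c n
    u-spec c n = begin
      (1# - q ^ suc m) * (u c n * inv m)   ≈⟨ solve 3 (λ a b c → a :* (b :* c) := b :* (a :* c)) refl _ _ _ ⟩
      u c n * ((1# - q ^ suc m) * inv m)   ≈⟨ *-congˡ (inv-spec m) ⟩
      u c n * 1#                           ≈⟨ *-identityʳ _ ⟩
      u c n                                ∎
      where m = n ℕ.+ c ℕ.* suc n

    -- e m = (-q^(m+1);q)∞ by Euler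
    e : ℕ → Carrier
    e m = Σ[ L ] (λ i → q ^ (i C 2 ℕ.+ i ℕ.* suc m) * u 0 i)

    -- The i-th term of the difference of the two series has the factor 1 - q^i, which lowers the
    -- index of `u`; after a shift in i, q^(m+1) times the second series remains.
    e-step : ∀ m → e m ≈ (1# + q ^ suc m) * e (suc m)
    e-step m = begin
      e m                          ≈⟨ solve 2 (λ a b → a := (a :+ :- one :* b) :+ b) refl _ _ ⟩
      (e m + - 1# * e (suc m)) + e (suc m)
        ≈⟨ +-congʳ (trans (+-congˡ (sym (Σ-* L _ _))) (sym (Σ-+ L _ _))) ⟩
      Σ[ L ] diff + e (suc m)      ≈⟨ +-congʳ (Σ-shift L diff diff-0 diff-L) ⟩
      Σ[ L ] (λ i → diff (suc i)) + e (suc m)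
        ≈⟨ +-congʳ (trans (Σ-cong L diff-suc) (Σ-* L _ _)) ⟩
      q ^ suc m * e (suc m) + e (suc m)
        ≈⟨ solve 2 (λ a b → a :* b :+ b := (one :+ a) :* b) refl _ _ ⟩
      (1# + q ^ suc m) * e (suc m) ∎
      where
      ex : ℕ → ℕ → ℕ
      ex i m = i C 2 ℕ.+ i ℕ.* suc m
      diff : ℕ → Carrier
      diff i = q ^ ex i m * u 0 i + - 1# * (q ^ ex i (suc m) * u 0 i)
      diff-factor : ∀ i → diff i ≈ q ^ ex i m * ((1# - q ^ (1 ℕ.* i)) * u 0 i)
      diff-factor i = begin
        q ^ ex i m * u 0 i + - 1# * (q ^ ex i (suc m) * u 0 i)
          ≈⟨ +-congˡ (*-congˡ (*-congʳ (trans (^-congʳ q exponent) (^-homo-* q (ex i m) (1 ℕ.* i))))) ⟩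
        q ^ ex i m * u 0 i + - 1# * (q ^ ex i m * q ^ (1 ℕ.* i) * u 0 i)
          ≈⟨ solve 3 (λ a b c → a :* c :+ :- one :* (a :* b :* c) := a :* ((one :- b) :* c)) refl _ _ _ ⟩
        q ^ ex i m * ((1# - q ^ (1 ℕ.* i)) * u 0 i) ∎
        where
        exponent : ex i (suc m) ≡ ex i m ℕ.+ 1 ℕ.* i
        exponent = solveℕ 3 (λ c i m → c ⊕ i ⊗ (nat 1 ⊕ (nat 1 ⊕ m)) ⊜ c ⊕ i ⊗ (nat 1 ⊕ m) ⊕ nat 1 ⊗ i)
          ≡.refl (i C 2) i m
      diff-0 : diff 0 ≈ 0#
      diff-0 = trans (diff-factor 0) (solve 0 (one :* ((one :- one) :* one) := con (+ 0)) refl)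
      diff-L : diff L ≈ 0#
      diff-L = trans (diff-factor L)
        (q^-vanish _ _ (ℕ.≤-trans (ℕ.m≤m*n L (suc m)) (ℕ.m≤n+m _ (L C 2))))
      diff-suc : ∀ i → diff (suc i) ≈ q ^ suc m * (q ^ ex i (suc m) * u 0 i)
      diff-suc i = begin
        diff (suc i)                       ≈⟨ diff-factor (suc i) ⟩
        q ^ ex (suc i) m * ((1# - q ^ (1 ℕ.* suc i)) * u 0 (suc i))
          ≈⟨ *-cong (trans (^-congʳ q exponent) (^-homo-* q (suc m) (ex i (suc m)))) (u-spec 0 i) ⟩
        q ^ suc m * q ^ ex i (suc m) * u 0 i  ≈⟨ *-assoc _ _ _ ⟩
        q ^ suc m * (q ^ ex i (suc m) * u 0 i) ∎
        where
        exponent : ex (suc i) m ≡ suc m ℕ.+ ex i (suc m)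
        exponent = ≡.trans (≡.cong (ℕ._+ suc i ℕ.* suc m) (C2-suc i))
          (solveℕ 3 (λ c i m → c ⊕ i ⊕ (nat 1 ⊕ i) ⊗ (nat 1 ⊕ m)
            ⊜ nat 1 ⊕ m ⊕ (c ⊕ i ⊗ (nat 1 ⊕ (nat 1 ⊕ m)))) ≡.refl (i C 2) i m)

    e-const : ∀ m → L ℕ.≤ suc m → e m ≈ 1#
    e-const m L≤m = trans (Σ-only-head l _ (λ i → q^-vanish _ (u 0 (suc i))
        (ℕ.≤-trans L≤m (ℕ.≤-trans (ℕ.m≤m+n (suc m) (i ℕ.* suc m)) (ℕ.m≤n+m _ (suc i C 2))))))
      (*-identityˡ 1#)

    -- Coefficients (q^γ;q^(c+1))ₙ / (q^(c+1);q^(c+1))ₙ and the series of the q-binomial theorem.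
    coeff : ℕ → ℕ → ℕ → Carrier
    coeff γ c zero    = 1#
    coeff γ c (suc n) = coeff γ c n * ((1# - q ^ (γ ℕ.+ suc c ℕ.* n)) * inv (n ℕ.+ c ℕ.* suc n))

    h : ℕ → ℕ → Carrier → Carrier
    h γ c z = Σ[ L ] (λ n → coeff γ c n * z ^ n)

    -- This is the purpose of the hypothesis z ≈ q w in the difference equations below: the boundary
    -- term created by cutting a series at L vanishes.
    ^L-vanish : ∀ {z w} a → z ≈ q * w → a * z ^ L ≈ 0#
    ^L-vanish {z} {w} a z≈qw = begin
      a * z ^ L          ≈⟨ *-congˡ (trans (^-congˡ L z≈qw) (^-distrib-* q w L)) ⟩
      a * (q ^ L * w ^ L) ≈⟨ *-congˡ (q^-vanish L _ ℕ.≤-refl) ⟩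
      a * 0#             ≈⟨ zeroʳ a ⟩
      0#                 ∎

    coeff-spec : ∀ γ c n → (1# - q ^ (suc c ℕ.* suc n)) * coeff γ c (suc n) ≈ (1# - q ^ (γ ℕ.+ suc c ℕ.* n)) * coeff γ c n
    coeff-spec γ c n = begin
      (1# - q ^ suc m) * (coeff γ c n * (b * inv m))
        ≈⟨ solve 4 (λ a b c d → a :* (c :* (b :* d)) := b :* c :* (a :* d)) refl _ _ _ _ ⟩
      b * coeff γ c n * ((1# - q ^ suc m) * inv m)    ≈⟨ *-congˡ (inv-spec m) ⟩
      b * coeff γ c n * 1#                            ≈⟨ *-identityʳ _ ⟩
      b * coeff γ c n                                 ∎
      where
      m = n ℕ.+ c ℕ.* suc n
      b = 1# - q ^ (γ ℕ.+ suc c ℕ.* n)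

    [pz]^ : ∀ c z n → (q ^ c * z) ^ n ≈ q ^ (c ℕ.* n) * z ^ n
    [pz]^ c z n = trans (^-distrib-* (q ^ c) z n) (*-congʳ (^-assocʳ q c n))

    h-cong : ∀ γ c {z w} → z ≈ w → h γ c z ≈ h γ c w
    h-cong γ c z≈w = Σ-cong L (λ n → *-congˡ (^-congˡ n z≈w))

    h-zero : ∀ γ c {z} → z ≈ 0# → h γ c z ≈ 1#
    h-zero γ c {z} z≈0 = trans (Σ-only-head l (λ n → coeff γ c n * z ^ n) (λ n → trans (*-congˡ (trans (*-congʳ z≈0) (zeroˡ _))) (zeroʳ _)))
      (*-identityˡ 1#)

    -- The difference equation of ₁φ₀. In the recursion of the coefficients, multiplication by
    -- q^((c+1)n) amounts to dilating the argument by q^(c+1); hence the two terms that appear after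
    -- the shift.
    h-step : ∀ γ c {z w} → z ≈ q * w → (1# - z) * h γ c z ≈ (1# - q ^ γ * z) * h γ c (q ^ suc c * z)
    h-step γ c {z} {w} z≈qw = begin
      (1# - z) * H z
        ≈⟨ solve 3 (λ z a b → (one :- z) :* a := (a :+ :- one :* b) :+ (b :- z :* a)) refl z (H z) (H pz) ⟩
      (H z + - 1# * H pz) + (H pz - z * H z)
        ≈⟨ +-congʳ (trans (+-congˡ (sym (Σ-* L _ _))) (sym (Σ-+ L _ _))) ⟩
      Σ[ L ] diff + (H pz - z * H z)
        ≈⟨ +-congʳ (Σ-shift L diff diff-0 (trans (diff-factor L) (^L-vanish _ z≈qw))) ⟩
      Σ[ L ] (λ n → diff (suc n)) + (H pz - z * H z)
        ≈⟨ +-congʳ (trans (Σ-cong L diff-suc) (trans (Σ-+ L _ _) (+-cong (Σ-* L _ _) (Σ-* L _ _)))) ⟩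
      (z * H z + (- (q ^ γ * z)) * H pz) + (H pz - z * H z)
        ≈⟨ solve 4 (λ z a b g → (z :* a :+ (:- (g :* z)) :* b) :+ (b :- z :* a) := (one :- g :* z) :* b) refl z (H z) (H pz) (q ^ γ) ⟩
      (1# - q ^ γ * z) * H pz ∎
      where
      H = h γ c
      pz = q ^ suc c * z
      diff : ℕ → Carrier
      diff n = coeff γ c n * z ^ n + - 1# * (coeff γ c n * pz ^ n)
      diff-factor : ∀ n → diff n ≈ ((1# - q ^ (suc c ℕ.* n)) * coeff γ c n) * z ^ n
      diff-factor n = trans (+-congˡ (*-congˡ (*-congˡ ([pz]^ (suc c) z n))))
        (solve 3 (λ a b p → a :* b :+ :- one :* (a :* (p :* b)) := ((one :- p) :* a) :* b) refl _ _ _)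
      diff-0 : diff 0 ≈ 0#
      diff-0 = solve 0 (one :* one :+ :- one :* (one :* one) := con (+ 0)) refl
      diff-suc : ∀ n → diff (suc n) ≈ z * (coeff γ c n * z ^ n) + (- (q ^ γ * z)) * (coeff γ c n * pz ^ n)
      diff-suc n = begin
        diff (suc n)  ≈⟨ diff-factor (suc n) ⟩
        ((1# - q ^ (suc c ℕ.* suc n)) * coeff γ c (suc n)) * (z * z ^ n)
          ≈⟨ *-congʳ (trans (coeff-spec γ c n) (*-congʳ (+-congˡ (-‿cong (^-homo-* q γ (suc c ℕ.* n)))))) ⟩
        ((1# - q ^ γ * q ^ (suc c ℕ.* n)) * coeff γ c n) * (z * z ^ n)
          ≈⟨ solve 5 (λ g p k z w → ((one :- g :* p) :* k) :* (z :* w)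
               := z :* (k :* w) :+ (:- (g :* z)) :* (k :* (p :* w))) refl _ _ _ _ _ ⟩
        z * (coeff γ c n * z ^ n) + (- (q ^ γ * z)) * (coeff γ c n * (q ^ (suc c ℕ.* n) * z ^ n))
          ≈⟨ +-congˡ (*-congˡ (*-congˡ (sym ([pz]^ (suc c) z n)))) ⟩
        z * (coeff γ c n * z ^ n) + (- (q ^ γ * z)) * (coeff γ c n * pz ^ n) ∎

    -- (q^a;q^b)_N
    poch : ℕ → ℕ → ℕ → Carrier
    poch a b N = Π[ N ] (λ n → 1# - q ^ (a ℕ.+ b ℕ.* n))

    L≤a+b*L : ∀ a b → L ℕ.≤ a ℕ.+ suc b ℕ.* L
    L≤a+b*L a b = ℕ.≤-trans (ℕ.m≤m+n L (b ℕ.* L)) (ℕ.m≤n+m _ a)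

    -- The q-binomial theorem at q^(a+1) in base q^(c+1), free of division. Each use of `h-step`
    -- adds one factor on either side and dilates the argument; after L uses the argument is 0 and
    -- the series is 1.
    poch-h : ∀ γ a c → poch (suc a) (suc c) L * h γ c (q ^ suc a) ≈ poch (γ ℕ.+ suc a) (suc c) L
    poch-h γ a c = begin
      poch (suc a) (suc c) L * h γ c (q ^ suc a)
        ≈⟨ *-congˡ (h-cong γ c (^-congʳ q (≡.trans (≡.sym (ℕ.+-identityʳ (suc a))) (≡.cong (suc a ℕ.+_) (≡.sym (ℕ.*-zeroʳ (suc c))))))) ⟩
      poch (suc a) (suc c) L * h γ c (q ^ (suc a ℕ.+ suc c ℕ.* 0))      ≈⟨ go L ⟩
      poch (γ ℕ.+ suc a) (suc c) L * h γ c (q ^ (suc a ℕ.+ suc c ℕ.* L))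
        ≈⟨ *-congˡ (h-zero γ c (q^-zero _ (L≤a+b*L (suc a) c))) ⟩
      poch (γ ℕ.+ suc a) (suc c) L * 1#                                 ≈⟨ *-identityʳ _ ⟩
      poch (γ ℕ.+ suc a) (suc c) L                                      ∎
      where
      z : ℕ → Carrier
      z n = q ^ (suc a ℕ.+ suc c ℕ.* n)
      next : ∀ n → q ^ suc c * z n ≈ z (suc n)
      next n = trans (sym (^-homo-* q (suc c) _)) (^-congʳ q
        (solveℕ 3 (λ a c n → (nat 1 ⊕ c) ⊕ ((nat 1 ⊕ a) ⊕ (nat 1 ⊕ c) ⊗ n)
          ⊜ (nat 1 ⊕ a) ⊕ (nat 1 ⊕ c) ⊗ (nat 1 ⊕ n)) ≡.refl a c n))
      go : ∀ N → poch (suc a) (suc c) N * h γ c (z 0) ≈ poch (γ ℕ.+ suc a) (suc c) N * h γ c (z N)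
      go zero    = refl
      go (suc N) = begin
        (poch (suc a) (suc c) N * (1# - z N)) * h γ c (z 0)
          ≈⟨ solve 3 (λ a b c → (a :* b) :* c := b :* (a :* c)) refl _ _ _ ⟩
        (1# - z N) * (poch (suc a) (suc c) N * h γ c (z 0))     ≈⟨ *-congˡ (go N) ⟩
        (1# - z N) * (poch (γ ℕ.+ suc a) (suc c) N * h γ c (z N))
          ≈⟨ solve 3 (λ a b c → b :* (a :* c) := a :* (b :* c)) refl _ _ _ ⟩
        poch (γ ℕ.+ suc a) (suc c) N * ((1# - z N) * h γ c (z N))
          ≈⟨ *-congˡ (trans (h-step γ c refl) (*-cong
               (+-congˡ (-‿cong (trans (sym (^-homo-* q γ _)) (^-congʳ q (≡.sym (ℕ.+-assoc γ (suc a) _))))))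
               (h-cong γ c (next N)))) ⟩
        poch (γ ℕ.+ suc a) (suc c) N * ((1# - q ^ ((γ ℕ.+ suc a) ℕ.+ suc c ℕ.* N)) * h γ c (z (suc N)))
          ≈⟨ sym (*-assoc _ _ _) ⟩
        poch (γ ℕ.+ suc a) (suc c) (suc N) * h γ c (z (suc N)) ∎

    -- The hypergeometric side: the difference equation of ₂φ₁ and its value at x = 1.

    module BaileyDaum (a : ℕ) (ν μ : Carrier) (νμ : ν * q ^ suc a * q ≈ μ * q ^ 6) where
      -- With B = q⁵ and Q = q⁶ one has Q/B = q. So the lower parameter AQ/B required by Bailey-Daum
      -- is qA, and the required argument -Q/B is -q.
      A = q ^ suc a
      B = q ^ 5
      Q = q ^ 6

      -- The coefficients of ₂φ₁(A, B; qA; Q; z).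
      φ : ℕ → Carrier
      φ zero    = 1#
      φ (suc s) = φ s * ((1# - q ^ (suc a ℕ.+ 6 ℕ.* s)) * (1# - q ^ (5 ℕ.+ 6 ℕ.* s))
                         * (inv (s ℕ.+ 5 ℕ.* suc s) * inv (suc a ℕ.+ 6 ℕ.* s)))

      φ-spec : ∀ s → (1# - q ^ (6 ℕ.* suc s)) * ((1# - q ^ suc (suc a ℕ.+ 6 ℕ.* s)) * φ (suc s))
                   ≈ (1# - A * q ^ (6 ℕ.* s)) * (1# - B * q ^ (6 ℕ.* s)) * φ s
      φ-spec s = begin
        x * (y * (φ s * (α * β * (i * j))))
          ≈⟨ solve 7 (λ x y f α β i j → x :* (y :* (f :* (α :* β :* (i :* j))))
               := α :* β :* f :* ((x :* i) :* (y :* j))) refl x y (φ s) α β i j ⟩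
        α * β * φ s * ((x * i) * (y * j))  ≈⟨ *-congˡ (*-cong (inv-spec _) (inv-spec _)) ⟩
        α * β * φ s * (1# * 1#)            ≈⟨ trans (*-congˡ (*-identityˡ 1#)) (*-identityʳ _) ⟩
        α * β * φ s
          ≈⟨ *-congʳ (*-cong (+-congˡ (-‿cong (^-homo-* q (suc a) _))) (+-congˡ (-‿cong (^-homo-* q 5 (6 ℕ.* s))))) ⟩
        (1# - A * q ^ (6 ℕ.* s)) * (1# - B * q ^ (6 ℕ.* s)) * φ s ∎
        where
        x = 1# - q ^ (6 ℕ.* suc s)
        y = 1# - q ^ suc (suc a ℕ.+ 6 ℕ.* s)
        α = 1# - q ^ (suc a ℕ.+ 6 ℕ.* s)
        β = 1# - q ^ (5 ℕ.+ 6 ℕ.* s)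
        i = inv (s ℕ.+ 5 ℕ.* suc s)
        j = inv (suc a ℕ.+ 6 ℕ.* s)

      F : Carrier → Carrier
      F z = Σ[ L ] (λ s → φ s * z ^ s)

      F-cong : ∀ {z w} → z ≈ w → F z ≈ F w
      F-cong z≈w = Σ-cong L (λ s → *-congˡ (^-congˡ s z≈w))

      -- Let T be the dilation z ↦ Qz. The coefficient recursion says (1 - T)(ν - μT)F = νz(1 -
      -- AT)(1 - BT)F, because `νμ` makes ν - μQ^(s+1) equal to ν(1 - qAQ^s). Here this equation is
      -- solved for the undilated term.
      F-step : ∀ {z w} → z ≈ q * w →
        ν * (1# - z) * F z ≈ ((ν + μ) - ν * z * (A + B)) * F (Q * z) - (μ - ν * z * A * B) * F (Q * (Q * z))
      F-step {z} {w} z≈qw = begin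
        ν * (1# - z) * F z
          ≈⟨ solve 6 (λ ν μ z f g h → ν :* (one :- z) :* f
               := (ν :* f :+ (:- (ν :+ μ)) :* g :+ μ :* h) :+ (:- (ν :* z)) :* f :+ (ν :+ μ) :* g :- μ :* h)
               refl ν μ z _ _ _ ⟩
        (ν * F z + (- (ν + μ)) * F (Q * z) + μ * F (Q * (Q * z)))
          + (- (ν * z)) * F z + (ν + μ) * F (Q * z) - μ * F (Q * (Q * z))
          ≈⟨ +-congʳ (+-congʳ (+-congʳ combine)) ⟩
        (ν * z * F z + (- (ν * z * (A + B))) * F (Q * z) + (ν * z * A * B) * F (Q * (Q * z)))
          + (- (ν * z)) * F z + (ν + μ) * F (Q * z) - μ * F (Q * (Q * z))
          ≈⟨ solve 8 (λ ν μ z a b f g h → (ν :* z :* f :+ (:- (ν :* z :* (a :+ b))) :* g :+ (ν :* z :* a :* b) :* h)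
               :+ (:- (ν :* z)) :* f :+ (ν :+ μ) :* g :- μ :* h
               := ((ν :+ μ) :- ν :* z :* (a :+ b)) :* g :- (μ :- ν :* z :* a :* b) :* h)
               refl ν μ z A B _ _ _ ⟩
        ((ν + μ) - ν * z * (A + B)) * F (Q * z) - (μ - ν * z * A * B) * F (Q * (Q * z)) ∎
        where
        lin : ∀ c₁ c₂ c₃ →
          Σ[ L ] (λ s → c₁ * (φ s * z ^ s) + c₂ * (φ s * (Q * z) ^ s) + c₃ * (φ s * (Q * (Q * z)) ^ s))
          ≈ c₁ * F z + c₂ * F (Q * z) + c₃ * F (Q * (Q * z))
        lin c₁ c₂ c₃ = trans (Σ-+ L _ _) (+-cong (trans (Σ-+ L _ _) (+-cong (Σ-* L c₁ _) (Σ-* L c₂ _))) (Σ-* L c₃ _))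
        pow² : ∀ s → (Q * (Q * z)) ^ s ≈ q ^ (6 ℕ.* s) * (q ^ (6 ℕ.* s) * z ^ s)
        pow² s = trans ([pz]^ 6 (Q * z) s) (*-congˡ ([pz]^ 6 z s))
        diff : ℕ → Carrier
        diff s = ν * (φ s * z ^ s) + (- (ν + μ)) * (φ s * (Q * z) ^ s) + μ * (φ s * (Q * (Q * z)) ^ s)
        diff-factor : ∀ s → diff s ≈ ((1# - q ^ (6 ℕ.* s)) * (ν - μ * q ^ (6 ℕ.* s)) * φ s) * z ^ s
        diff-factor s = trans (+-cong (+-congˡ (*-congˡ (*-congˡ ([pz]^ 6 z s)))) (*-congˡ (*-congˡ (pow² s))))
          (solve 5 (λ ν μ f t w → ν :* (f :* w) :+ (:- (ν :+ μ)) :* (f :* (t :* w)) :+ μ :* (f :* (t :* (t :* w)))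
            := ((one :- t) :* (ν :- μ :* t) :* f) :* w) refl ν μ _ _ _)
        diff-0 : diff 0 ≈ 0#
        diff-0 = solve 2 (λ ν μ → ν :* (one :* one) :+ (:- (ν :+ μ)) :* (one :* one) :+ μ :* (one :* one) := con (+ 0)) refl ν μ
        ν-μt : ∀ s → ν - μ * q ^ (6 ℕ.* suc s) ≈ ν * (1# - q ^ suc (suc a ℕ.+ 6 ℕ.* s))
        ν-μt s = begin
          ν - μ * q ^ (6 ℕ.* suc s)
            ≈⟨ +-congˡ (-‿cong (*-congˡ (trans (^-congʳ q (ℕ.*-suc 6 s)) (^-homo-* q 6 (6 ℕ.* s))))) ⟩
          ν - μ * (Q * q ^ (6 ℕ.* s))          ≈⟨ +-congˡ (-‿cong (sym (*-assoc _ _ _))) ⟩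
          ν - μ * Q * q ^ (6 ℕ.* s)            ≈⟨ +-congˡ (-‿cong (*-congʳ (sym νμ))) ⟩
          ν - ν * A * q * q ^ (6 ℕ.* s)
            ≈⟨ solve 4 (λ ν a q t → ν :- ν :* a :* q :* t := ν :* (one :- q :* (a :* t))) refl ν A q _ ⟩
          ν * (1# - q * (A * q ^ (6 ℕ.* s)))   ≈⟨ *-congˡ (+-congˡ (-‿cong (*-congˡ (sym (^-homo-* q (suc a) _))))) ⟩
          ν * (1# - q ^ suc (suc a ℕ.+ 6 ℕ.* s)) ∎
        diff-suc : ∀ s → diff (suc s) ≈
          ν * z * (φ s * z ^ s) + (- (ν * z * (A + B))) * (φ s * (Q * z) ^ s) + (ν * z * A * B) * (φ s * (Q * (Q * z)) ^ s)
        diff-suc s = begin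
          diff (suc s)   ≈⟨ diff-factor (suc s) ⟩
          ((1# - q ^ (6 ℕ.* suc s)) * (ν - μ * q ^ (6 ℕ.* suc s)) * φ (suc s)) * (z * z ^ s)
            ≈⟨ *-congʳ (*-congʳ (*-congˡ (ν-μt s))) ⟩
          ((1# - q ^ (6 ℕ.* suc s)) * (ν * (1# - q ^ suc (suc a ℕ.+ 6 ℕ.* s))) * φ (suc s)) * (z * z ^ s)
            ≈⟨ *-congʳ (solve 4 (λ x ν y f → x :* (ν :* y) :* f := ν :* (x :* (y :* f))) refl _ _ _ _) ⟩
          (ν * ((1# - q ^ (6 ℕ.* suc s)) * ((1# - q ^ suc (suc a ℕ.+ 6 ℕ.* s)) * φ (suc s)))) * (z * z ^ s)
            ≈⟨ *-congʳ (*-congˡ (φ-spec s)) ⟩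
          (ν * ((1# - A * q ^ (6 ℕ.* s)) * (1# - B * q ^ (6 ℕ.* s)) * φ s)) * (z * z ^ s)
            ≈⟨ solve 7 (λ ν z a b f t w → (ν :* ((one :- a :* t) :* (one :- b :* t) :* f)) :* (z :* w)
                 := ν :* z :* (f :* w) :+ (:- (ν :* z :* (a :+ b))) :* (f :* (t :* w)) :+ (ν :* z :* a :* b) :* (f :* (t :* (t :* w))))
                 refl ν z A B _ _ _ ⟩
          ν * z * (φ s * z ^ s) + (- (ν * z * (A + B))) * (φ s * (q ^ (6 ℕ.* s) * z ^ s))
            + (ν * z * A * B) * (φ s * (q ^ (6 ℕ.* s) * (q ^ (6 ℕ.* s) * z ^ s)))
            ≈⟨ +-cong (+-congˡ (*-congˡ (*-congˡ (sym ([pz]^ 6 z s))))) (*-congˡ (*-congˡ (sym (pow² s)))) ⟩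
          ν * z * (φ s * z ^ s) + (- (ν * z * (A + B))) * (φ s * (Q * z) ^ s) + (ν * z * A * B) * (φ s * (Q * (Q * z)) ^ s) ∎
        combine : ν * F z + (- (ν + μ)) * F (Q * z) + μ * F (Q * (Q * z))
          ≈ ν * z * F z + (- (ν * z * (A + B))) * F (Q * z) + (ν * z * A * B) * F (Q * (Q * z))
        combine = begin
          ν * F z + (- (ν + μ)) * F (Q * z) + μ * F (Q * (Q * z))  ≈⟨ sym (lin ν (- (ν + μ)) μ) ⟩
          Σ[ L ] diff  ≈⟨ Σ-shift L diff diff-0 (trans (diff-factor L) (^L-vanish _ z≈qw)) ⟩
          Σ[ L ] (λ s → diff (suc s))  ≈⟨ Σ-cong L diff-suc ⟩
          _  ≈⟨ lin _ _ _ ⟩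
          ν * z * F z + (- (ν * z * (A + B))) * F (Q * z) + (ν * z * A * B) * F (Q * (Q * z)) ∎

      -- Only these sample points occur: dilation by q⁶ becomes r ↦ r + 1, and x is 0 as soon as 6r
      -- ≥ L.
      x : ℕ → Carrier
      x r = q ^ (6 ℕ.* r)

      x-suc : ∀ r → x (suc r) ≈ Q * x r
      x-suc r = trans (^-congʳ q (ℕ.*-suc 6 r)) (^-homo-* q 6 (6 ℕ.* r))

      z : ℕ → Carrier
      z r = - (q * x r)

      z≈q* : ∀ r → z r ≈ q * (- x r)
      z≈q* r = solve 2 (λ q x → :- (q :* x) := q :* (:- x)) refl q (x r)

      Qz : ∀ r → Q * z r ≈ z (suc r)
      Qz r = trans (solve 3 (λ p q x → p :* (:- (q :* x)) := :- (q :* (p :* x))) refl Q q (x r))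
        (-‿cong (*-congˡ (sym (x-suc r))))

      P : ℕ → Carrier
      P r = Π[ L ] (λ n → 1# + q * x (r ℕ.+ n))

      x-zero : ∀ r → L ℕ.≤ 6 ℕ.* r → x r ≈ 0#
      x-zero r = q^-zero (6 ℕ.* r)

      P-factor-trivial : ∀ r → L ℕ.≤ 6 ℕ.* r → 1# + q * x r ≈ 1#
      P-factor-trivial r L≤6r = trans (+-congˡ (trans (*-congˡ (x-zero r L≤6r)) (zeroʳ q))) (+-identityʳ 1#)

      -- L factors from r on equal L + 1 of them, because the factor at r + L is 1; the finite
      -- product thus obeys the recursion of the infinite one.
      P-step : ∀ r → P r ≈ (1# + q * x r) * P (suc r)
      P-step r = begin
        P r                 ≈⟨ sym (*-identityʳ _) ⟩
        P r * 1#            ≈⟨ *-congˡ (sym (P-factor-trivial (r ℕ.+ L) (ℕ.≤-trans (ℕ.m≤n+m L r) (ℕ.m≤n*m (r ℕ.+ L) 6)))) ⟩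
        Π[ suc L ] (λ n → 1# + q * x (r ℕ.+ n))   ≈⟨ Π-head L _ ⟩
        (1# + q * x (r ℕ.+ 0)) * Π[ L ] (λ n → 1# + q * x (r ℕ.+ suc n))
          ≈⟨ *-cong (reflexive (≡.cong (λ k → 1# + q * x k) (ℕ.+-identityʳ r)))
               (Π-cong L (λ n → reflexive (≡.cong (λ k → 1# + q * x k) (ℕ.+-suc r n)))) ⟩
        (1# + q * x r) * P (suc r) ∎

      P-const : ∀ r → L ℕ.≤ 6 ℕ.* r → P r ≈ 1#
      P-const r L≤6r = go L
        where
        go : ∀ N → Π[ N ] (λ n → 1# + q * x (r ℕ.+ n)) ≈ 1#
        go zero    = refl
        go (suc N) = trans (*-cong (go N) (P-factor-trivial (r ℕ.+ N)
          (ℕ.≤-trans L≤6r (ℕ.*-monoʳ-≤ 6 (ℕ.m≤m+n r N))))) (*-identityˡ 1#)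

      -- (-qx;q⁶)∞ ₂φ₁(A, B; qA; q⁶; -qx) at x = q^(6r)
      X : ℕ → Carrier
      X r = P r * F (z r)

      -- The prefactor (-qx;q⁶)∞ absorbs the 1 - z = 1 + qx of `F-step`, so that the leading
      -- coefficient is ν alone; in exchange 1 + q⁷x appears in the last term. The coefficients are
      -- now those of the recurrence for the double sum.
      X-step : ∀ r → ν * X r ≈ (ν + μ) * (1# + Q * x r) * X (suc r)
                              - μ * (1# + q ^ 7 * x r) * (1# + q ^ 11 * x r) * X (suc (suc r))
      X-step r = begin
        ν * (P r * F₀)                       ≈⟨ *-congˡ (*-congʳ (P-step r)) ⟩
        ν * ((1# + q * y) * P₁ * F₀)
          ≈⟨ solve 5 (λ ν q y p f → ν :* ((one :+ q :* y) :* p :* f) := p :* (ν :* (one :- (:- (q :* y))) :* f)) refl ν q y P₁ F₀ ⟩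
        P₁ * (ν * (1# - z r) * F₀)           ≈⟨ *-congˡ (F-step (z≈q* r)) ⟩
        P₁ * (((ν + μ) - ν * z r * (A + B)) * F (Q * z r) - (μ - ν * z r * A * B) * F (Q * (Q * z r)))
          ≈⟨ *-congˡ (+-cong (*-congˡ (F-cong (Qz r)))
               (-‿cong (*-congˡ (F-cong (trans (*-congˡ (Qz r)) (Qz (suc r))))))) ⟩
        P₁ * (((ν + μ) - ν * z r * (A + B)) * F₁ - (μ - ν * z r * A * B) * F₂)
          ≈⟨ solve 8 (λ ν μ q y a p f g →
               p :* (((ν :+ μ) :- ν :* (:- (q :* y)) :* (a :+ q :^ 5)) :* f :- (μ :- ν :* (:- (q :* y)) :* a :* q :^ 5) :* g)
               := p :* (((ν :+ μ) :+ (ν :* a :* q) :* y :+ ν :* q :^ 6 :* y) :* f :- (μ :+ (ν :* a :* q) :* (y :* q :^ 5)) :* g))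
               refl ν μ q y A P₁ F₁ F₂ ⟩
        P₁ * (((ν + μ) + (ν * A * q) * y + ν * Q * y) * F₁ - (μ + (ν * A * q) * (y * q ^ 5)) * F₂)
          ≈⟨ *-congˡ (+-cong (*-congʳ (+-congʳ (+-congˡ (*-congʳ νμ)))) (-‿cong (*-congʳ (+-congˡ (*-congʳ νμ))))) ⟩
        P₁ * (((ν + μ) + (μ * Q) * y + ν * Q * y) * F₁ - (μ + (μ * Q) * (y * q ^ 5)) * F₂)
          ≈⟨ solve 7 (λ ν μ q y p f g →
               p :* (((ν :+ μ) :+ (μ :* q :^ 6) :* y :+ ν :* q :^ 6 :* y) :* f :- (μ :+ (μ :* q :^ 6) :* (y :* q :^ 5)) :* g)
               := (ν :+ μ) :* (one :+ q :^ 6 :* y) :* (p :* f) :- μ :* (one :+ q :^ 11 :* y) :* (p :* g))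
               refl ν μ q y P₁ F₁ F₂ ⟩
        (ν + μ) * (1# + Q * y) * (P₁ * F₁) - μ * (1# + q ^ 11 * y) * (P₁ * F₂)
          ≈⟨ +-congˡ (-‿cong (*-congˡ (*-congʳ (trans (P-step (suc r)) (*-congʳ (+-congˡ (*-congˡ (x-suc r)))))))) ⟩
        (ν + μ) * (1# + Q * y) * (P₁ * F₁) - μ * (1# + q ^ 11 * y) * ((1# + q * (Q * y)) * P₂ * F₂)
          ≈⟨ +-congˡ (-‿cong (solve 5 (λ μ q y p f → μ :* (one :+ q :^ 11 :* y) :* ((one :+ q :* (q :^ 6 :* y)) :* p :* f)
               := μ :* (one :+ q :^ 7 :* y) :* (one :+ q :^ 11 :* y) :* (p :* f)) refl μ q y P₂ F₂)) ⟩
        (ν + μ) * (1# + Q * y) * (P₁ * F₁) - μ * (1# + q ^ 7 * y) * (1# + q ^ 11 * y) * (P₂ * F₂) ∎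
        where
        y = x r
        F₀ = F (z r)
        F₁ = F (z (suc r))
        F₂ = F (z (suc (suc r)))
        P₁ = P (suc r)
        P₂ = P (suc (suc r))

      z-zero : ∀ r → L ℕ.≤ 6 ℕ.* r → z r ≈ 0#
      z-zero r L≤r = trans (-‿cong (trans (*-congˡ (x-zero r L≤r)) (zeroʳ q))) (solve 0 (:- con (+ 0) := con (+ 0)) refl)

      hA : ℕ → Carrier
      hA s = h 1 5 (q ^ (suc a ℕ.+ 6 ℕ.* s))

      hA-step : ∀ s → (1# - q ^ (suc a ℕ.+ 6 ℕ.* s)) * hA s ≈ (1# - q ^ suc (suc a ℕ.+ 6 ℕ.* s)) * hA (suc s)
      hA-step s = trans (h-step 1 5 refl) (*-cong
        (+-congˡ (-‿cong (*-congʳ (*-identityʳ q))))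
        (h-cong 1 5 (trans (sym (^-homo-* q 6 (suc a ℕ.+ 6 ℕ.* s))) (^-congʳ q
          (solveℕ 2 (λ a s → nat 6 ⊕ (nat 1 ⊕ a ⊕ nat 6 ⊗ s) ⊜ nat 1 ⊕ a ⊕ nat 6 ⊗ (nat 1 ⊕ s)) ≡.refl a s)))))

      -- `hA s` stands for (qAQ^s;Q)∞/(AQ^s;Q)∞, so the quotient of `hA s` by `hA 0` is
      -- (A;Q)ₛ/(qA;Q)ₛ. Two of the four symbols in `φ s` are thereby traded for a series in powers
      -- of AQ^s.
      φ-hA : ∀ s → φ s * hA 0 ≈ coeff 5 5 s * hA s
      φ-hA zero    = refl
      φ-hA (suc s) = begin
        φ s * (α * β * (i * j)) * hA 0
          ≈⟨ solve 6 (λ f α β i j h → f :* (α :* β :* (i :* j)) :* h := (f :* h) :* (α :* β :* (i :* j))) refl _ _ _ _ _ _ ⟩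
        (φ s * hA 0) * (α * β * (i * j))       ≈⟨ *-congʳ (φ-hA s) ⟩
        (c * hA s) * (α * β * (i * j))
          ≈⟨ solve 6 (λ c h α β i j → (c :* h) :* (α :* β :* (i :* j)) := c :* (β :* i) :* ((α :* h) :* j)) refl _ _ _ _ _ _ ⟩
        c * (β * i) * ((α * hA s) * j)         ≈⟨ *-congˡ (*-congʳ (hA-step s)) ⟩
        c * (β * i) * ((w * hA (suc s)) * j)
          ≈⟨ solve 4 (λ c w h j → c :* ((w :* h) :* j) := c :* h :* (w :* j)) refl _ _ _ _ ⟩
        c * (β * i) * hA (suc s) * (w * j)     ≈⟨ *-congˡ (inv-spec _) ⟩
        c * (β * i) * hA (suc s) * 1#          ≈⟨ *-identityʳ _ ⟩
        c * (β * i) * hA (suc s)               ∎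
        where
        c = coeff 5 5 s
        α = 1# - q ^ (suc a ℕ.+ 6 ℕ.* s)
        β = 1# - q ^ (5 ℕ.+ 6 ℕ.* s)
        i = inv (s ℕ.+ 5 ℕ.* suc s)
        j = inv (suc a ℕ.+ 6 ℕ.* s)
        w = 1# - q ^ suc (suc a ℕ.+ 6 ℕ.* s)

      k : ℕ → Carrier
      k n = h 5 5 (z n)

      k-step : ∀ n → (1# + q * x n) * k n ≈ (1# + x (suc n)) * k (suc n)
      k-step n = begin
        (1# + q * x n) * k n   ≈⟨ *-congʳ (solve 1 (λ t → one :+ t := one :- (:- t)) refl _) ⟩
        (1# - z n) * k n       ≈⟨ h-step 5 5 (z≈q* n) ⟩
        (1# - q ^ 5 * z n) * h 5 5 (Q * z n)
          ≈⟨ *-cong (trans (solve 2 (λ q y → one :- q :^ 5 :* (:- (q :* y)) := one :+ q :^ 6 :* y) refl q (x n))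
               (+-congˡ (sym (x-suc n)))) (h-cong 5 5 (Qz n)) ⟩
        (1# + x (suc n)) * k (suc n) ∎

      -- The coincidence behind Bailey-Daum: the quotient of `k n` by `k 0` is (-q;Q)ₙ/(-Q;Q)ₙ, and
      -- it combines with (q;Q)ₙ/(Q;Q)ₙ to (q²;Q²)ₙ/(Q²;Q²)ₙ. The sum left by Heine's transformation
      -- is again a q-binomial series, in base q¹².
      coeff-k : ∀ n → coeff 1 5 n * k n ≈ coeff 2 11 n * k 0
      coeff-k zero    = refl
      coeff-k (suc n) = begin
        c * ((1# - q ^ (1 ℕ.+ 6 ℕ.* n)) * i) * k (suc n)
          ≈⟨ *-congʳ (*-congˡ (*-congˡ i≈)) ⟩
        c * ((1# - q * x n) * ((1# + x (suc n)) * j)) * k (suc n)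
          ≈⟨ solve 5 (λ c y w j k → c :* ((one :- y) :* ((one :+ w) :* j)) :* k := c :* (one :- y) :* j :* ((one :+ w) :* k))
               refl c (q * x n) (x (suc n)) j (k (suc n)) ⟩
        c * (1# - q * x n) * j * ((1# + x (suc n)) * k (suc n))   ≈⟨ *-congˡ (sym (k-step n)) ⟩
        c * (1# - q * x n) * j * ((1# + q * x n) * k n)
          ≈⟨ solve 5 (λ c q y j k → c :* (one :- q :* y) :* j :* ((one :+ q :* y) :* k)
               := (c :* k) :* ((one :- q :^ 2 :* y :^ 2) :* j)) refl c q (x n) j (k n) ⟩
        (c * k n) * ((1# - q ^ 2 * x n ^ 2) * j)
          ≈⟨ *-cong (coeff-k n) (*-congʳ (+-congˡ (-‿cong pow))) ⟩
        (coeff 2 11 n * k 0) * ((1# - q ^ (2 ℕ.+ 12 ℕ.* n)) * j)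
          ≈⟨ solve 3 (λ a b c → (a :* b) :* c := a :* c :* b) refl _ _ _ ⟩
        coeff 2 11 n * ((1# - q ^ (2 ℕ.+ 12 ℕ.* n)) * j) * k 0 ∎
        where
        c = coeff 1 5 n
        i = inv (n ℕ.+ 5 ℕ.* suc n)
        j = inv (n ℕ.+ 11 ℕ.* suc n)
        w = x (suc n)
        pow : q ^ 2 * x n ^ 2 ≈ q ^ (2 ℕ.+ 12 ℕ.* n)
        pow = trans (*-congˡ (^-assocʳ q (6 ℕ.* n) 2)) (trans (sym (^-homo-* q 2 (6 ℕ.* n ℕ.* 2))) (^-congʳ q
          (solveℕ 1 (λ n → nat 2 ⊕ nat 6 ⊗ n ⊗ nat 2 ⊜ nat 2 ⊕ nat 12 ⊗ n) ≡.refl n)))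
        w² : w * w ≈ q ^ (12 ℕ.* suc n)
        w² = trans (sym (^-homo-* q (6 ℕ.* suc n) _)) (^-congʳ q
          (solveℕ 1 (λ n → nat 6 ⊗ (nat 1 ⊕ n) ⊕ nat 6 ⊗ (nat 1 ⊕ n) ⊜ nat 12 ⊗ (nat 1 ⊕ n)) ≡.refl n))
        i≈ : i ≈ (1# + w) * j
        i≈ = begin
          i                              ≈⟨ sym (*-identityʳ _) ⟩
          i * 1#                         ≈⟨ *-congˡ (sym (inv-spec (n ℕ.+ 11 ℕ.* suc n))) ⟩
          i * ((1# - q ^ (12 ℕ.* suc n)) * j)   ≈⟨ *-congˡ (*-congʳ (+-congˡ (-‿cong (sym w²)))) ⟩
          i * ((1# - w * w) * j)
            ≈⟨ solve 3 (λ i w j → i :* ((one :- w :* w) :* j) := ((one :- w) :* i) :* ((one :+ w) :* j)) refl i w j ⟩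
          ((1# - w) * i) * ((1# + w) * j)       ≈⟨ *-congʳ (inv-spec (n ℕ.+ 5 ℕ.* suc n)) ⟩
          1# * ((1# + w) * j)                   ≈⟨ *-identityˡ _ ⟩
          (1# + w) * j                          ∎

      -- Heine's transformation: expand hA s and exchange the summations.
      heine : hA 0 * F (z 0) ≈ k 0 * h 2 11 A
      heine = begin
        hA 0 * F (z 0)                      ≈⟨ sym (Σ-* L _ _) ⟩
        Σ[ L ] (λ s → hA 0 * (φ s * z 0 ^ s))
          ≈⟨ Σ-cong L (λ s → trans (solve 3 (λ h f w → h :* (f :* w) := w :* (f :* h)) refl _ _ _)
               (trans (*-congˡ (φ-hA s)) (trans (solve 3 (λ w c h → w :* (c :* h) := (c :* w) :* h) refl _ _ _) (sym (Σ-* L _ _))))) ⟩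
        Σ[ L ] (λ s → Σ[ L ] (λ n → (coeff 5 5 s * z 0 ^ s) * (coeff 1 5 n * (q ^ (suc a ℕ.+ 6 ℕ.* s)) ^ n)))
          ≈⟨ Σ-swap L L _ ⟩
        Σ[ L ] (λ n → Σ[ L ] (λ s → (coeff 5 5 s * z 0 ^ s) * (coeff 1 5 n * (q ^ (suc a ℕ.+ 6 ℕ.* s)) ^ n)))
          ≈⟨ Σ-cong L (λ n → trans (Σ-cong L (regroup n)) (Σ-* L _ _)) ⟩
        Σ[ L ] (λ n → (coeff 1 5 n * A ^ n) * k n)
          ≈⟨ Σ-cong L (λ n → trans (solve 3 (λ c w k → (c :* w) :* k := w :* (c :* k)) refl _ _ _)
               (trans (*-congˡ (coeff-k n)) (solve 3 (λ w c k → w :* (c :* k) := k :* (c :* w)) refl _ _ _))) ⟩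
        Σ[ L ] (λ n → k 0 * (coeff 2 11 n * A ^ n))   ≈⟨ Σ-* L _ _ ⟩
        k 0 * h 2 11 A                                ∎
        where
        z-pow : ∀ n → q ^ (6 ℕ.* n) * z 0 ≈ z n
        z-pow n = solve 2 (λ q y → y :* (:- (q :* one)) := :- (q :* y)) refl q (x n)
        regroup : ∀ n s → (coeff 5 5 s * z 0 ^ s) * (coeff 1 5 n * (q ^ (suc a ℕ.+ 6 ℕ.* s)) ^ n)
          ≈ (coeff 1 5 n * A ^ n) * (coeff 5 5 s * z n ^ s)
        regroup n s = begin
          (coeff 5 5 s * z 0 ^ s) * (coeff 1 5 n * (q ^ (suc a ℕ.+ 6 ℕ.* s)) ^ n)
            ≈⟨ *-congˡ (*-congˡ (trans (^-congˡ n (^-homo-* q (suc a) _)) (trans (^-distrib-* _ _ n) (*-congˡ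
                 (trans (^-assocʳ q (6 ℕ.* s) n) (^-congʳ q (solveℕ 2 (λ s n → nat 6 ⊗ s ⊗ n ⊜ nat 6 ⊗ n ⊗ s) ≡.refl s n))))))) ⟩
          (coeff 5 5 s * z 0 ^ s) * (coeff 1 5 n * (A ^ n * q ^ (6 ℕ.* n ℕ.* s)))
            ≈⟨ solve 5 (λ c w e v p → (c :* w) :* (e :* (v :* p)) := (e :* v) :* (c :* (p :* w))) refl _ _ _ _ _ ⟩
          (coeff 1 5 n * A ^ n) * (coeff 5 5 s * (q ^ (6 ℕ.* n ℕ.* s) * z 0 ^ s))
            ≈⟨ *-congˡ (*-congˡ (trans (sym ([pz]^ (6 ℕ.* n) (z 0) s)) (^-congˡ s (z-pow n)))) ⟩
          (coeff 1 5 n * A ^ n) * (coeff 5 5 s * z n ^ s) ∎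

      -- M r = (-q^(6r+6);q⁶)∞
      M : ℕ → Carrier
      M r = P r * k r

      M-step : ∀ r → M r ≈ (1# + q ^ (6 ℕ.* suc r)) * M (suc r)
      M-step r = begin
        P r * k r                              ≈⟨ *-congʳ (P-step r) ⟩
        (1# + q * x r) * P (suc r) * k r       ≈⟨ solve 3 (λ a p k → a :* p :* k := p :* (a :* k)) refl _ _ _ ⟩
        P (suc r) * ((1# + q * x r) * k r)     ≈⟨ *-congˡ (k-step r) ⟩
        P (suc r) * ((1# + x (suc r)) * k (suc r))
          ≈⟨ solve 3 (λ a p k → p :* (a :* k) := a :* (p :* k)) refl _ _ _ ⟩
        (1# + x (suc r)) * M (suc r)           ∎

      M-const : ∀ r → L ℕ.≤ 6 ℕ.* r → M r ≈ 1#
      M-const r L≤r = trans (*-cong (P-const r L≤r) (h-zero 5 5 (z-zero r L≤r))) (*-identityˡ 1#)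

      -- Cross-multiplied by (qA;Q)∞ and (A;Q²)∞, which turn the two q-binomial series of `heine`
      -- into products; P 0 joins k 0 to form (-Q;Q)∞.
      bailey-daum : poch (suc (suc a)) 6 L * poch (suc a) 12 L * X 0 ≈ poch (suc a) 6 L * M 0 * poch (suc (suc (suc a))) 12 L
      bailey-daum = begin
        poch (suc (suc a)) 6 L * poch (suc a) 12 L * (P 0 * F (z 0))
          ≈⟨ *-congʳ (*-congʳ (trans (sym (poch-h 1 a 5)) (*-congˡ (h-cong 1 5 (^-congʳ q (≡.sym (ℕ.+-identityʳ (suc a)))))))) ⟩
        (poch (suc a) 6 L * hA 0) * poch (suc a) 12 L * (P 0 * F (z 0))
          ≈⟨ solve 5 (λ a h b p f → (a :* h) :* b :* (p :* f) := a :* b :* p :* (h :* f)) refl _ _ _ _ _ ⟩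
        poch (suc a) 6 L * poch (suc a) 12 L * P 0 * (hA 0 * F (z 0))   ≈⟨ *-congˡ heine ⟩
        poch (suc a) 6 L * poch (suc a) 12 L * P 0 * (k 0 * h 2 11 A)
          ≈⟨ solve 5 (λ a b p k h → a :* b :* p :* (k :* h) := a :* (p :* k) :* (b :* h)) refl _ _ _ _ _ ⟩
        poch (suc a) 6 L * M 0 * (poch (suc a) 12 L * h 2 11 A)         ≈⟨ *-congˡ (poch-h 2 a 11) ⟩
        poch (suc a) 6 L * M 0 * poch (suc (suc (suc a))) 12 L          ∎

      F-zero : ∀ {w} → w ≈ 0# → F w ≈ 1#
      F-zero {w} w≈0 = trans (Σ-only-head l (λ s → φ s * w ^ s)
        (λ n → trans (*-congˡ (trans (*-congʳ w≈0) (zeroˡ _))) (zeroʳ _))) (*-identityˡ 1#)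

      X-const : ∀ r → L ℕ.≤ 6 ℕ.* r → X r ≈ 1#
      X-const r L≤6r = trans (*-cong (P-const r L≤6r) (F-zero (z-zero r L≤6r))) (*-identityˡ 1#)

    -- The double-sum side: the same recurrence by creative telescoping.

    module DoubleSum (ν μ : Carrier) (ω p : ℕ → ℕ → Carrier) where
      x : ℕ → Carrier
      x r = q ^ (6 ℕ.* r)

      β : ℕ → ℕ → ℕ → Carrier
      β r j k = x r ^ (j ℕ.+ k) * ω j k

      -- The sum over j and k with x^(j+k) inserted, at x = q^(6r).
      E : ℕ → Carrier
      E r = Σ² L (λ j k → β r j k * p j k)

      t : ℕ → ℕ → Carrier
      t j k = (q ^ j * q ^ k) ^ 6

      x-suc : ∀ r → x (suc r) ≈ q ^ 6 * x r
      x-suc r = trans (^-congʳ q (ℕ.*-suc 6 r)) (^-homo-* q 6 (6 ℕ.* r))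

      t≈ : ∀ j k → q ^ (6 ℕ.* (j ℕ.+ k)) ≈ t j k
      t≈ j k = trans (^-congʳ q (ℕ.*-comm 6 (j ℕ.+ k))) (trans (sym (^-assocʳ q (j ℕ.+ k) 6)) (^-congˡ 6 (^-homo-* q j k)))

      β-suc : ∀ r j k → β (suc r) j k ≈ β r j k * t j k
      β-suc r j k = begin
        x (suc r) ^ (j ℕ.+ k) * ω j k
          ≈⟨ *-congʳ (trans (^-congˡ (j ℕ.+ k) (x-suc r)) (trans ([pz]^ 6 (x r) (j ℕ.+ k)) (*-congʳ (t≈ j k)))) ⟩
        t j k * x r ^ (j ℕ.+ k) * ω j k    ≈⟨ solve 3 (λ t x w → t :* x :* w := x :* w :* t) refl _ _ _ ⟩
        x r ^ (j ℕ.+ k) * ω j k * t j k    ∎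

      -- The parts of degree 0, 1 and 2 in x of the recurrence operator applied to the summand, not
      -- counting the power x^(j+k) inside β.
      s₀ s₁ s₂ : ℕ → ℕ → ℕ → Carrier
      s₀ r j k = β r j k * (p j k * (1# - t j k) * (ν - μ * t j k))
      s₁ r j k = x r * β r j k * (p j k * (μ * (q ^ 7 + q ^ 11) * t j k ^ 2 - (ν + μ) * q ^ 6 * t j k))
      s₂ r j k = x r ^ 2 * β r j k * (p j k * (μ * q ^ 18 * t j k ^ 2))

      expand : ∀ r → ν * E r + (- ((ν + μ) * (1# + q ^ 6 * x r))) * E (suc r)
                      + (μ * (1# + q ^ 7 * x r) * (1# + q ^ 11 * x r)) * E (suc (suc r))
                   ≈ Σ² L (s₀ r) + Σ² L (s₁ r) + Σ² L (s₂ r)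
      expand r = begin
        ν * E r + c₁ * E (suc r) + c₂ * E (suc (suc r))
          ≈⟨ sym (trans (Σ²-+ L _ _) (+-cong (trans (Σ²-+ L _ _) (+-cong (Σ²-* L _ _) (Σ²-* L _ _))) (Σ²-* L _ _))) ⟩
        Σ² L (λ j k → ν * (β r j k * p j k) + c₁ * (β (suc r) j k * p j k) + c₂ * (β (suc (suc r)) j k * p j k))
          ≈⟨ Σ²-cong L (λ j k → trans (+-cong (+-congˡ (*-congˡ (*-congʳ (β-suc r j k))))
               (*-congˡ (*-congʳ (trans (β-suc (suc r) j k) (*-congʳ (β-suc r j k))))))
               (solve 7 (λ ν μ q y b p t →
                 ν :* (b :* p) :+ (:- ((ν :+ μ) :* (one :+ q :^ 6 :* y))) :* (b :* t :* p)
                 :+ (μ :* (one :+ q :^ 7 :* y) :* (one :+ q :^ 11 :* y)) :* (b :* t :* t :* p)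
                 := b :* (p :* (one :- t) :* (ν :- μ :* t))
                 :+ y :* b :* (p :* (μ :* (q :^ 7 :+ q :^ 11) :* t :^ 2 :- (ν :+ μ) :* q :^ 6 :* t))
                 :+ y :^ 2 :* b :* (p :* (μ :* q :^ 18 :* t :^ 2)))
                 refl ν μ q (x r) (β r j k) (p j k) (t j k))) ⟩
        Σ² L (λ j k → s₀ r j k + s₁ r j k + s₂ r j k)
          ≈⟨ trans (Σ²-+ L _ _) (+-congʳ (Σ²-+ L _ _)) ⟩
        Σ² L (s₀ r) + Σ² L (s₁ r) + Σ² L (s₂ r) ∎
        where
        c₁ = - ((ν + μ) * (1# + q ^ 6 * x r))
        c₂ = μ * (1# + q ^ 7 * x r) * (1# + q ^ 11 * x r)

      Recurrence : Set
      Recurrence = ∀ r → ν * E r ≈ (ν + μ) * (1# + q ^ 6 * x r) * E (suc r)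
                       - μ * (1# + q ^ 7 * x r) * (1# + q ^ 11 * x r) * E (suc (suc r))

      recurrence : (∀ r → Σ² L (s₀ r) + Σ² L (s₁ r) + Σ² L (s₂ r) ≈ 0#) → Recurrence
      recurrence sum≈0 r = begin
        ν * E r
          ≈⟨ solve 5 (λ a b c d e → a := (a :+ (:- b) :* c :+ d :* e) :+ (b :* c :- d :* e)) refl _ _ _ _ _ ⟩
        (ν * E r + (- c₁) * E (suc r) + c₂ * E (suc (suc r))) + (c₁ * E (suc r) - c₂ * E (suc (suc r)))
          ≈⟨ +-congʳ (trans (expand r) (sum≈0 r)) ⟩
        0# + (c₁ * E (suc r) - c₂ * E (suc (suc r)))   ≈⟨ +-identityˡ _ ⟩
        c₁ * E (suc r) - c₂ * E (suc (suc r)) ∎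
        where
        c₁ = (ν + μ) * (1# + q ^ 6 * x r)
        c₂ = μ * (1# + q ^ 7 * x r) * (1# + q ^ 11 * x r)

      E-const : ∀ r → L ℕ.≤ 6 ℕ.* r → E r ≈ ω 0 0 * p 0 0
      E-const r L≤6r = trans (Σ-only-head l _ (λ j → trans (Σ-cong L (λ k → vanish (j ℕ.+ k) _ _)) (Σ-zero L)))
        (trans (Σ-only-head l _ (λ k → vanish k _ _)) (*-congʳ (*-identityˡ _)))
        where
        vanish : ∀ m y z → x r ^ suc m * y * z ≈ 0#
        vanish m y z = trans (*-congʳ (trans (*-congʳ (trans (*-congʳ (q^-zero _ L≤6r)) (zeroˡ _))) (zeroˡ y))) (zeroˡ z)

    -- Powers of q with exponent linear in j and k become monomials in q, J = q^j and K = q^k, so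
    -- that the certificates turn into polynomial identities in three variables.
    monomial : ∀ c a j b k → q ^ (c ℕ.+ a ℕ.* j ℕ.+ b ℕ.* k) ≈ q ^ c * (q ^ j) ^ a * (q ^ k) ^ b
    monomial c a j b k = trans (^-homo-* q (c ℕ.+ a ℕ.* j) (b ℕ.* k)) (*-cong
      (trans (^-homo-* q c (a ℕ.* j)) (*-congˡ (pow a j))) (pow b k))
      where
      pow : ∀ a j → q ^ (a ℕ.* j) ≈ (q ^ j) ^ a
      pow a j = trans (^-congʳ q (ℕ.*-comm a j)) (sym (^-assocʳ q j a))

    u-step : ∀ c j → (1# - q ^ suc c * (q ^ j) ^ suc c) * u c (suc j) ≈ u c j
    u-step c j = trans (*-congʳ (+-congˡ (-‿cong (sym (trans (^-congʳ q
      (≡.trans (ℕ.*-suc (suc c) j) (≡.sym (ℕ.+-identityʳ _)))) (trans (monomial (suc c) (suc c) j 0 0) (*-identityʳ _))))))) (u-spec c j)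

    e-step′ : ∀ c j k → e (c ℕ.+ 2 ℕ.* j ℕ.+ 3 ℕ.* k) ≈ (1# + q ^ suc c * (q ^ j) ^ 2 * (q ^ k) ^ 3) * e (suc c ℕ.+ 2 ℕ.* j ℕ.+ 3 ℕ.* k)
    e-step′ c j k = trans (e-step _) (*-congʳ (+-congˡ (monomial (suc c) 2 j 3 k)))

    binom : ℕ → ℕ → ℕ
    binom j k = (2 ℕ.* j ℕ.+ 3 ℕ.* k) C 2

    binom-sucˡ : ∀ j k → binom (suc j) k ≡ 1 ℕ.+ binom j k ℕ.+ 4 ℕ.* j ℕ.+ 6 ℕ.* k
    binom-sucˡ j k = ≡.trans (≡.cong (_C 2) (solveℕ 2 (λ j k → nat 2 ⊗ (nat 1 ⊕ j) ⊕ nat 3 ⊗ k ⊜ nat 1 ⊕ (nat 1 ⊕ (nat 2 ⊗ j ⊕ nat 3 ⊗ k))) ≡.refl j k))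
      (≡.trans (C2-suc (suc n)) (≡.trans (≡.cong (ℕ._+ suc n) (C2-suc n))
        (solveℕ 3 (λ b j k → b ⊕ (nat 2 ⊗ j ⊕ nat 3 ⊗ k) ⊕ (nat 1 ⊕ (nat 2 ⊗ j ⊕ nat 3 ⊗ k)) ⊜ nat 1 ⊕ b ⊕ nat 4 ⊗ j ⊕ nat 6 ⊗ k) ≡.refl (binom j k) j k)))
      where n = 2 ℕ.* j ℕ.+ 3 ℕ.* k

    binom-sucʳ : ∀ j k → binom j (suc k) ≡ 3 ℕ.+ binom j k ℕ.+ 6 ℕ.* j ℕ.+ 9 ℕ.* k
    binom-sucʳ j k = ≡.trans (≡.cong (_C 2) (solveℕ 2 (λ j k → nat 2 ⊗ j ⊕ nat 3 ⊗ (nat 1 ⊕ k) ⊜ nat 1 ⊕ (nat 1 ⊕ (nat 1 ⊕ (nat 2 ⊗ j ⊕ nat 3 ⊗ k)))) ≡.refl j k))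
      (≡.trans (C2-suc (suc (suc n))) (≡.trans (≡.cong (ℕ._+ suc (suc n)) (≡.trans (C2-suc (suc n)) (≡.cong (ℕ._+ suc n) (C2-suc n))))
        (solveℕ 3 (λ b j k → b ⊕ (nat 2 ⊗ j ⊕ nat 3 ⊗ k) ⊕ (nat 1 ⊕ (nat 2 ⊗ j ⊕ nat 3 ⊗ k)) ⊕ (nat 1 ⊕ (nat 1 ⊕ (nat 2 ⊗ j ⊕ nat 3 ⊗ k))) ⊜ nat 3 ⊕ b ⊕ nat 6 ⊗ j ⊕ nat 9 ⊗ k) ≡.refl (binom j k) j k)))
      where n = 2 ℕ.* j ℕ.+ 3 ℕ.* k

    module Weighted (c a d : ℕ) .{{_ : ℕ.NonZero (a ℕ.+ d)}} (ν μ : Carrier) (p : ℕ → ℕ → Carrier) where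
      -- The two double sums are the cases (c, a, d) = (1, 0, 2) and (2, 4, 3). The exponent is at
      -- least j because of j², and at least k because a + d is nonzero; hence the terms with j ≥ L
      -- or k ≥ L vanish.
      ex : ℕ → ℕ → ℕ
      ex j k = binom j k ℕ.+ j ℕ.* j ℕ.+ a ℕ.* j ℕ.+ (a ℕ.+ d) ℕ.* k

      ω : ℕ → ℕ → Carrier
      ω j k = q ^ ex j k * (u 1 j * u 2 k) * e (c ℕ.+ 2 ℕ.* j ℕ.+ 3 ℕ.* k)

      open DoubleSum ν μ ω p public

      ω-vanish : ∀ j k z → L ℕ.≤ ex j k → ω j k * z ≈ 0#
      ω-vanish j k z L≤ = trans (*-congʳ (trans (*-congʳ (q^-vanish _ _ L≤)) (zeroˡ _))) (zeroˡ z)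

      β-vanishˡ : ∀ r j k z → L ℕ.≤ j → β r j k * z ≈ 0#
      β-vanishˡ r j@(suc _) k z L≤j = trans (*-assoc _ _ _) (trans (*-congˡ (ω-vanish j k z
        (ℕ.≤-trans L≤j (ℕ.≤-trans (ℕ.m≤m*n j j) (ℕ.≤-trans (ℕ.m≤n+m (j ℕ.* j) (binom j k))
          (ℕ.≤-trans (ℕ.m≤m+n _ (a ℕ.* j)) (ℕ.m≤m+n _ ((a ℕ.+ d) ℕ.* k)))))))) (zeroʳ _))

      β-vanishʳ : ∀ r j k z → L ℕ.≤ k → β r j k * z ≈ 0#
      β-vanishʳ r j k z L≤k = trans (*-assoc _ _ _) (trans (*-congˡ (ω-vanish j k z
        (ℕ.≤-trans L≤k (ℕ.≤-trans (ℕ.m≤n*m k (a ℕ.+ d)) (ℕ.m≤n+m _ (binom j k ℕ.+ j ℕ.* j ℕ.+ a ℕ.* j)))))) (zeroʳ _))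

      f : Carrier → Carrier → Carrier
      f J K = (1# - q ^ 2 * J ^ 2) * (1# + q ^ (1 ℕ.+ c) * J ^ 2 * K ^ 3) * (1# + q ^ (2 ℕ.+ c) * J ^ 2 * K ^ 3)

      -- Both sides have degree j + k + 1 in x: the x in front pays for raising j. This ratio and
      -- the next refer everything to the term at (j + 1, k), in which the shifted sums are
      -- compared.
      β-sucˡ : ∀ r j k → x r * q ^ (2 ℕ.+ a) * t j k * β r j k ≈ β r (suc j) k * f (q ^ j) (q ^ k)
      β-sucˡ r j k = begin
        x r * q ^ (2 ℕ.+ a) * t j k * (X * (q ^ ex j k * (u 1 j * V) * e (c ℕ.+ 2 ℕ.* j ℕ.+ 3 ℕ.* k)))
          ≈⟨ *-congˡ (*-congˡ (*-cong (*-congˡ (*-congʳ (sym (u-step 1 j))))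
               (trans (e-step′ c j k) (trans (*-congˡ (e-step′ (suc c) j k)) (*-congˡ (*-congˡ (reflexive (≡.cong e
                 (solveℕ 3 (λ c j k → nat 2 ⊕ c ⊕ nat 2 ⊗ j ⊕ nat 3 ⊗ k ⊜ c ⊕ nat 2 ⊗ (nat 1 ⊕ j) ⊕ nat 3 ⊗ k) ≡.refl c j k))))))))) ⟩
        x r * q ^ (2 ℕ.+ a) * t j k * (X * (q ^ ex j k * ((g₁ * u 1 (suc j)) * V) * (g₂ * (g₃ * e₄))))
          ≈⟨ solve 10 (λ x s t X w g₁ U V g₂ v → x :* s :* t :* (X :* (w :* ((g₁ :* U) :* V) :* (g₂ :* v)))
               := x :* X :* (s :* t :* w :* (U :* V) :* v) :* (g₁ :* g₂))
               refl (x r) (q ^ (2 ℕ.+ a)) (t j k) X (q ^ ex j k) g₁ (u 1 (suc j)) V g₂ (g₃ * e₄) ⟩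
        x r * X * (q ^ (2 ℕ.+ a) * t j k * q ^ ex j k * (u 1 (suc j) * V) * (g₃ * e₄)) * (g₁ * g₂)
          ≈⟨ *-congʳ (*-congˡ (*-congʳ (*-congʳ exponent))) ⟩
        x r * X * (q ^ ex (suc j) k * (u 1 (suc j) * V) * (g₃ * e₄)) * (g₁ * g₂)
          ≈⟨ solve 7 (λ X w U g₃ v g₁ g₂ → X :* (w :* U :* (g₃ :* v)) :* (g₁ :* g₂)
               := (X :* (w :* U :* v)) :* (g₁ :* g₂ :* g₃)) refl (x r * X) (q ^ ex (suc j) k) (u 1 (suc j) * V) g₃ e₄ g₁ g₂ ⟩
        β r (suc j) k * f (q ^ j) (q ^ k) ∎
        where
        X = x r ^ (j ℕ.+ k)
        V = u 2 k
        g₁ = 1# - q ^ 2 * (q ^ j) ^ 2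
        g₂ = 1# + q ^ (1 ℕ.+ c) * (q ^ j) ^ 2 * (q ^ k) ^ 3
        g₃ = 1# + q ^ (2 ℕ.+ c) * (q ^ j) ^ 2 * (q ^ k) ^ 3
        e₄ = e (c ℕ.+ 2 ℕ.* suc j ℕ.+ 3 ℕ.* k)
        exponent : q ^ (2 ℕ.+ a) * t j k * q ^ ex j k ≈ q ^ ex (suc j) k
        exponent = trans (*-congʳ (trans (*-congˡ (sym (t≈ j k))) (sym (^-homo-* q (2 ℕ.+ a) (6 ℕ.* (j ℕ.+ k))))))
          (trans (sym (^-homo-* q (2 ℕ.+ a ℕ.+ 6 ℕ.* (j ℕ.+ k)) (ex j k)))
          (^-congʳ q (≡.trans (solveℕ 5 (λ b a d j k → (nat 2 ⊕ a ⊕ nat 6 ⊗ (j ⊕ k)) ⊕ (b ⊕ j ⊗ j ⊕ a ⊗ j ⊕ (a ⊕ d) ⊗ k)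
            ⊜ (nat 1 ⊕ b ⊕ nat 4 ⊗ j ⊕ nat 6 ⊗ k) ⊕ (nat 1 ⊕ j) ⊗ (nat 1 ⊕ j) ⊕ a ⊗ (nat 1 ⊕ j) ⊕ (a ⊕ d) ⊗ k) ≡.refl (binom j k) a d j k)
            (≡.cong (λ b → b ℕ.+ suc j ℕ.* suc j ℕ.+ a ℕ.* suc j ℕ.+ (a ℕ.+ d) ℕ.* k) (≡.sym (binom-sucˡ j k))))))

      β-sucʳ : ∀ r j k → β r j (suc k) * ((1# - q ^ 3 * (q ^ k) ^ 3) * (1# + q ^ (3 ℕ.+ c) * (q ^ j) ^ 2 * (q ^ k) ^ 3))
        ≈ β r (suc j) k * ((1# - q ^ 2 * (q ^ j) ^ 2) * (q ^ suc d * (q ^ k) ^ 3))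
      β-sucʳ r j k = begin
        (x r ^ (j ℕ.+ suc k) * (q ^ ex j (suc k) * (u 1 j * u 2 (suc k)) * e₃)) * (g₁ * g₂)
          ≈⟨ *-congʳ (*-cong (^-congʳ (x r) (ℕ.+-suc j k)) (*-congʳ (*-cong exponent (*-congʳ (sym (u-step 1 j)))))) ⟩
        (X * (w * v * ((g₃ * U) * u 2 (suc k)) * e₃)) * (g₁ * g₂)
          ≈⟨ solve 9 (λ X w v g₃ U V e g₁ g₂ → (X :* (w :* v :* ((g₃ :* U) :* V) :* e)) :* (g₁ :* g₂)
               := (X :* (w :* (U :* (g₁ :* V)) :* (g₂ :* e))) :* (g₃ :* v)) refl X w v g₃ U (u 2 (suc k)) e₃ g₁ g₂ ⟩
        (X * (w * (U * (g₁ * u 2 (suc k))) * (g₂ * e₃))) * (g₃ * v)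
          ≈⟨ *-congʳ (*-congˡ (*-cong (*-congˡ (*-congˡ (u-step 2 k))) eq-e)) ⟩
        β r (suc j) k * (g₃ * v) ∎
        where
        X = x r ^ suc (j ℕ.+ k)
        U = u 1 (suc j)
        w = q ^ ex (suc j) k
        v = q ^ suc d * (q ^ k) ^ 3
        e₃ = e (c ℕ.+ 2 ℕ.* j ℕ.+ 3 ℕ.* suc k)
        g₁ = 1# - q ^ 3 * (q ^ k) ^ 3
        g₂ = 1# + q ^ (3 ℕ.+ c) * (q ^ j) ^ 2 * (q ^ k) ^ 3
        g₃ = 1# - q ^ 2 * (q ^ j) ^ 2
        eq-e : g₂ * e₃ ≈ e (c ℕ.+ 2 ℕ.* suc j ℕ.+ 3 ℕ.* k)
        eq-e = trans (*-congˡ (reflexive (≡.cong e (solveℕ 3 (λ c j k → c ⊕ nat 2 ⊗ j ⊕ nat 3 ⊗ (nat 1 ⊕ k) ⊜ nat 3 ⊕ c ⊕ nat 2 ⊗ j ⊕ nat 3 ⊗ k) ≡.refl c j k))))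
          (trans (sym (e-step′ (2 ℕ.+ c) j k)) (reflexive (≡.cong e
            (solveℕ 3 (λ c j k → nat 2 ⊕ c ⊕ nat 2 ⊗ j ⊕ nat 3 ⊗ k ⊜ c ⊕ nat 2 ⊗ (nat 1 ⊕ j) ⊕ nat 3 ⊗ k) ≡.refl c j k))))
        exponent : q ^ ex j (suc k) ≈ w * v
        exponent = trans (^-congʳ q (≡.trans (≡.cong (λ b → b ℕ.+ j ℕ.* j ℕ.+ a ℕ.* j ℕ.+ (a ℕ.+ d) ℕ.* suc k) (binom-sucʳ j k))
          (≡.trans (solveℕ 5 (λ b a d j k → (nat 3 ⊕ b ⊕ nat 6 ⊗ j ⊕ nat 9 ⊗ k) ⊕ j ⊗ j ⊕ a ⊗ j ⊕ (a ⊕ d) ⊗ (nat 1 ⊕ k)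
            ⊜ ((nat 1 ⊕ b ⊕ nat 4 ⊗ j ⊕ nat 6 ⊗ k) ⊕ (nat 1 ⊕ j) ⊗ (nat 1 ⊕ j) ⊕ a ⊗ (nat 1 ⊕ j) ⊕ (a ⊕ d) ⊗ k)
              ⊕ (nat 1 ⊕ d ⊕ nat 0 ⊗ j ⊕ nat 3 ⊗ k)) ≡.refl (binom j k) a d j k)
            (≡.cong (λ b → (b ℕ.+ suc j ℕ.* suc j ℕ.+ a ℕ.* suc j ℕ.+ (a ℕ.+ d) ℕ.* k) ℕ.+ (suc d ℕ.+ 0 ℕ.* j ℕ.+ 3 ℕ.* k)) (≡.sym (binom-sucˡ j k))))))
          (trans (^-homo-* q (ex (suc j) k) _) (*-congˡ (trans (monomial (suc d) 0 j 3 k) (*-congʳ (*-identityʳ _)))))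

      -- A creative-telescoping certificate: after the shift in j the coefficients of 1, x and x²
      -- in the recurrence combine with differences of g (in k) and y (in j).
      certified : ∀ (G W V Y : ℕ → ℕ → Carrier) →
        (∀ j k → q ^ (2 ℕ.+ a) * W j k ≈ p j k * (μ * (q ^ 7 + q ^ 11) * t j k - (ν + μ) * q ^ 6)) →
        (∀ j k → q ^ (2 ℕ.+ a) * q ^ (2 ℕ.+ a) * V j k ≈ p j k * (μ * q ^ 12)) →
        (∀ k → Y 0 k ≈ 0#) → (∀ j k → f (q ^ j) (q ^ k) * V j k ≈ Y (suc j) k) →
        (∀ k → p 0 k * (1# - t 0 k) * (ν - μ * t 0 k) + (1# - (q ^ k) ^ 3) * (1# + q ^ c * 1# ^ 2 * (q ^ k) ^ 3) * G 0 k ≈ 0#) →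
        (∀ j k → f (q ^ j) (q ^ k) * W j k
          + p (suc j) k * (1# - t (suc j) k) * (ν - μ * t (suc j) k)
          + (1# - (q ^ k) ^ 3) * (1# + q ^ c * (q ^ suc j) ^ 2 * (q ^ k) ^ 3) * G (suc j) k
          - (1# - q ^ 2 * (q ^ j) ^ 2) * (q ^ suc d * (q ^ k) ^ 3) * G j (suc k)
          ≈ - (f (q ^ j) (q ^ k) * Y j k)) →
        Recurrence
      certified G W V Y W-spec V-spec Y-zero Y-suc G-zero G-suc = recurrence (λ r →
        -- The parts of degree 0, 1, 2 take the places of a, b, c: s₀ at j + 1, s₁ at j and the two
        -- values of g all become multiples of β at (j + 1, k). The factor 1 - K³ of g vanishes at k
        -- = 0.
        telescope L (s₀ r) (s₁ r) (s₂ r) (g r) (y r)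
        (λ k → trans (sym (distribˡ _ _ _)) (trans (*-congˡ (G-zero k)) (zeroʳ _)))
        (λ k → trans (+-cong (β-vanishˡ r L k _ ℕ.≤-refl) (β-vanishˡ r L k _ ℕ.≤-refl)) (+-identityʳ 0#))
        (λ j → solve 3 (λ b w v → b :* ((one :- one :^ 3) :* w :* v) := con (+ 0)) refl (β r j 0) _ _)
        (λ j → β-vanishʳ r j L _ ℕ.≤-refl)
        (λ k → trans (*-congˡ (trans (*-congˡ (Y-zero k)) (zeroʳ _))) (zeroʳ _))
        (λ k → β-vanishˡ r (suc L) k _ (ℕ.n≤1+n L))
        (step r)
        (s₂-suc r))
        where
        g y : ℕ → ℕ → ℕ → Carrier
        g r j k = β r j k * ((1# - (q ^ k) ^ 3) * (1# + q ^ c * (q ^ j) ^ 2 * (q ^ k) ^ 3) * G j k)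
        y r j k = β r (suc j) k * (f (q ^ j) (q ^ k) * Y j k)

        g-suc : ∀ r j k → g r j (suc k) ≈ β r (suc j) k * ((1# - q ^ 2 * (q ^ j) ^ 2) * (q ^ suc d * (q ^ k) ^ 3) * G j (suc k))
        g-suc r j k = begin
          b₁ * ((1# - (q * K) ^ 3) * (1# + q ^ c * J ^ 2 * (q * K) ^ 3) * G j (suc k))
            ≈⟨ solve 6 (λ q w J K b G → b :* ((one :- (q :* K) :^ 3) :* (one :+ w :* J :^ 2 :* (q :* K) :^ 3) :* G)
                 := (b :* ((one :- q :^ 3 :* K :^ 3) :* (one :+ q :* (q :* (q :* w)) :* J :^ 2 :* K :^ 3))) :* G)
                 refl q (q ^ c) J K b₁ (G j (suc k)) ⟩
          (b₁ * ((1# - q ^ 3 * K ^ 3) * (1# + q ^ (3 ℕ.+ c) * J ^ 2 * K ^ 3))) * G j (suc k)   ≈⟨ *-congʳ (β-sucʳ r j k) ⟩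
          (β r (suc j) k * ((1# - q ^ 2 * J ^ 2) * (q ^ suc d * K ^ 3))) * G j (suc k)         ≈⟨ *-assoc _ _ _ ⟩
          β r (suc j) k * ((1# - q ^ 2 * J ^ 2) * (q ^ suc d * K ^ 3) * G j (suc k))           ∎
          where
          J = q ^ j
          K = q ^ k
          b₁ = β r j (suc k)

        s₁-suc : ∀ r j k → s₁ r j k ≈ β r (suc j) k * (f (q ^ j) (q ^ k) * W j k)
        s₁-suc r j k = begin
          s₁ r j k
            ≈⟨ solve 7 (λ ν μ q x b p t → x :* b :* (p :* (μ :* (q :^ 7 :+ q :^ 11) :* t :^ 2 :- (ν :+ μ) :* q :^ 6 :* t))
                 := (x :* t :* b) :* (p :* (μ :* (q :^ 7 :+ q :^ 11) :* t :- (ν :+ μ) :* q :^ 6))) refl ν μ q (x r) (β r j k) (p j k) (t j k) ⟩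
          (x r * t j k * β r j k) * (p j k * (μ * (q ^ 7 + q ^ 11) * t j k - (ν + μ) * q ^ 6))
            ≈⟨ *-congˡ (sym (W-spec j k)) ⟩
          (x r * t j k * β r j k) * (q ^ (2 ℕ.+ a) * W j k)
            ≈⟨ solve 5 (λ x t b s w → (x :* t :* b) :* (s :* w) := (x :* s :* t :* b) :* w) refl (x r) (t j k) (β r j k) (q ^ (2 ℕ.+ a)) (W j k) ⟩
          (x r * q ^ (2 ℕ.+ a) * t j k * β r j k) * W j k   ≈⟨ *-congʳ (β-sucˡ r j k) ⟩
          (β r (suc j) k * f (q ^ j) (q ^ k)) * W j k       ≈⟨ *-assoc _ _ _ ⟩
          β r (suc j) k * (f (q ^ j) (q ^ k) * W j k)       ∎

        -- The factor x² allows j to be raised twice. One raise gives f at (j, k), which `Y-suc`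
        -- absorbs together with V; the other gives the f at (j + 1, k) that is part of y.
        s₂-suc : ∀ r j k → s₂ r j k ≈ y r (suc j) k
        s₂-suc r j k = begin
          s₂ r j k
            ≈⟨ solve 7 (λ q μ x b p J K → x :^ 2 :* b :* (p :* (μ :* q :^ 18 :* ((J :* K) :^ 6) :^ 2))
                 := x :* (q :* J :* K) :^ 6 :* (x :* (J :* K) :^ 6 :* b) :* (p :* (μ :* q :^ 12))) refl q μ (x r) (β r j k) (p j k) J K ⟩
          x r * t (suc j) k * (x r * t j k * β r j k) * (p j k * (μ * q ^ 12))   ≈⟨ *-congˡ (sym (V-spec j k)) ⟩
          x r * t (suc j) k * (x r * t j k * β r j k) * (s * s * V j k)
            ≈⟨ solve 6 (λ x t₁ t₀ b s v → x :* t₁ :* (x :* t₀ :* b) :* (s :* s :* v) := x :* s :* t₁ :* (x :* s :* t₀ :* b) :* v)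
                 refl (x r) (t (suc j) k) (t j k) (β r j k) s (V j k) ⟩
          x r * s * t (suc j) k * (x r * s * t j k * β r j k) * V j k     ≈⟨ *-congʳ (*-congˡ (β-sucˡ r j k)) ⟩
          x r * s * t (suc j) k * (β r (suc j) k * f J K) * V j k         ≈⟨ *-congʳ (sym (*-assoc _ _ _)) ⟩
          x r * s * t (suc j) k * β r (suc j) k * f J K * V j k           ≈⟨ *-congʳ (*-congʳ (β-sucˡ r (suc j) k)) ⟩
          β r (suc (suc j)) k * f (q ^ suc j) K * f J K * V j k
            ≈⟨ trans (*-assoc _ _ _) (trans (*-assoc _ _ _) (*-congˡ (*-congˡ (Y-suc j k)))) ⟩
          β r (suc (suc j)) k * (f (q ^ suc j) K * Y (suc j) k)           ∎
          where
          J = q ^ j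
          K = q ^ k
          s = q ^ (2 ℕ.+ a)

        step : ∀ r j k → s₁ r j k + (s₀ r (suc j) k + g r (suc j) k) - g r j (suc k) ≈ - y r j k
        step r j k = begin
          s₁ r j k + (s₀ r (suc j) k + g r (suc j) k) - g r j (suc k)
            ≈⟨ +-cong (+-congʳ (s₁-suc r j k)) (-‿cong (g-suc r j k)) ⟩
          b * c₁ + (b * c₂ + b * c₃) - b * c₄
            ≈⟨ solve 5 (λ b c₁ c₂ c₃ c₄ → b :* c₁ :+ (b :* c₂ :+ b :* c₃) :- b :* c₄ := b :* (c₁ :+ c₂ :+ c₃ :- c₄)) refl b c₁ c₂ c₃ c₄ ⟩
          b * (c₁ + c₂ + c₃ - c₄)   ≈⟨ *-congˡ (G-suc j k) ⟩
          b * (- c₅)                ≈⟨ solve 2 (λ b c → b :* (:- c) := :- (b :* c)) refl b c₅ ⟩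
          - y r j k                 ∎
          where
          b = β r (suc j) k
          c₁ = f (q ^ j) (q ^ k) * W j k
          c₂ = p (suc j) k * (1# - t (suc j) k) * (ν - μ * t (suc j) k)
          c₃ = (1# - (q ^ k) ^ 3) * (1# + q ^ c * (q ^ suc j) ^ 2 * (q ^ k) ^ 3) * G (suc j) k
          c₄ = (1# - q ^ 2 * (q ^ j) ^ 2) * (q ^ suc d * (q ^ k) ^ 3) * G j (suc k)
          c₅ = f (q ^ j) (q ^ k) * Y j k

    module Second where
      p : ℕ → ℕ → Carrier
      p j k = 1# + q + q ^ 2 * (q ^ j) ^ 2 * (q ^ k) ^ 3

      open Weighted 2 4 3 1# (q ^ 4) p public

      private
        pᴾ fᴾ certᴾ yᴾ : ∀ {n} (q J K : Polynomial n) → Polynomial n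
        pᴾ q J K = one :+ q :+ q :^ 2 :* J :^ 2 :* K :^ 3
        fᴾ q J K = (one :- q :^ 2 :* J :^ 2) :* (one :+ q :^ 3 :* J :^ 2 :* K :^ 3) :* (one :+ q :^ 4 :* J :^ 2 :* K :^ 3)
        certᴾ q J K = (q :^ 2 :+ q :^ 3 :- one :- q) :* J :^ 2 :- (q :^ 2 :+ q :^ 3) :* J :^ 4 :+ (q :^ 2 :+ q :^ 3 :+ q :^ 3 :+ q :^ 4) :* J :^ 4 :* K :^ 3
          :- (one :+ q :+ q :^ 2 :+ q :^ 3 :+ q :^ 4) :* J :^ 6 :* K :^ 3 :+ (q :+ q :^ 2 :+ q :^ 3 :+ q :^ 4) :* J :^ 6 :* K :^ 6
          :- (q :+ q :^ 2) :* J :^ 8 :* K :^ 6 :+ q :^ 2 :* J :^ 8 :* K :^ 9 :+ (q :^ 4 :- q :^ 2) :* J :^ 10 :* K :^ 9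
        yᴾ q J K = (one :- J :^ 2) :* (one :+ q :* J :^ 2 :* K :^ 3) :* (one :+ q :^ 2 :* J :^ 2 :* K :^ 3) :* (q :^ 4 :* (one :+ q :+ J :^ 2 :* K :^ 3))

      -- y is f·p·q⁴ with J replaced by J/q: at j + 1 it matches f·V, and its factor 1 - J² vanishes
      -- at j = 0. The conditions on `cert` are polynomial identities in q, J, K, left to the ring
      -- solver.
      cert y : Carrier → Carrier → Carrier
      cert J K = (q ^ 2 + q ^ 3 - 1# - q) * J ^ 2 - (q ^ 2 + q ^ 3) * J ^ 4 + (q ^ 2 + q ^ 3 + q ^ 3 + q ^ 4) * J ^ 4 * K ^ 3
        - (1# + q + q ^ 2 + q ^ 3 + q ^ 4) * J ^ 6 * K ^ 3 + (q + q ^ 2 + q ^ 3 + q ^ 4) * J ^ 6 * K ^ 6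
        - (q + q ^ 2) * J ^ 8 * K ^ 6 + q ^ 2 * J ^ 8 * K ^ 9 + (q ^ 4 - q ^ 2) * J ^ 10 * K ^ 9
      y J K = (1# - J ^ 2) * (1# + q * J ^ 2 * K ^ 3) * (1# + q ^ 2 * J ^ 2 * K ^ 3) * (q ^ 4 * (1# + q + J ^ 2 * K ^ 3))

      E-recurrence : Recurrence
      E-recurrence = certified (λ j k → cert (q ^ j) (q ^ k)) (λ j k → p j k * (q ^ 4 * (q + q ^ 5) * t j k - (1# + q ^ 4)))
        (λ j k → p j k * q ^ 4) (λ j k → y (q ^ j) (q ^ k))
        (λ j k → solve 3 (λ q p t → q :^ 6 :* (p :* (q :^ 4 :* (q :+ q :^ 5) :* t :- (one :+ q :^ 4)))
          := p :* (q :^ 4 :* (q :^ 7 :+ q :^ 11) :* t :- (one :+ q :^ 4) :* q :^ 6)) refl q (p j k) (t j k))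
        (λ j k → solve 2 (λ q p → q :^ 6 :* q :^ 6 :* (p :* q :^ 4) := p :* (q :^ 4 :* q :^ 12)) refl q (p j k))
        (λ k → solve 2 (λ q K → yᴾ q one K := con (+ 0)) refl q (q ^ k))
        (λ j k → solve 3 (λ q J K → fᴾ q J K :* (pᴾ q J K :* q :^ 4) := yᴾ q (q :* J) K) refl q (q ^ j) (q ^ k))
        (λ k → solve 2 (λ q K → pᴾ q one K :* (one :- (one :* K) :^ 6) :* (one :- q :^ 4 :* (one :* K) :^ 6)
          :+ (one :- K :^ 3) :* (one :+ q :^ 2 :* one :^ 2 :* K :^ 3) :* certᴾ q one K := con (+ 0)) refl q (q ^ k))
        (λ j k → solve 3 (λ q J K →
          fᴾ q J K :* (pᴾ q J K :* (q :^ 4 :* (q :+ q :^ 5) :* (J :* K) :^ 6 :- (one :+ q :^ 4)))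
          :+ pᴾ q (q :* J) K :* (one :- (q :* J :* K) :^ 6) :* (one :- q :^ 4 :* (q :* J :* K) :^ 6)
          :+ (one :- K :^ 3) :* (one :+ q :^ 2 :* (q :* J) :^ 2 :* K :^ 3) :* certᴾ q (q :* J) K
          :- (one :- q :^ 2 :* J :^ 2) :* (q :^ 4 :* K :^ 3) :* certᴾ q J (q :* K)
          := :- (fᴾ q J K :* yᴾ q J K)) refl q (q ^ j) (q ^ k))

    module First where
      -- This is not a factor of the original summand: it arises in `Σ³-term₁`, where the two values
      -- of e left by the summation over i are merged.
      p : ℕ → ℕ → Carrier
      p j k = 1# + q * (q ^ j) ^ 4 * (q ^ k) ^ 3

      open Weighted 1 0 2 (q ^ 4) 1# p public

      -- In the certificate the monomials with negative powers of q sum to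
      -- q⁻²J⁶(1-J²) times a polynomial; θ j is q⁻²J⁶(1-J²) at J = qʲ.
      θ : ℕ → Carrier
      θ zero    = 0#
      θ (suc j) = q ^ 4 * (q ^ j) ^ 6 * (1# - q ^ 2 * (q ^ j) ^ 2)

      q²θ : ∀ j → q ^ 2 * θ j ≈ (q ^ j) ^ 6 * (1# - (q ^ j) ^ 2)
      q²θ zero    = solve 1 (λ q → q :^ 2 :* con (+ 0) := one :^ 6 :* (one :- one :^ 2)) refl q
      q²θ (suc j) = solve 2 (λ q J → q :^ 2 :* (q :^ 4 :* J :^ 6 :* (one :- q :^ 2 :* J :^ 2)) := (q :* J) :^ 6 :* (one :- (q :* J) :^ 2)) refl q (q ^ j)

      private
        pᴾ fᴾ yᴾ : ∀ {n} (q J K : Polynomial n) → Polynomial n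
        certᴾ : ∀ {n} (q Θ J K : Polynomial n) → Polynomial n
        pᴾ q J K = one :+ q :* J :^ 4 :* K :^ 3
        fᴾ q J K = (one :- q :^ 2 :* J :^ 2) :* (one :+ q :^ 2 :* J :^ 2 :* K :^ 3) :* (one :+ q :^ 3 :* J :^ 2 :* K :^ 3)
        certᴾ q Θ J K = (q :^ 6 :- q :^ 4) :* J :^ 2 :- q :^ 6 :* J :^ 4 :+ (q :^ 5 :+ q :^ 6) :* J :^ 4 :* K :^ 3
          :- (q :^ 4 :+ q :^ 5 :+ q :^ 6) :* J :^ 6 :* K :^ 3 :+ q :^ 5 :* J :^ 6 :* K :^ 6
          :+ (one :- q :^ 5) :* J :^ 8 :* K :^ 6 :+ J :^ 12 :* K :^ 9 :+ Θ :* ((one :+ J :^ 2 :* K :^ 3) :* (q :+ J :^ 2 :* K :^ 3))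
        yᴾ q J K = (one :- J :^ 2) :* (one :+ J :^ 2 :* K :^ 3) :* (one :+ q :* J :^ 2 :* K :^ 3) :* (q :^ 8 :+ q :^ 5 :* J :^ 4 :* K :^ 3)

      cert : Carrier → Carrier → Carrier → Carrier
      cert Θ J K = (q ^ 6 - q ^ 4) * J ^ 2 - q ^ 6 * J ^ 4 + (q ^ 5 + q ^ 6) * J ^ 4 * K ^ 3
        - (q ^ 4 + q ^ 5 + q ^ 6) * J ^ 6 * K ^ 3 + q ^ 5 * J ^ 6 * K ^ 6
        + (1# - q ^ 5) * J ^ 8 * K ^ 6 + J ^ 12 * K ^ 9 + Θ * ((1# + J ^ 2 * K ^ 3) * (q + J ^ 2 * K ^ 3))

      y : Carrier → Carrier → Carrier
      y J K = (1# - J ^ 2) * (1# + J ^ 2 * K ^ 3) * (1# + q * J ^ 2 * K ^ 3) * (q ^ 8 + q ^ 5 * J ^ 4 * K ^ 3)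

      E-recurrence : Recurrence
      E-recurrence = certified (λ j k → cert (θ j * (q ^ k) ^ 3) (q ^ j) (q ^ k)) (λ j k → q ^ 4 * p j k * ((q + q ^ 5) * t j k - (q ^ 4 + 1#)))
        (λ j k → p j k * q ^ 8) (λ j k → y (q ^ j) (q ^ k))
        (λ j k → solve 3 (λ q p t → q :^ 2 :* (q :^ 4 :* p :* ((q :+ q :^ 5) :* t :- (q :^ 4 :+ one)))
          := p :* (one :* (q :^ 7 :+ q :^ 11) :* t :- (q :^ 4 :+ one) :* q :^ 6)) refl q (p j k) (t j k))
        (λ j k → solve 2 (λ q p → q :^ 2 :* q :^ 2 :* (p :* q :^ 8) := p :* (one :* q :^ 12)) refl q (p j k))
        (λ k → solve 2 (λ q K → yᴾ q one K := con (+ 0)) refl q (q ^ k))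
        (λ j k → solve 3 (λ q J K → fᴾ q J K :* (pᴾ q J K :* q :^ 8) := yᴾ q (q :* J) K) refl q (q ^ j) (q ^ k))
        (λ k → solve 2 (λ q K → pᴾ q one K :* (one :- (one :* K) :^ 6) :* (q :^ 4 :- one :* (one :* K) :^ 6)
          :+ (one :- K :^ 3) :* (one :+ q :^ 1 :* one :^ 2 :* K :^ 3) :* certᴾ q (con (+ 0) :* K :^ 3) one K := con (+ 0)) refl q (q ^ k))
        -- In the certificate at k + 1 the cube of q^(k+1) supplies q³; two of these powers turn θ j
        -- into the polynomial J⁶(1 - J²). At j + 1 the definition of θ is already polynomial.
        (λ j k → trans (+-congˡ (-‿cong (*-congˡ (+-congˡ (*-congʳ (θ-suc j k)))))) (solve 3 (λ q J K →
          fᴾ q J K :* (q :^ 4 :* pᴾ q J K :* ((q :+ q :^ 5) :* (J :* K) :^ 6 :- (q :^ 4 :+ one)))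
          :+ pᴾ q (q :* J) K :* (one :- (q :* J :* K) :^ 6) :* (q :^ 4 :- one :* (q :* J :* K) :^ 6)
          :+ (one :- K :^ 3) :* (one :+ q :^ 1 :* (q :* J) :^ 2 :* K :^ 3) :* certᴾ q (q :^ 4 :* J :^ 6 :* (one :- q :^ 2 :* J :^ 2) :* K :^ 3) (q :* J) K
          :- (one :- q :^ 2 :* J :^ 2) :* (q :^ 3 :* K :^ 3) :* certᴾ q (q :* (J :^ 6 :* (one :- J :^ 2)) :* K :^ 3) J (q :* K)
          := :- (fᴾ q J K :* yᴾ q J K)) refl q (q ^ j) (q ^ k)))
        where
        θ-suc : ∀ j k → θ j * (q ^ suc k) ^ 3 ≈ q * ((q ^ j) ^ 6 * (1# - (q ^ j) ^ 2)) * (q ^ k) ^ 3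
        θ-suc j k = trans (solve 3 (λ θ q K → θ :* (q :* K) :^ 3 := q :* (q :^ 2 :* θ) :* K :^ 3) refl (θ j) q (q ^ k))
          (*-congʳ (*-congˡ (q²θ j)))

    -- Dissection of products, and both identities in the nilpotent setting.

    poch-factor-trivial : ∀ a b n → L ℕ.≤ n → 1# - q ^ (a ℕ.+ suc b ℕ.* n) ≈ 1#
    poch-factor-trivial a b n L≤n = trans (+-congˡ (-‿cong (q^-zero _
      (ℕ.≤-trans L≤n (ℕ.≤-trans (ℕ.m≤m+n n (b ℕ.* n)) (ℕ.m≤n+m _ a))))))
      (solve 0 (one :- con (+ 0) := one) refl)

    poch-stable : ∀ a b n → poch a (suc b) (n ℕ.+ L) ≈ poch a (suc b) L
    poch-stable a b n = Π-stable L n _ (poch-factor-trivial a b)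

    factor≡ : ∀ {m n} → m ≡ n → 1# - q ^ m ≈ 1# - q ^ n
    factor≡ m≡n = +-congˡ (-‿cong (^-congʳ q m≡n))

    -- The L factors are first extended to 2L by factors equal to 1, so that each residue class
    -- receives exactly L; likewise with 3L in `poch-triple`.
    poch-double : ∀ a b → poch a (suc b) L ≈ poch a (2 ℕ.* suc b) L * poch (a ℕ.+ suc b) (2 ℕ.* suc b) L
    poch-double a b = trans (sym (poch-stable a b L)) (trans (Π-double L _) (*-cong
      (Π-cong L (λ i → factor≡ (solveℕ 3 (λ a c i → a ⊕ c ⊗ (i ⊕ i) ⊜ a ⊕ nat 2 ⊗ c ⊗ i) ≡.refl a (suc b) i)))
      (Π-cong L (λ i → factor≡ (solveℕ 3 (λ a c i → a ⊕ c ⊗ (nat 1 ⊕ (i ⊕ i)) ⊜ a ⊕ c ⊕ nat 2 ⊗ c ⊗ i) ≡.refl a (suc b) i)))))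

    poch-triple : ∀ a b → poch a (suc b) L ≈
      poch a (3 ℕ.* suc b) L * poch (a ℕ.+ suc b) (3 ℕ.* suc b) L * poch (a ℕ.+ 2 ℕ.* suc b) (3 ℕ.* suc b) L
    poch-triple a b = trans (sym (poch-stable a b (L ℕ.+ L)))
      (trans (Π-triple L _) (*-cong (*-cong
      (Π-cong L (λ i → factor≡ (solveℕ 3 (λ a c i → a ⊕ c ⊗ (i ⊕ i ⊕ i) ⊜ a ⊕ nat 3 ⊗ c ⊗ i) ≡.refl a (suc b) i)))
      (Π-cong L (λ i → factor≡ (solveℕ 3 (λ a c i → a ⊕ c ⊗ (nat 1 ⊕ (i ⊕ i ⊕ i)) ⊜ a ⊕ c ⊕ nat 3 ⊗ c ⊗ i) ≡.refl a (suc b) i))))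
      (Π-cong L (λ i → factor≡ (solveℕ 3 (λ a c i → a ⊕ c ⊗ (nat 2 ⊕ (i ⊕ i ⊕ i)) ⊜ a ⊕ nat 2 ⊗ c ⊕ nat 3 ⊗ c ⊗ i) ≡.refl a (suc b) i)))))

    poch-head : ∀ a b → poch a (suc b) L ≈ (1# - q ^ a) * poch (a ℕ.+ suc b) (suc b) L
    poch-head a b = trans (sym (poch-stable a b 1)) (trans (Π-head L _) (*-cong
      (factor≡ (solveℕ 2 (λ a c → a ⊕ c ⊗ nat 0 ⊜ a) ≡.refl a (suc b)))
      (Π-cong L (λ i → factor≡ (solveℕ 3 (λ a c i → a ⊕ c ⊗ (nat 1 ⊕ i) ⊜ a ⊕ c ⊕ c ⊗ i) ≡.refl a (suc b) i)))))

    poch-u : ∀ c n → poch (suc c) (suc c) n * u c n ≈ 1#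
    poch-u c zero    = *-identityˡ 1#
    poch-u c (suc n) = begin
      poch (suc c) (suc c) n * (1# - q ^ (suc c ℕ.+ suc c ℕ.* n)) * u c (suc n)
        ≈⟨ *-assoc _ _ _ ⟩
      poch (suc c) (suc c) n * ((1# - q ^ (suc c ℕ.+ suc c ℕ.* n)) * u c (suc n))
        ≈⟨ *-congˡ (trans (*-congʳ (factor≡ (≡.sym (ℕ.*-suc (suc c) n)))) (u-spec c n)) ⟩
      poch (suc c) (suc c) n * u c n   ≈⟨ poch-u c n ⟩
      1# ∎

    -- Euler: (-p;p)∞ (p;p²)∞ = 1 for p = q^(c+1).
    euler : ∀ c (m : ℕ → Carrier) → (∀ r → m r ≈ (1# + q ^ (suc c ℕ.* suc r)) * m (suc r)) →
      (∀ r → L ℕ.≤ r → m r ≈ 1#) → m 0 * poch (suc c) (2 ℕ.* suc c) L ≈ 1#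
    euler c m m-step m-const = begin
      m 0 * odd                              ≈⟨ sym (*-identityʳ _) ⟩
      m 0 * odd * 1#                         ≈⟨ *-congˡ (sym (poch-u (c ℕ.+ 1 ℕ.* suc c) L)) ⟩
      m 0 * odd * (even * v)                 ≈⟨ solve 4 (λ m o e v → m :* o :* (e :* v) := m :* (o :* e) :* v) refl _ _ _ _ ⟩
      m 0 * (odd * even) * v
        ≈⟨ *-congʳ (*-congˡ (trans (*-congˡ (reflexive (≡.cong (λ a → poch a (2 ℕ.* suc c) L) 2c≡))) (sym (poch-double (suc c) c)))) ⟩
      m 0 * poch (suc c) (suc c) L * v         ≈⟨ *-congʳ (go L) ⟩
      m L * even * v                         ≈⟨ *-congʳ (trans (*-congʳ (m-const L ℕ.≤-refl)) (*-identityˡ _)) ⟩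
      even * v                               ≈⟨ poch-u (c ℕ.+ 1 ℕ.* suc c) L ⟩
      1#                                     ∎
      where
      odd = poch (suc c) (2 ℕ.* suc c) L
      even = poch (2 ℕ.* suc c) (2 ℕ.* suc c) L
      v = u (c ℕ.+ 1 ℕ.* suc c) L
      2c≡ : 2 ℕ.* suc c ≡ suc c ℕ.+ suc c
      2c≡ = ≡.cong (suc c ℕ.+_) (ℕ.+-identityʳ (suc c))
      go : ∀ N → m 0 * poch (suc c) (suc c) N ≈ m N * poch (2 ℕ.* suc c) (2 ℕ.* suc c) N
      go zero    = refl
      go (suc N) = begin
        m 0 * (poch (suc c) (suc c) N * (1# - z))       ≈⟨ sym (*-assoc _ _ _) ⟩
        m 0 * poch (suc c) (suc c) N * (1# - z)         ≈⟨ *-congʳ (go N) ⟩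
        m N * p₂ * (1# - z)                           ≈⟨ *-congʳ (*-congʳ (m-step N)) ⟩
        (1# + q ^ (suc c ℕ.* suc N)) * m (suc N) * p₂ * (1# - z)
          ≈⟨ *-congʳ (*-congʳ (*-congʳ (+-congˡ (^-congʳ q (ℕ.*-suc (suc c) N))))) ⟩
        (1# + z) * m (suc N) * p₂ * (1# - z)
          ≈⟨ solve 3 (λ z m p → (one :+ z) :* m :* p :* (one :- z) := m :* (p :* (one :- z :* z))) refl z _ _ ⟩
        m (suc N) * (p₂ * (1# - z * z))
          ≈⟨ *-congˡ (*-congˡ (+-congˡ (-‿cong (trans (sym (^-homo-* q (suc c ℕ.+ suc c ℕ.* N) (suc c ℕ.+ suc c ℕ.* N))) (^-congʳ q
               (solveℕ 2 (λ c n → c ⊕ c ⊗ n ⊕ (c ⊕ c ⊗ n) ⊜ nat 2 ⊗ c ⊕ nat 2 ⊗ c ⊗ n) ≡.refl (suc c) N)))))) ⟩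
        m (suc N) * poch (2 ℕ.* suc c) (2 ℕ.* suc c) (suc N) ∎
        where
        z = q ^ (suc c ℕ.+ suc c ℕ.* N)
        p₂ = poch (2 ℕ.* suc c) (2 ℕ.* suc c) N

    e-euler : e 0 * poch 1 2 L ≈ 1#
    e-euler = euler 0 e (λ r → trans (e-step r) (*-congʳ (+-congˡ (^-congʳ q (≡.sym (ℕ.*-identityˡ (suc r)))))))
      (λ r L≤r → e-const r (ℕ.m≤n⇒m≤1+n L≤r))

    C2-split : ∀ i j k → (i ℕ.+ 2 ℕ.* j ℕ.+ 3 ℕ.* k) C 2 ≡ i C 2 ℕ.+ binom j k ℕ.+ i ℕ.* (2 ℕ.* j ℕ.+ 3 ℕ.* k)
    C2-split i j k = ≡.trans (≡.cong (_C 2) (ℕ.+-assoc i (2 ℕ.* j) (3 ℕ.* k))) (C2-+ i (2 ℕ.* j ℕ.+ 3 ℕ.* k))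

    term₁ term₂ : ℕ → ℕ → ℕ → Carrier
    term₁ i j k = (1# + q ^ (2 ℕ.* i ℕ.+ 4 ℕ.* j ℕ.+ 6 ℕ.* k ℕ.+ 2) - q ^ (3 ℕ.* i ℕ.+ 6 ℕ.* j ℕ.+ 9 ℕ.* k ℕ.+ 5))
      * q ^ (((i ℕ.+ 2 ℕ.* j ℕ.+ 3 ℕ.* k) C 2) ℕ.+ i ℕ.+ j ℕ.^ 2 ℕ.+ 2 ℕ.* j ℕ.+ 2 ℕ.* k) * (u 0 i * (u 1 j * u 2 k))
    term₂ i j k = (1# + q + q ^ (2 ℕ.* j ℕ.+ 3 ℕ.* k ℕ.+ 2))
      * q ^ (((i ℕ.+ 2 ℕ.* j ℕ.+ 3 ℕ.* k) C 2) ℕ.+ 3 ℕ.* i ℕ.+ j ℕ.^ 2 ℕ.+ 4 ℕ.* j ℕ.+ 7 ℕ.* k) * (u 0 i * (u 1 j * u 2 k))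

    e-term : ℕ → ℕ → Carrier
    e-term m i = q ^ (i C 2 ℕ.+ i ℕ.* suc m) * u 0 i

    e-term-+ : ∀ s m i → e-term (s ℕ.+ m) i ≈ q ^ (s ℕ.* i) * e-term m i
    e-term-+ s m i = trans (*-congʳ (trans (^-congʳ q
      (solveℕ 4 (λ c i s m → c ⊕ i ⊗ (nat 1 ⊕ (s ⊕ m)) ⊜ s ⊗ i ⊕ (c ⊕ i ⊗ (nat 1 ⊕ m))) ≡.refl (i C 2) i s m))
      (^-homo-* q (s ℕ.* i) _))) (*-assoc _ _ _)

    module _ where
      open Second

      Σ-term₂ : ∀ j k → Σ[ L ] (λ i → term₂ i j k) ≈ β 0 j k * p j k
      Σ-term₂ j k = begin
        Σ[ L ] (λ i → term₂ i j k)    ≈⟨ Σ-cong L split ⟩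
        Σ[ L ] (λ i → (q ^ ex j k * (u 1 j * u 2 k) * p j k) * e-term (2 ℕ.+ 2 ℕ.* j ℕ.+ 3 ℕ.* k) i)
          ≈⟨ Σ-* L _ _ ⟩
        (q ^ ex j k * (u 1 j * u 2 k) * p j k) * e (2 ℕ.+ 2 ℕ.* j ℕ.+ 3 ℕ.* k)
          ≈⟨ solve 4 (λ a b p e → (a :* b :* p) :* e := (one :* (a :* b :* e)) :* p) refl _ _ _ _ ⟩
        1# * ω j k * p j k            ≈⟨ *-congʳ (*-congʳ (sym (1^n≈1 (j ℕ.+ k)))) ⟩
        β 0 j k * p j k               ∎
        where
        split : ∀ i → term₂ i j k ≈ (q ^ ex j k * (u 1 j * u 2 k) * p j k) * e-term (2 ℕ.+ 2 ℕ.* j ℕ.+ 3 ℕ.* k) i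
        split i = trans (*-congʳ (*-cong
            (+-congˡ (trans (^-congʳ q (solveℕ 2 (λ j k → nat 2 ⊗ j ⊕ nat 3 ⊗ k ⊕ nat 2 ⊜ nat 2 ⊕ nat 2 ⊗ j ⊕ nat 3 ⊗ k) ≡.refl j k)) (monomial 2 2 j 3 k)))
            (trans (^-congʳ q (≡.trans (≡.cong (λ c → c ℕ.+ 3 ℕ.* i ℕ.+ j ℕ.^ 2 ℕ.+ 4 ℕ.* j ℕ.+ 7 ℕ.* k) (C2-split i j k))
              (solveℕ 5 (λ c b i j k → c ⊕ b ⊕ i ⊗ (nat 2 ⊗ j ⊕ nat 3 ⊗ k) ⊕ nat 3 ⊗ i ⊕ j ⊛ 2 ⊕ nat 4 ⊗ j ⊕ nat 7 ⊗ k
                ⊜ (b ⊕ j ⊗ j ⊕ nat 4 ⊗ j ⊕ nat 7 ⊗ k) ⊕ (c ⊕ i ⊗ (nat 1 ⊕ (nat 2 ⊕ nat 2 ⊗ j ⊕ nat 3 ⊗ k)))) ≡.refl (i C 2) (binom j k) i j k)))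
              (^-homo-* q (ex j k) _))))
          (solve 5 (λ p a b u v → p :* (a :* b) :* (u :* v) := (a :* v :* p) :* (b :* u)) refl _ _ _ _ _)

      Σ³-term₂ : Σ³ L term₂ ≈ E 0
      Σ³-term₂ = trans (Σ³-rotate L term₂) (Σ²-cong L Σ-term₂)

      -- (q;q³)∞ splits into (q;q⁶)∞(q⁴;q⁶)∞, and 1 - q⁴ is taken out to reach the (q¹⁰;q⁶)∞ of
      -- Bailey-Daum with A = q⁹. Afterwards (1 - q³)(q⁹;q⁶)∞ = (q³;q⁶)∞, and the odd classes modulo
      -- 6 reassemble to (q;q²)∞, the inverse of e 0.
      identity₂ : ∀ d → L ℕ.≤ 6 ℕ.* d →
        poch 1 3 L * (poch 5 12 L * (poch 6 12 L * poch 9 12 L)) * Σ³ L term₂ ≈ 1#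
      identity₂ d L≤6d = begin
        poch 1 3 L * (b * (c * a)) * Σ³ L term₂     ≈⟨ *-cong (*-congʳ (trans (poch-double 1 2) (*-congˡ (poch-head 4 5)))) Σ³-term₂ ⟩
        o₁ * ((1# - q ^ 4) * a′) * (b * (c * a)) * E 0
          ≈⟨ solve 7 (λ o κ a′ b c a E → o :* (κ :* a′) :* (b :* (c :* a)) :* E := (o :* a′ :* b :* c :* a) :* (κ :* E)) refl _ _ _ _ _ _ _ ⟩
        (o₁ * a′ * b * c * a) * ((1# - q ^ 4) * E 0)   ≈⟨ *-congˡ E≈X ⟩
        (o₁ * a′ * b * c * a) * ((1# - q ^ 3) * e 0 * X 0)
          ≈⟨ solve 8 (λ o a′ b c a κ e X → (o :* a′ :* b :* c :* a) :* (κ :* e :* X) := o :* b :* c :* κ :* e :* (a′ :* a :* X)) refl _ _ _ _ _ _ _ _ ⟩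
        o₁ * b * c * (1# - q ^ 3) * e 0 * (a′ * a * X 0)   ≈⟨ *-congˡ bailey-daum ⟩
        o₁ * b * c * (1# - q ^ 3) * e 0 * (poch 9 6 L * M 0 * poch 11 12 L)
          ≈⟨ solve 8 (λ o b c κ e p M r → o :* b :* c :* κ :* e :* (p :* M :* r) := e :* (o :* (κ :* p) :* (b :* r)) :* (M :* c)) refl _ _ _ _ _ _ _ _ ⟩
        e 0 * (o₁ * ((1# - q ^ 3) * poch 9 6 L) * (b * poch 11 12 L)) * (M 0 * c)
          ≈⟨ *-congʳ (*-congˡ (*-cong (*-congˡ (sym (poch-head 3 5))) (sym (poch-double 5 5)))) ⟩
        e 0 * (o₁ * poch 3 6 L * poch 5 6 L) * (M 0 * c)   ≈⟨ *-cong (*-congˡ (sym (poch-triple 1 1))) M-euler ⟩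
        e 0 * poch 1 2 L * 1#                            ≈⟨ trans (*-identityʳ _) e-euler ⟩
        1#                                             ∎
        where
        open BaileyDaum 8 1# (q ^ 4) (solve 1 (λ q → one :* q :^ 9 :* q := q :^ 4 :* q :^ 6) refl q)
          using (X; M; X-step; X-const; M-step; M-const; bailey-daum)
        o₁ = poch 1 6 L
        a′ = poch 10 6 L
        b = poch 5 12 L
        c = poch 6 12 L
        a = poch 9 12 L
        M-euler : M 0 * poch 6 12 L ≈ 1#
        M-euler = euler 5 M M-step (λ r L≤r → M-const r (ℕ.≤-trans L≤r (ℕ.m≤n*m r 6)))
        -- The constants come from x = 0: there E is (1 + q + q²) e 2 and X is 1, while e 0 = (1 +
        -- q)(1 + q²) e 2; and (1 - q⁴)(1 + q + q²) = (1 - q³)(1 + q)(1 + q²).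
        D : ℕ → Carrier
        D r = (1# - q ^ 4) * E r - (1# - q ^ 3) * e 0 * X r
        D-step : ∀ r → 1# * D r ≈ ((1# + q ^ 4) * (1# + q ^ 6 * x r)) * D (suc r)
          - (q ^ 4 * (1# + q ^ 7 * x r) * (1# + q ^ 11 * x r)) * D (suc (suc r))
        D-step r = trans (solve 5 (λ ν a E b X → ν :* (a :* E :- b :* X) := a :* (ν :* E) :- b :* (ν :* X)) refl 1# (1# - q ^ 4) (E r) ((1# - q ^ 3) * e 0) (X r))
          (trans (+-cong (*-congˡ (E-recurrence r)) (-‿cong (*-congˡ (X-step r))))
          (solve 8 (λ s t a E₁ E₂ b X₁ X₂ → a :* (s :* E₁ :- t :* E₂) :- b :* (s :* X₁ :- t :* X₂)
            := s :* (a :* E₁ :- b :* X₁) :- t :* (a :* E₂ :- b :* X₂)) refl _ _ _ _ _ _ _ _))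
        D-zero : ∀ r → d ℕ.≤ r → D r ≈ 0#
        D-zero r d≤r = begin
          D r  ≈⟨ +-cong (*-congˡ (E-const r L≤6r)) (-‿cong (*-cong
                    (*-congˡ (trans (e-step 0) (*-congˡ (e-step 1)))) (X-const r L≤6r))) ⟩
          (1# - q ^ 4) * (1# * (1# * 1#) * e 2 * (1# + q + q ^ 2 * 1# ^ 2 * 1# ^ 3))
            - (1# - q ^ 3) * ((1# + q ^ 1) * ((1# + q ^ 2) * e 2)) * 1#
            ≈⟨ solve 2 (λ q e → (one :- q :^ 4) :* (one :* (one :* one) :* e :* (one :+ q :+ q :^ 2 :* one :^ 2 :* one :^ 3))
                 :- (one :- q :^ 3) :* ((one :+ q :^ 1) :* ((one :+ q :^ 2) :* e)) :* one := con (+ 0)) refl q (e 2) ⟩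
          0# ∎
          where
          L≤6r : L ℕ.≤ 6 ℕ.* r
          L≤6r = ℕ.≤-trans L≤6d (ℕ.*-monoʳ-≤ 6 d≤r)
        E≈X : (1# - q ^ 4) * E 0 ≈ (1# - q ^ 3) * e 0 * X 0
        E≈X = begin
          (1# - q ^ 4) * E 0              ≈⟨ solve 2 (λ a b → a := one :* (a :- b) :+ b) refl _ _ ⟩
          1# * D 0 + (1# - q ^ 3) * e 0 * X 0   ≈⟨ +-congʳ (trans (*-congʳ (sym (1^n≈1 d))) (descend 1# D _ _ d D-step D-zero)) ⟩
          0# + (1# - q ^ 3) * e 0 * X 0   ≈⟨ +-identityˡ _ ⟩
          (1# - q ^ 3) * e 0 * X 0        ∎

    module _ where
      open First

      c₁ : ℕ → ℕ → Carrier
      c₁ j k = q ^ (ex j k ℕ.+ 2 ℕ.* j) * (u 1 j * u 2 k)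

      n : ℕ → ℕ → ℕ
      n j k = 2 ℕ.* j ℕ.+ 3 ℕ.* k

      -- The three monomials of the numerator shift the index of e by 0, 2 and 3. With n = 2j + 3k,
      -- expanding e (n + 2) = (1 + q^(n+3)) e (n + 3) produces a term that cancels the negative
      -- one.
      Σ-term₁ : ∀ j k → Σ[ L ] (λ i → term₁ i j k) ≈ c₁ j k * (e (n j k) + q ^ (2 ℕ.+ 2 ℕ.* n j k) * e (3 ℕ.+ n j k))
      Σ-term₁ j k = begin
        Σ[ L ] (λ i → term₁ i j k)    ≈⟨ Σ-cong L split ⟩
        Σ[ L ] (λ i → c₁ j k * e-term m i + c₁ j k * r * e-term (2 ℕ.+ m) i + (- (c₁ j k * s)) * e-term (3 ℕ.+ m) i)
          ≈⟨ trans (Σ-+ L _ _) (+-cong (trans (Σ-+ L _ _) (+-cong (Σ-* L _ _) (Σ-* L _ _))) (Σ-* L _ _)) ⟩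
        c₁ j k * e m + c₁ j k * r * e (2 ℕ.+ m) + (- (c₁ j k * s)) * e (3 ℕ.+ m)
          ≈⟨ +-cong (+-congˡ (*-congˡ (e-step (2 ℕ.+ m)))) (*-congʳ (-‿cong (*-congˡ
               (trans (^-congʳ q (solveℕ 1 (λ m → nat 5 ⊕ nat 3 ⊗ m ⊜ nat 2 ⊕ nat 2 ⊗ m ⊕ (nat 3 ⊕ m)) ≡.refl m)) (^-homo-* q (2 ℕ.+ 2 ℕ.* m) (3 ℕ.+ m)))))) ⟩
        c₁ j k * e m + c₁ j k * r * ((1# + t₃) * e (3 ℕ.+ m)) + (- (c₁ j k * (r * t₃))) * e (3 ℕ.+ m)
          ≈⟨ solve 5 (λ c r t e f → c :* e :+ c :* r :* ((one :+ t) :* f) :+ (:- (c :* (r :* t))) :* f := c :* (e :+ r :* f)) refl _ _ _ _ _ ⟩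
        c₁ j k * (e m + r * e (3 ℕ.+ m)) ∎
        where
        m = n j k
        r = q ^ (2 ℕ.+ 2 ℕ.* m)
        s = q ^ (5 ℕ.+ 3 ℕ.* m)
        t₃ = q ^ (3 ℕ.+ m)
        split : ∀ i → term₁ i j k ≈ c₁ j k * e-term m i + c₁ j k * r * e-term (2 ℕ.+ m) i + (- (c₁ j k * s)) * e-term (3 ℕ.+ m) i
        split i = begin
          term₁ i j k
            ≈⟨ *-congʳ (*-cong (+-cong
                 (+-congˡ (trans (^-congʳ q (solveℕ 3 (λ i j k → nat 2 ⊗ i ⊕ nat 4 ⊗ j ⊕ nat 6 ⊗ k ⊕ nat 2 ⊜ nat 2 ⊗ i ⊕ (nat 2 ⊕ nat 2 ⊗ (nat 2 ⊗ j ⊕ nat 3 ⊗ k))) ≡.refl i j k)) (^-homo-* q (2 ℕ.* i) _)))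
                 (-‿cong (trans (^-congʳ q (solveℕ 3 (λ i j k → nat 3 ⊗ i ⊕ nat 6 ⊗ j ⊕ nat 9 ⊗ k ⊕ nat 5 ⊜ nat 3 ⊗ i ⊕ (nat 5 ⊕ nat 3 ⊗ (nat 2 ⊗ j ⊕ nat 3 ⊗ k))) ≡.refl i j k)) (^-homo-* q (3 ℕ.* i) _))))
                 (trans (^-congʳ q (≡.trans (≡.cong (λ c → c ℕ.+ i ℕ.+ j ℕ.^ 2 ℕ.+ 2 ℕ.* j ℕ.+ 2 ℕ.* k) (C2-split i j k))
                   (solveℕ 5 (λ c b i j k → c ⊕ b ⊕ i ⊗ (nat 2 ⊗ j ⊕ nat 3 ⊗ k) ⊕ i ⊕ j ⊛ 2 ⊕ nat 2 ⊗ j ⊕ nat 2 ⊗ k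
                     ⊜ (b ⊕ j ⊗ j ⊕ nat 0 ⊗ j ⊕ nat 2 ⊗ k ⊕ nat 2 ⊗ j) ⊕ (c ⊕ i ⊗ (nat 1 ⊕ (nat 2 ⊗ j ⊕ nat 3 ⊗ k)))) ≡.refl (i C 2) (binom j k) i j k)))
                   (^-homo-* q (ex j k ℕ.+ 2 ℕ.* j) _))) ⟩
          (1# + y₂ * r - y₃ * s) * (a * b) * (u 0 i * v)
            ≈⟨ solve 8 (λ y r z s a b w v → (one :+ y :* r :- z :* s) :* (a :* b) :* (w :* v)
                 := a :* v :* (b :* w) :+ a :* v :* r :* (y :* (b :* w)) :+ (:- (a :* v :* s)) :* (z :* (b :* w))) refl y₂ r y₃ s a b (u 0 i) v ⟩
          c₁ j k * e-term m i + c₁ j k * r * (y₂ * e-term m i) + (- (c₁ j k * s)) * (y₃ * e-term m i)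
            ≈⟨ +-cong (+-congˡ (*-congˡ (sym (e-term-+ 2 m i)))) (*-congˡ (sym (e-term-+ 3 m i))) ⟩
          c₁ j k * e-term m i + c₁ j k * r * e-term (2 ℕ.+ m) i + (- (c₁ j k * s)) * e-term (3 ℕ.+ m) i ∎
          where
          y₂ = q ^ (2 ℕ.* i)
          y₃ = q ^ (3 ℕ.* i)
          a = q ^ (ex j k ℕ.+ 2 ℕ.* j)
          b = q ^ (i C 2 ℕ.+ i ℕ.* suc m)
          v = u 1 j * u 2 k

      -- The part with e (n + 3) is G at j + 1, so a shift in j lets both parts be written with e (n
      -- + 1). Then J²(1 + qJ²K³) + (1 - J²) = 1 + qJ⁴K³, which is p.
      Σ³-term₁ : Σ³ L term₁ ≈ E 0
      Σ³-term₁ = begin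
        Σ³ L term₁    ≈⟨ Σ³-rotate L term₁ ⟩
        Σ² L (λ j k → Σ[ L ] (λ i → term₁ i j k))   ≈⟨ Σ²-cong L (λ j k → trans (Σ-term₁ j k) (distribˡ _ _ _)) ⟩
        Σ² L (λ j k → c₁ j k * e (n j k) + c₁ j k * (q ^ (2 ℕ.+ 2 ℕ.* n j k) * e (3 ℕ.+ n j k)))
          ≈⟨ trans (Σ²-+ L _ _) (+-congˡ (Σ²-cong L (λ j k → sym (shifted j k)))) ⟩
        Σ² L (λ j k → c₁ j k * e (n j k)) + Σ² L (λ j k → G (suc j) k)
          ≈⟨ +-congˡ (sym (Σ²-shiftˡ L G (λ k → solve 1 (λ w → w :* (one :- one :^ 2) := con (+ 0)) refl (ω 0 k))
               (λ k → trans (*-congʳ (trans (sym (*-identityˡ _)) (*-congʳ (sym (1^n≈1 (L ℕ.+ k)))))) (β-vanishˡ 0 L k _ ℕ.≤-refl)))) ⟩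
        Σ² L (λ j k → c₁ j k * e (n j k)) + Σ² L G   ≈⟨ sym (Σ²-+ L _ _) ⟩
        Σ² L (λ j k → c₁ j k * e (n j k) + G j k)    ≈⟨ Σ²-cong L combine ⟩
        E 0 ∎
        where
        G : ℕ → ℕ → Carrier
        G j k = ω j k * (1# - (q ^ j) ^ 2)
        shifted : ∀ j k → G (suc j) k ≈ c₁ j k * (q ^ (2 ℕ.+ 2 ℕ.* n j k) * e (3 ℕ.+ n j k))
        shifted j k = begin
          q ^ ex (suc j) k * (u 1 (suc j) * u 2 k) * e₄ * (1# - (q * q ^ j) ^ 2)
            ≈⟨ solve 6 (λ x U V e q J → x :* (U :* V) :* e :* (one :- (q :* J) :^ 2) := x :* (((one :- q :^ 2 :* J :^ 2) :* U) :* V) :* e) refl _ _ _ _ q (q ^ j) ⟩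
          q ^ ex (suc j) k * (((1# - q ^ 2 * (q ^ j) ^ 2) * u 1 (suc j)) * u 2 k) * e₄
            ≈⟨ *-cong (*-cong exponent (*-congʳ (u-step 1 j))) (reflexive (≡.cong e
                 (solveℕ 2 (λ j k → nat 1 ⊕ nat 2 ⊗ (nat 1 ⊕ j) ⊕ nat 3 ⊗ k ⊜ nat 3 ⊕ (nat 2 ⊗ j ⊕ nat 3 ⊗ k)) ≡.refl j k))) ⟩
          (a * r) * (u 1 j * u 2 k) * e (3 ℕ.+ n j k)
            ≈⟨ solve 4 (λ a r v e → a :* r :* v :* e := a :* v :* (r :* e)) refl _ _ _ _ ⟩
          c₁ j k * (r * e (3 ℕ.+ n j k)) ∎
          where
          e₄ = e (1 ℕ.+ 2 ℕ.* suc j ℕ.+ 3 ℕ.* k)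
          a = q ^ (ex j k ℕ.+ 2 ℕ.* j)
          r = q ^ (2 ℕ.+ 2 ℕ.* n j k)
          exponent : q ^ ex (suc j) k ≈ a * r
          exponent = trans (^-congʳ q (≡.trans (≡.cong (λ b → b ℕ.+ suc j ℕ.* suc j ℕ.+ 0 ℕ.* suc j ℕ.+ 2 ℕ.* k) (binom-sucˡ j k))
            (solveℕ 3 (λ b j k → (nat 1 ⊕ b ⊕ nat 4 ⊗ j ⊕ nat 6 ⊗ k) ⊕ (nat 1 ⊕ j) ⊗ (nat 1 ⊕ j) ⊕ nat 0 ⊗ (nat 1 ⊕ j) ⊕ nat 2 ⊗ k
              ⊜ (b ⊕ j ⊗ j ⊕ nat 0 ⊗ j ⊕ nat 2 ⊗ k ⊕ nat 2 ⊗ j) ⊕ (nat 2 ⊕ nat 2 ⊗ (nat 2 ⊗ j ⊕ nat 3 ⊗ k))) ≡.refl (binom j k) j k)))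
            (^-homo-* q (ex j k ℕ.+ 2 ℕ.* j) _)
        combine : ∀ j k → c₁ j k * e (n j k) + G j k ≈ β 0 j k * p j k
        combine j k = begin
          q ^ (ex j k ℕ.+ 2 ℕ.* j) * (u 1 j * u 2 k) * e (n j k) + G j k
            ≈⟨ +-congʳ (*-cong (*-congʳ (trans (^-homo-* q (ex j k) (2 ℕ.* j)) (*-congˡ
                 (trans (^-congʳ q (ℕ.*-comm 2 j)) (sym (^-assocʳ q j 2)))))) (e-step′ 0 j k)) ⟩
          q ^ ex j k * J ^ 2 * (u 1 j * u 2 k) * ((1# + q ^ 1 * J ^ 2 * K ^ 3) * e₁) + q ^ ex j k * (u 1 j * u 2 k) * e₁ * (1# - J ^ 2)
            ≈⟨ solve 6 (λ x v e q J K → x :* J :^ 2 :* v :* ((one :+ q :^ 1 :* J :^ 2 :* K :^ 3) :* e) :+ x :* v :* e :* (one :- J :^ 2)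
                 := one :* (x :* v :* e) :* (one :+ q :* J :^ 4 :* K :^ 3)) refl (q ^ ex j k) (u 1 j * u 2 k) e₁ q J K ⟩
          1# * ω j k * p j k            ≈⟨ *-congʳ (*-congʳ (sym (1^n≈1 (j ℕ.+ k)))) ⟩
          β 0 j k * p j k ∎
          where
          J = q ^ j
          K = q ^ k
          e₁ = e (1 ℕ.+ 2 ℕ.* j ℕ.+ 3 ℕ.* k)

      -- Now ν = q⁴, so the descent yields E 0 = e 0 · X 0 only after multiplication by q^(4d). The
      -- bracket splits into a multiple of that difference and a product part that is exactly 1 - 1.
      identity₁ : ∀ d → L ℕ.≤ 6 ℕ.* d →
        (q ^ 4) ^ d * (poch 2 3 L * (poch 1 12 L * (poch 6 12 L * poch 9 12 L)) * Σ³ L term₁ - 1#) ≈ 0#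
      identity₁ d L≤6d = begin
        ν * (poch 2 3 L * (a * (c * b)) * Σ³ L term₁ - 1#)
          ≈⟨ *-congˡ (+-congʳ (*-cong (*-congʳ (poch-double 2 2)) Σ³-term₁)) ⟩
        ν * (a′ * o₅ * (a * (c * b)) * E 0 - 1#)
          ≈⟨ solve 8 (λ ν a′ o a c b E Y → ν :* (a′ :* o :* (a :* (c :* b)) :* E :- one)
               := a′ :* o :* a :* c :* b :* (ν :* (E :- Y)) :+ ν :* (a′ :* o :* a :* c :* b :* Y :- one)) refl ν a′ o₅ a c b (E 0) (e 0 * X 0) ⟩
        a′ * o₅ * a * c * b * (ν * (E 0 - e 0 * X 0)) + ν * (a′ * o₅ * a * c * b * (e 0 * X 0) - 1#)
          ≈⟨ +-cong (*-congˡ (descend (q ^ 4) D _ _ d D-step D-zero)) (*-congˡ (+-congʳ product≈1)) ⟩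
        a′ * o₅ * a * c * b * 0# + ν * (1# - 1#)
          ≈⟨ solve 2 (λ x ν → x :* con (+ 0) :+ ν :* (one :- one) := con (+ 0)) refl _ _ ⟩
        0# ∎
        where
        open BaileyDaum 0 (q ^ 4) 1# (solve 1 (λ q → q :^ 4 :* q :^ 1 :* q := one :* q :^ 6) refl q)
          using (X; M; X-step; X-const; M-step; M-const; bailey-daum)
        ν = (q ^ 4) ^ d
        a′ = poch 2 6 L
        o₅ = poch 5 6 L
        a = poch 1 12 L
        c = poch 6 12 L
        b = poch 9 12 L
        M-euler : M 0 * poch 6 12 L ≈ 1#
        M-euler = euler 5 M M-step (λ r L≤r → M-const r (ℕ.≤-trans L≤r (ℕ.m≤n*m r 6)))
        product≈1 : a′ * o₅ * a * c * b * (e 0 * X 0) ≈ 1#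
        product≈1 = begin
          a′ * o₅ * a * c * b * (e 0 * X 0)
            ≈⟨ solve 7 (λ a′ o a c b e X → a′ :* o :* a :* c :* b :* (e :* X) := o :* c :* b :* e :* (a′ :* a :* X)) refl _ _ _ _ _ _ _ ⟩
          o₅ * c * b * e 0 * (a′ * a * X 0)   ≈⟨ *-congˡ bailey-daum ⟩
          o₅ * c * b * e 0 * (poch 1 6 L * M 0 * poch 3 12 L)
            ≈⟨ solve 7 (λ o c b e p M r → o :* c :* b :* e :* (p :* M :* r) := e :* (p :* (r :* b) :* o) :* (M :* c)) refl _ _ _ _ _ _ _ ⟩
          e 0 * (poch 1 6 L * (poch 3 12 L * b) * o₅) * (M 0 * c)
            ≈⟨ *-cong (*-congˡ (trans (*-congʳ (*-congˡ (sym (poch-double 3 5)))) (sym (poch-triple 1 1)))) M-euler ⟩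
          e 0 * poch 1 2 L * 1#                 ≈⟨ trans (*-identityʳ _) e-euler ⟩
          1# ∎
        -- At x = 0 one has E = (1 + q) e 1 = e 0 and X = 1, so e 0 is the right constant.
        D : ℕ → Carrier
        D r = E r - e 0 * X r
        D-step : ∀ r → q ^ 4 * D r ≈ ((q ^ 4 + 1#) * (1# + q ^ 6 * x r)) * D (suc r)
          - (1# * (1# + q ^ 7 * x r) * (1# + q ^ 11 * x r)) * D (suc (suc r))
        D-step r = trans (solve 4 (λ ν E b X → ν :* (E :- b :* X) := ν :* E :- b :* (ν :* X)) refl (q ^ 4) (E r) (e 0) (X r))
          (trans (+-cong (E-recurrence r) (-‿cong (*-congˡ (X-step r))))
          (solve 7 (λ s t E₁ E₂ b X₁ X₂ → (s :* E₁ :- t :* E₂) :- b :* (s :* X₁ :- t :* X₂)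
            := s :* (E₁ :- b :* X₁) :- t :* (E₂ :- b :* X₂)) refl _ _ _ _ _ _ _))
        D-zero : ∀ r → d ℕ.≤ r → D r ≈ 0#
        D-zero r d≤r = begin
          D r  ≈⟨ +-cong (E-const r L≤6r) (-‿cong (*-cong (e-step 0) (X-const r L≤6r))) ⟩
          1# * (1# * 1#) * e 1 * (1# + q * 1# ^ 4 * 1# ^ 3) - (1# + q ^ 1) * e 1 * 1#
            ≈⟨ solve 2 (λ q e → one :* (one :* one) :* e :* (one :+ q :* one :^ 4 :* one :^ 3) :- (one :+ q :^ 1) :* e :* one := con (+ 0)) refl q (e 1) ⟩
          0# ∎
          where
          L≤6r : L ℕ.≤ 6 ℕ.* r
          L≤6r = ℕ.≤-trans L≤6d (ℕ.*-monoʳ-≤ 6 d≤r)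

-- Power series over ℚ and their truncations.

module PowerSeries where

  open import Data.Nat.Base as ℕ using (ℕ; zero; suc; z≤n; s≤s)
  import Data.Nat.Properties as ℕ
  open import Data.Rational.Base
  open import Data.Rational.Properties
  open import Data.Rational.Solver using (module +-*-Solver)
  open import Data.Product using (_,_)
  open import Relation.Binary.PropositionalEquality
  open ≡-Reasoning

  Series : Set
  Series = ℕ → ℚ

  infixl 6 _⊕_
  infixl 7 _⊗_
  infix 4 _≈[_]_

  -- A record rather than a bare function type, so that a, M and b can be recovered by unification.
  record _≈[_]_ (a : Series) (M : ℕ) (b : Series) : Set where
    constructor agree
    field at : ∀ n → n ℕ.< M → a n ≡ b n
  open _≈[_]_ public

  tail : Series → Series
  tail a n = a (suc n)

  0ˢ 1ˢ X : Series
  0ˢ n = 0ℚ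
  1ˢ zero    = 1ℚ
  1ˢ (suc n) = 0ℚ
  X zero    = 0ℚ
  X (suc n) = 1ˢ n

  _⊕_ _⊗_ : Series → Series → Series
  (a ⊕ b) n = a n + b n
  (a ⊗ b) zero    = a 0 * b 0
  (a ⊗ b) (suc n) = a 0 * b (suc n) + (tail a ⊗ b) n

  ⊖_ : Series → Series
  (⊖ a) n = - a n

  _·_ : ℚ → Series → Series
  (s · a) n = s * a n

  module _ where
    open +-*-Solver

    ⊗-cong≤ : ∀ n {a a′ b b′} → (∀ m → m ℕ.≤ n → a m ≡ a′ m) → (∀ m → m ℕ.≤ n → b m ≡ b′ m) →
      (a ⊗ b) n ≡ (a′ ⊗ b′) n
    ⊗-cong≤ zero    a≡ b≡ = cong₂ _*_ (a≡ 0 z≤n) (b≡ 0 z≤n)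
    ⊗-cong≤ (suc n) a≡ b≡ = cong₂ _+_ (cong₂ _*_ (a≡ 0 z≤n) (b≡ (suc n) ℕ.≤-refl))
      (⊗-cong≤ n (λ m m≤n → a≡ (suc m) (s≤s m≤n)) (λ m m≤n → b≡ m (ℕ.m≤n⇒m≤1+n m≤n)))

    -- The recursion of the product peels off the head of a; commutativity needs the head of b to be
    -- peeled off as well.
    ⊗-suc : ∀ n a b → (a ⊗ b) (suc n) ≡ (a ⊗ tail b) n + a (suc n) * b 0
    ⊗-suc zero    a b = refl
    ⊗-suc (suc n) a b = trans (cong (a 0 * b (suc (suc n)) +_) (⊗-suc n (tail a) b)) (sym (+-assoc (a 0 * b (suc (suc n))) _ _))

    ⊗-comm : ∀ a b n → (a ⊗ b) n ≡ (b ⊗ a) n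
    ⊗-comm a b zero    = *-comm (a 0) (b 0)
    ⊗-comm a b (suc n) = trans (cong₂ _+_ (*-comm (a 0) (b (suc n))) (⊗-comm (tail a) b n))
      (trans (+-comm (b (suc n) * a 0) _) (sym (⊗-suc n b a)))

    ⊗-distribʳ : ∀ c a b n → ((a ⊕ b) ⊗ c) n ≡ (a ⊗ c) n + (b ⊗ c) n
    ⊗-distribʳ c a b zero    = *-distribʳ-+ (c 0) (a 0) (b 0)
    ⊗-distribʳ c a b (suc n) = trans (cong ((a 0 + b 0) * c (suc n) +_) (⊗-distribʳ c (tail a) (tail b) n))
      (solve 5 (λ x y z v w → (x :+ y) :* z :+ (v :+ w) := (x :* z :+ v) :+ (y :* z :+ w)) refl
        (a 0) (b 0) (c (suc n)) ((tail a ⊗ c) n) ((tail b ⊗ c) n))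

    ⊗-scale : ∀ s a b n → ((s · a) ⊗ b) n ≡ s * (a ⊗ b) n
    ⊗-scale s a b zero    = *-assoc s (a 0) (b 0)
    ⊗-scale s a b (suc n) = trans (cong (s * a 0 * b (suc n) +_) (⊗-scale s (tail a) b n))
      (solve 4 (λ s x y z → s :* x :* y :+ s :* z := s :* (x :* y :+ z)) refl s (a 0) (b (suc n)) ((tail a ⊗ b) n))

    ⊗-assoc : ∀ a b c n → ((a ⊗ b) ⊗ c) n ≡ (a ⊗ (b ⊗ c)) n
    ⊗-assoc a b c zero    = *-assoc (a 0) (b 0) (c 0)
    ⊗-assoc a b c (suc n) = begin
      a 0 * b 0 * c (suc n) + (((a 0 · tail b) ⊕ (tail a ⊗ b)) ⊗ c) n
        ≡⟨ cong (a 0 * b 0 * c (suc n) +_) (trans (⊗-distribʳ c (a 0 · tail b) (tail a ⊗ b) n)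
             (cong₂ _+_ (⊗-scale (a 0) (tail b) c n) (⊗-assoc (tail a) b c n))) ⟩
      a 0 * b 0 * c (suc n) + (a 0 * (tail b ⊗ c) n + (tail a ⊗ (b ⊗ c)) n)
        ≡⟨ solve 5 (λ x y z v w → x :* y :* z :+ (x :* v :+ w) := x :* (y :* z :+ v) :+ w) refl
             (a 0) (b 0) (c (suc n)) ((tail b ⊗ c) n) ((tail a ⊗ (b ⊗ c)) n) ⟩
      a 0 * (b 0 * c (suc n) + (tail b ⊗ c) n) + (tail a ⊗ (b ⊗ c)) n ∎

    0⊗ : ∀ a n → (0ˢ ⊗ a) n ≡ 0ℚ
    0⊗ a zero    = *-zeroˡ (a 0)
    0⊗ a (suc n) = trans (cong₂ _+_ (*-zeroˡ (a (suc n))) (0⊗ a n)) (+-identityˡ 0ℚ)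

    1⊗ : ∀ a n → (1ˢ ⊗ a) n ≡ a n
    1⊗ a zero    = *-identityˡ (a 0)
    1⊗ a (suc n) = trans (cong₂ _+_ (*-identityˡ (a (suc n))) (0⊗ a n)) (+-identityʳ (a (suc n)))

  -- ℚ[[X]] / X^M, with the quotient expressed by the equality of the setoid
  truncated : ℕ → CommutativeRing 0ℓ 0ℓ
  truncated M = record
    { Carrier = Series ; _≈_ = _≈[ M ]_ ; _+_ = _⊕_ ; _*_ = _⊗_ ; -_ = ⊖_ ; 0# = 0ˢ ; 1# = 1ˢ
    ; isCommutativeRing = record
      { isRing = record
        { +-isAbelianGroup = record
          { isGroup = record
            { isMonoid = record
              { isSemigroup = record
                { isMagma = record
                  { isEquivalence = record
                    { refl = agree λ _ _ → refl ; sym = λ p → agree λ n n< → sym (at p n n<)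
                    ; trans = λ p r → agree λ n n< → trans (at p n n<) (at r n n<) }
                  ; ∙-cong = λ p r → agree λ n n< → cong₂ _+_ (at p n n<) (at r n n<) }
                ; assoc = λ a b c → agree λ n _ → +-assoc (a n) (b n) (c n) }
              ; identity = (λ a → agree λ n _ → +-identityˡ (a n)) , (λ a → agree λ n _ → +-identityʳ (a n)) }
            ; inverse = (λ a → agree λ n _ → +-inverseˡ (a n)) , (λ a → agree λ n _ → +-inverseʳ (a n))
            ; ⁻¹-cong = λ p → agree λ n n< → cong -_ (at p n n<) }
          ; comm = λ a b → agree λ n _ → +-comm (a n) (b n) }
        ; *-cong = λ p r → agree λ n n< → ⊗-cong≤ n (λ m m≤n → at p m (ℕ.≤-<-trans m≤n n<)) (λ m m≤n → at r m (ℕ.≤-<-trans m≤n n<))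
        ; *-assoc = λ a b c → agree λ n _ → ⊗-assoc a b c n
        ; *-identity = (λ a → agree λ n _ → 1⊗ a n) , (λ a → agree λ n _ → trans (⊗-comm a 1ˢ n) (1⊗ a n))
        ; distrib = (λ c a b → agree λ n _ → trans (⊗-comm c (a ⊕ b) n) (trans (⊗-distribʳ c a b n)
                       (cong₂ _+_ (⊗-comm a c n) (⊗-comm b c n))))
                  , (λ c a b → agree λ n _ → ⊗-distribʳ c a b n) }
      ; *-comm = λ a b → agree λ n _ → ⊗-comm a b n } }

  shift : Series → Series
  shift a zero    = 0ℚ
  shift a (suc n) = a n

  shift^ : ℕ → Series → Series
  shift^ zero    a = a
  shift^ (suc k) a = shift (shift^ k a)

  X⊗ : ∀ a n → (X ⊗ a) n ≡ shift a n
  X⊗ a zero    = *-zeroˡ (a 0)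
  X⊗ a (suc n) = trans (cong₂ _+_ (*-zeroˡ (a (suc n))) (1⊗ a n)) (+-identityˡ (a n))

  shift^-vanish : ∀ k a → shift^ k a ≈[ k ] 0ˢ
  shift^-vanish k a = agree (go k)
    where
    go : ∀ k n → n ℕ.< k → shift^ k a n ≡ 0ℚ
    go (suc k) zero    _        = refl
    go (suc k) (suc n) (s≤s n<) = go k n n<

  -- Division by X^k, at the cost of k coefficients of precision.
  shift^-cancel : ∀ k M a → shift^ k a ≈[ k ℕ.+ M ] 0ˢ → a ≈[ M ] 0ˢ
  shift^-cancel zero    M a p = p
  shift^-cancel (suc k) M a p = shift^-cancel k M a (agree λ n n< → at p (suc n) (s≤s n<))

  -- geo m r = X^r / (1 - X^(m+1)) for r ≤ m
  geo : ℕ → ℕ → Series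
  geo m zero    zero    = 1ℚ
  geo m (suc r) zero    = 0ℚ
  geo m zero    (suc n) = geo m m n
  geo m (suc r) (suc n) = geo m r n

  geo-shift^ : ∀ m r n → geo m r n ≡ shift^ r (geo m 0) n
  geo-shift^ m zero    n       = refl
  geo-shift^ m (suc r) zero    = refl
  geo-shift^ m (suc r) (suc n) = geo-shift^ m r n

  inv : ℕ → Series
  inv m = geo m 0

  inv-unfold : ∀ m n → inv m n ≡ (1ˢ ⊕ shift^ (suc m) (inv m)) n
  inv-unfold m zero    = refl
  inv-unfold m (suc n) = trans (geo-shift^ m m n) (sym (+-identityˡ _))

-- The identities as congruences of power series, for sums over arbitrary large finite sets of
-- indices.

module FormalIdentities where

  import Algebra.Properties.CommutativeSemiring.Exp
  import Algebra.Properties.Ring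
  import Relation.Binary.Reasoning.Setoid
  open PowerSeries
  open import Data.Nat.Base as ℕ using (ℕ; zero; suc)
  open import Data.Nat.Combinatorics using (_C_)
  import Data.Nat.Properties as ℕ
  open import Data.Product using (_×_; _,_; proj₁; proj₂)
  open import Data.List.Base using (List; []; _∷_; _++_; map; foldr; applyUpTo; upTo; cartesianProduct)
  open import Data.List.Properties using (map-∘)
  open import Data.List.Membership.Propositional using (_∈_; _∉_)
  open import Data.List.Membership.Propositional.Properties using (∈-∃++; ∈-++⁻; ∈-++⁺ˡ; ∈-++⁺ʳ; ∈-insert; ∈-upTo⁺; ∈-cartesianProduct⁺)
  open import Data.List.Relation.Unary.Any using (here; there)
  open import Data.List.Relation.Unary.All as All using (All; []; _∷_)
  open import Data.List.Relation.Unary.AllPairs using ([]; _∷_)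
  open import Data.List.Relation.Unary.Unique.Propositional using (Unique)
  open import Data.List.Relation.Unary.Unique.Propositional.Properties using (upTo⁺; cartesianProduct⁺)
  open import Data.List.Relation.Binary.Subset.Propositional using (_⊆_)
  open import Data.Sum.Base using (inj₁; inj₂; [_,_]′)
  open import Data.Empty using (⊥-elim)
  open import Relation.Binary.PropositionalEquality as ≡ using (_≡_)

  -- Products and quotients are applied to a series one factor at a time, so that majorants and
  -- values can be followed through each step.
  mulFactor : ℕ → Series → Series
  mulFactor k c = c ⊕ (⊖ shift^ k c)

  mulFactors : ℕ → ℕ → ℕ → Series → Series
  mulFactors a b zero    c = c
  mulFactors a b (suc N) c = mulFactor (a ℕ.+ b ℕ.* N) (mulFactors a b N c)

  divPoch : ℕ → ℕ → Series → Series
  divPoch c zero    s = s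
  divPoch c (suc n) s = inv (n ℕ.+ c ℕ.* suc n) ⊗ divPoch c n s

  Index : Set
  Index = ℕ × ℕ × ℕ

  exponent₁ exponent₂ : Index → ℕ
  exponent₁ (i , j , k) = ((i ℕ.+ 2 ℕ.* j ℕ.+ 3 ℕ.* k) C 2) ℕ.+ i ℕ.+ j ℕ.^ 2 ℕ.+ 2 ℕ.* j ℕ.+ 2 ℕ.* k
  exponent₂ (i , j , k) = ((i ℕ.+ 2 ℕ.* j ℕ.+ 3 ℕ.* k) C 2) ℕ.+ 3 ℕ.* i ℕ.+ j ℕ.^ 2 ℕ.+ 4 ℕ.* j ℕ.+ 7 ℕ.* k

  factor₁ factor₂ : Index → Series
  factor₁ (i , j , k) = (1ˢ ⊕ shift^ (2 ℕ.* i ℕ.+ 4 ℕ.* j ℕ.+ 6 ℕ.* k ℕ.+ 2) 1ˢ)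
    ⊕ (⊖ shift^ (3 ℕ.* i ℕ.+ 6 ℕ.* j ℕ.+ 9 ℕ.* k ℕ.+ 5) 1ˢ)
  factor₂ (i , j , k) = (1ˢ ⊕ shift 1ˢ) ⊕ shift^ (2 ℕ.* j ℕ.+ 3 ℕ.* k ℕ.+ 2) 1ˢ

  divide : Index → Series → Series
  divide (i , j , k) s = divPoch 0 i (divPoch 1 j (divPoch 2 k s))

  term₁ term₂ : Index → Series
  term₁ I = divide I (shift^ (exponent₁ I) (factor₁ I))
  term₂ I = divide I (shift^ (exponent₂ I) (factor₂ I))

  sumˢ : ∀ {A : Set} → (A → Series) → List A → Series
  sumˢ f F = foldr _⊕_ 0ˢ (map f F)

  box : ℕ → List Index
  box N = cartesianProduct (upTo N) (cartesianProduct (upTo N) (upTo N))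

  box-unique : ∀ N → Unique (box N)
  box-unique N = cartesianProduct⁺ (upTo⁺ N) (cartesianProduct⁺ (upTo⁺ N) (upTo⁺ N))

  -- The formal counterpart of A·B·Σ - 1 for finitely many factors and terms.
  defect : ℕ → ℕ → ℕ → ℕ → ℕ → ℕ → (Index → Series) → List Index → ℕ → Series
  defect a b a₁ a₂ a₃ c t F N =
    mulFactors a b N (mulFactors a₁ c N (mulFactors a₂ c N (mulFactors a₃ c N (sumˢ t F)))) ⊕ (⊖ 1ˢ)

  module Truncation (l : ℕ) where
    M : ℕ
    M = suc l

    ring : CommutativeRing 0ℓ 0ℓ
    ring = truncated M

    open CommutativeRing ring hiding (ring)
    open Algebra.Properties.CommutativeSemiring.Exp commutativeSemiring using (_^_)
    open Algebra.Properties.Ring (CommutativeRing.ring ring) using (-‿distribˡ-*)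
    open FiniteSums ring
    open import Relation.Binary.Reasoning.Setoid setoid

    X^⊗ : ∀ k a → X ^ k ⊗ a ≈ shift^ k a
    X^⊗ zero    a = *-identityˡ a
    X^⊗ (suc k) a = trans (*-assoc X (X ^ k) a) (trans (*-congˡ {X} (X^⊗ k a)) (agree λ n _ → X⊗ (shift^ k a) n))

    X^≈ : ∀ k → X ^ k ≈ shift^ k 1ˢ
    X^≈ k = trans (sym (*-identityʳ (X ^ k))) (X^⊗ k 1ˢ)

    nil : X ^ M ≈ 0ˢ
    nil = trans (X^≈ M) (shift^-vanish M 1ˢ)

    inv-spec : ∀ m → (1ˢ ⊕ (⊖ (X ^ suc m))) ⊗ inv m ≈ 1ˢ
    inv-spec m = begin
      (1ˢ ⊕ (⊖ (X ^ suc m))) ⊗ inv m             ≈⟨ distribʳ (inv m) 1ˢ (⊖ (X ^ suc m)) ⟩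
      (1ˢ ⊗ inv m) ⊕ ((⊖ (X ^ suc m)) ⊗ inv m)
        ≈⟨ +-cong (*-identityˡ (inv m)) (trans (sym (-‿distribˡ-* (X ^ suc m) (inv m))) (-‿cong (X^⊗ (suc m) (inv m)))) ⟩
      inv m ⊕ (⊖ shift^ (suc m) (inv m))         ≈⟨ +-congʳ (agree λ n _ → inv-unfold m n) ⟩
      (1ˢ ⊕ shift^ (suc m) (inv m)) ⊕ (⊖ shift^ (suc m) (inv m))   ≈⟨ +-assoc 1ˢ _ _ ⟩
      1ˢ ⊕ (shift^ (suc m) (inv m) ⊕ (⊖ shift^ (suc m) (inv m)))   ≈⟨ +-congˡ {1ˢ} (-‿inverseʳ (shift^ (suc m) (inv m))) ⟩
      1ˢ ⊕ 0ˢ                                    ≈⟨ +-identityʳ 1ˢ ⟩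
      1ˢ                                         ∎

    module G = QSeries.Nilpotent ring X inv inv-spec l nil
    open G using (u; poch)

    mulFactors≈ : ∀ a b N c → mulFactors a b N c ≈ poch a b N ⊗ c
    mulFactors≈ a b zero    c = sym (*-identityˡ c)
    mulFactors≈ a b (suc N) c = begin
      s ⊕ (⊖ shift^ m s)             ≈⟨ +-congˡ {s} (-‿cong (sym (X^⊗ m s))) ⟩
      s ⊕ (⊖ (X ^ m ⊗ s))            ≈⟨ +-cong (sym (*-identityˡ s)) (-‿distribˡ-* (X ^ m) s) ⟩
      (1ˢ ⊗ s) ⊕ ((⊖ (X ^ m)) ⊗ s)   ≈⟨ sym (distribʳ s 1ˢ (⊖ (X ^ m))) ⟩
      (1ˢ ⊕ (⊖ (X ^ m))) ⊗ s         ≈⟨ *-congˡ (mulFactors≈ a b N c) ⟩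
      (1ˢ ⊕ (⊖ (X ^ m))) ⊗ (poch a b N ⊗ c)   ≈⟨ sym (*-assoc _ (poch a b N) c) ⟩
      ((1ˢ ⊕ (⊖ (X ^ m))) ⊗ poch a b N) ⊗ c   ≈⟨ *-congʳ (*-comm _ (poch a b N)) ⟩
      (poch a b N ⊗ (1ˢ ⊕ (⊖ (X ^ m)))) ⊗ c   ∎
      where
      m = a ℕ.+ b ℕ.* N
      s = mulFactors a b N c

    divPoch≈ : ∀ c n s → divPoch c n s ≈ u c n ⊗ s
    divPoch≈ c zero    s = sym (*-identityˡ s)
    divPoch≈ c (suc n) s = begin
      i ⊗ divPoch c n s    ≈⟨ *-congˡ {i} (divPoch≈ c n s) ⟩
      i ⊗ (u c n ⊗ s)      ≈⟨ sym (*-assoc i (u c n) s) ⟩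
      (i ⊗ u c n) ⊗ s      ≈⟨ *-congʳ (*-comm i (u c n)) ⟩
      (u c n ⊗ i) ⊗ s      ∎
      where i = inv (n ℕ.+ c ℕ.* suc n)

    open IntegerSolver ring using (solve; _:*_; _:=_)

    divide≈ : ∀ i j k s → divide (i , j , k) s ≈ s ⊗ (u 0 i ⊗ (u 1 j ⊗ u 2 k))
    divide≈ i j k s = begin
      divPoch 0 i (divPoch 1 j (divPoch 2 k s))
        ≈⟨ trans (divPoch≈ 0 i _) (*-congˡ {u 0 i} (trans (divPoch≈ 1 j _) (*-congˡ {u 1 j} (divPoch≈ 2 k s)))) ⟩
      u 0 i ⊗ (u 1 j ⊗ (u 2 k ⊗ s))
        ≈⟨ solve 4 (λ a b c s → a :* (b :* (c :* s)) := s :* (a :* (b :* c))) refl (u 0 i) (u 1 j) (u 2 k) s ⟩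
      s ⊗ (u 0 i ⊗ (u 1 j ⊗ u 2 k)) ∎

    shift^-⊗ : ∀ k a → shift^ k a ≈ a ⊗ X ^ k
    shift^-⊗ k a = trans (sym (X^⊗ k a)) (*-comm (X ^ k) a)

    term₁≈ : ∀ i j k → term₁ (i , j , k) ≈ G.term₁ i j k
    term₁≈ i j k = trans (divide≈ i j k _) (*-congʳ (trans (shift^-⊗ (exponent₁ (i , j , k)) (factor₁ (i , j , k)))
      (*-congʳ (+-cong (+-congˡ {1ˢ} (sym (X^≈ (2 ℕ.* i ℕ.+ 4 ℕ.* j ℕ.+ 6 ℕ.* k ℕ.+ 2))))
        (-‿cong (sym (X^≈ (3 ℕ.* i ℕ.+ 6 ℕ.* j ℕ.+ 9 ℕ.* k ℕ.+ 5))))))))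

    term₂≈ : ∀ i j k → term₂ (i , j , k) ≈ G.term₂ i j k
    term₂≈ i j k = trans (divide≈ i j k _) (*-congʳ (trans (shift^-⊗ (exponent₂ (i , j , k)) (factor₂ (i , j , k)))
      (*-congʳ (+-cong (+-congˡ {1ˢ} (trans (sym (X^≈ 1)) (*-identityʳ X))) (sym (X^≈ (2 ℕ.* j ℕ.+ 3 ℕ.* k ℕ.+ 2)))))))

    divPoch-zero : ∀ c n {s} → s ≈ 0ˢ → divPoch c n s ≈ 0ˢ
    divPoch-zero c n s≈0 = trans (divPoch≈ c n _) (trans (*-congˡ {u c n} s≈0) (zeroʳ (u c n)))

    divide-vanish : ∀ I m s → M ℕ.≤ m → divide I (shift^ m s) ≈ 0ˢ
    divide-vanish (i , j , k) m s M≤m = divPoch-zero 0 i (divPoch-zero 1 j (divPoch-zero 2 k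
      (agree λ n n< → at (shift^-vanish m s) n (ℕ.<-≤-trans n< M≤m))))

    sum-insert : ∀ (f : Index → Series) ys b zs → sumˢ f (ys ++ b ∷ zs) ≈ f b ⊕ sumˢ f (ys ++ zs)
    sum-insert f []       b zs = refl
    sum-insert f (y ∷ ys) b zs = begin
      f y ⊕ sumˢ f (ys ++ b ∷ zs)         ≈⟨ +-congˡ {f y} (sum-insert f ys b zs) ⟩
      f y ⊕ (f b ⊕ sumˢ f (ys ++ zs))     ≈⟨ sym (+-assoc (f y) (f b) _) ⟩
      (f y ⊕ f b) ⊕ sumˢ f (ys ++ zs)     ≈⟨ +-congʳ (+-comm (f y) (f b)) ⟩
      (f b ⊕ f y) ⊕ sumˢ f (ys ++ zs)     ≈⟨ +-assoc (f b) (f y) _ ⟩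
      f b ⊕ (f y ⊕ sumˢ f (ys ++ zs))     ∎

    sum-zero : ∀ (f : Index → Series) F → (∀ I → I ∈ F → f I ≈ 0ˢ) → sumˢ f F ≈ 0ˢ
    sum-zero f []      f≈0 = refl
    sum-zero f (I ∷ F) f≈0 = trans (+-cong (f≈0 I (here ≡.refl)) (sum-zero f F (λ J J∈ → f≈0 J (there J∈)))) (+-identityˡ 0ˢ)

    unique-remove : ∀ ys {b : Index} {zs} → Unique (ys ++ b ∷ zs) → b ∉ ys ++ zs × Unique (ys ++ zs)
    unique-remove []       (b∉ ∷ u) = (λ b∈ → All.lookup b∉ b∈ ≡.refl) , u
    unique-remove (y ∷ ys) {b} {zs} (y∉ ∷ u) = b∉ , (All.tabulate (λ {x} x∈ → All.lookup y∉ (insert x∈)) ∷ proj₂ (unique-remove ys u))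
      where
      insert : ∀ {x} → x ∈ ys ++ zs → x ∈ ys ++ b ∷ zs
      insert x∈ = [ ∈-++⁺ˡ , (λ x∈zs → ∈-++⁺ʳ ys (there x∈zs)) ]′ (∈-++⁻ ys x∈)
      b∉ : b ∉ y ∷ ys ++ zs
      b∉ (here b≡y) = All.lookup y∉ (∈-insert ys) (≡.sym b≡y)
      b∉ (there b∈) = proj₁ (unique-remove ys u) b∈

    -- Unconditional summation ranges over arbitrary duplicate-free lists. The elements of B are
    -- extracted from F one by one, and what is left over contributes 0.
    sum-support : ∀ (f : Index → Series) B F → Unique B → Unique F → B ⊆ F → (∀ I → I ∈ F → I ∉ B → f I ≈ 0ˢ) → sumˢ f F ≈ sumˢ f B
    sum-support f []      F uB uF B⊆F f≈0 = sum-zero f F (λ I I∈ → f≈0 I I∈ (λ ()))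
    sum-support f (b ∷ B) F (b∉ ∷ uB) uF B⊆F f≈0 with ∈-∃++ (B⊆F (here ≡.refl))
    ... | ys , zs , ≡.refl = trans (sum-insert f ys b zs) (+-congˡ {f b} (sum-support f B (ys ++ zs) uB (proj₂ rem) sub vanish))
      where
      rem = unique-remove ys uF
      sub : B ⊆ ys ++ zs
      sub {I} I∈B with ∈-++⁻ ys (B⊆F (there I∈B))
      ... | inj₁ I∈ys = ∈-++⁺ˡ I∈ys
      ... | inj₂ (here I≡b) = ⊥-elim (All.lookup b∉ I∈B (≡.sym I≡b))
      ... | inj₂ (there I∈zs) = ∈-++⁺ʳ ys I∈zs
      vanish : ∀ I → I ∈ ys ++ zs → I ∉ B → f I ≈ 0ˢ
      vanish I I∈ I∉B = f≈0 I ([ ∈-++⁺ˡ , (λ p → ∈-++⁺ʳ ys (there p)) ]′ (∈-++⁻ ys I∈))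
        (λ { (here I≡b) → proj₁ rem (≡.subst (_∈ ys ++ zs) I≡b I∈) ; (there I∈B) → I∉B I∈B })

    sum-++ : ∀ {A : Set} (f : A → Series) xs ys → sumˢ f (xs ++ ys) ≈ sumˢ f xs ⊕ sumˢ f ys
    sum-++ f []       ys = sym (+-identityˡ (sumˢ f ys))
    sum-++ f (x ∷ xs) ys = trans (+-congˡ {f x} (sum-++ f xs ys)) (sym (+-assoc (f x) _ _))

    sum-upTo : ∀ {A : Set} (f : A → Series) h N → sumˢ f (applyUpTo h N) ≈ Σ[ N ] (λ i → f (h i))
    sum-upTo f h zero    = refl
    sum-upTo f h (suc N) = trans (+-congˡ {f (h 0)} (sum-upTo f (λ i → h (suc i)) N)) (sym (Σ-head N (λ i → f (h i))))

    sum-product : ∀ {A B : Set} (f : A × B → Series) (h : ℕ → A) (ys : List B) N →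
      sumˢ f (cartesianProduct (applyUpTo h N) ys) ≈ Σ[ N ] (λ i → sumˢ (λ y → f (h i , y)) ys)
    sum-product f h ys zero    = refl
    sum-product f h ys (suc N) = begin
      sumˢ f (map (h 0 ,_) ys ++ cartesianProduct (applyUpTo (λ i → h (suc i)) N) ys)
        ≈⟨ sum-++ f (map (h 0 ,_) ys) _ ⟩
      sumˢ f (map (h 0 ,_) ys) ⊕ sumˢ f (cartesianProduct (applyUpTo (λ i → h (suc i)) N) ys)
        ≈⟨ +-cong (reflexive (≡.cong (foldr _⊕_ 0ˢ) (≡.sym (map-∘ ys)))) (sum-product f (λ i → h (suc i)) ys N) ⟩
      sumˢ (λ y → f (h 0 , y)) ys ⊕ Σ[ N ] (λ i → sumˢ (λ y → f (h (suc i) , y)) ys)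
        ≈⟨ sym (Σ-head N (λ i → sumˢ (λ y → f (h i , y)) ys)) ⟩
      Σ[ suc N ] (λ i → sumˢ (λ y → f (h i , y)) ys) ∎

    sum-box : ∀ (f : Index → Series) N → sumˢ f (box N) ≈ Σ³ N (λ i j k → f (i , j , k))
    sum-box f N = trans (sum-product f (λ i → i) _ N) (Σ-cong N (λ i →
      trans (sum-product (λ y → f (i , y)) (λ i → i) _ N) (Σ-cong N (λ j → sum-upTo (λ k → f (i , j , k)) (λ i → i) N))))

    -- An index outside the box has a coordinate of size at least M, so the hypothesis on i + j + k
    -- makes its term vanish.
    sum-over : ∀ (f : Index → Series) F → Unique F → box M ⊆ F → (∀ i j k → M ℕ.≤ i ℕ.+ j ℕ.+ k → f (i , j , k) ≈ 0ˢ) →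
      sumˢ f F ≈ Σ³ M (λ i j k → f (i , j , k))
    sum-over f F uF box⊆F f≈0 = trans (sum-support f (box M) F
        (box-unique M) uF box⊆F outside) (sum-box f M)
      where
      outside : ∀ I → I ∈ F → I ∉ box M → f I ≈ 0ˢ
      outside (i , j , k) _ I∉ = f≈0 i j k (ℕ.≮⇒≥ (λ s<M → I∉ (∈-cartesianProduct⁺ (∈-upTo⁺ (ℕ.≤-<-trans (ℕ.≤-trans (ℕ.m≤m+n i j) (ℕ.m≤m+n _ k)) s<M))
        (∈-cartesianProduct⁺ (∈-upTo⁺ (ℕ.≤-<-trans (ℕ.≤-trans (ℕ.m≤n+m j i) (ℕ.m≤m+n _ k)) s<M)) (∈-upTo⁺ (ℕ.≤-<-trans (ℕ.m≤n+m k _) s<M))))))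

    poch-from : ∀ a b {N} → M ℕ.≤ N → poch a (suc b) N ≈ poch a (suc b) M
    poch-from a b {N} M≤N = trans (reflexive (≡.cong (poch a (suc b)) (≡.sym (ℕ.m∸n+n≡m M≤N)))) (G.poch-stable a b (N ℕ.∸ M))

    defect≈ : ∀ a b a₁ a₂ a₃ c t {F N} → Unique F → box M ⊆ F → M ℕ.≤ N → (∀ i j k → M ℕ.≤ i ℕ.+ j ℕ.+ k → t (i , j , k) ≈ 0ˢ) →
      defect a (suc b) a₁ a₂ a₃ (suc c) t F N ≈
      ((poch a (suc b) M ⊗ (poch a₁ (suc c) M ⊗ (poch a₂ (suc c) M ⊗ poch a₃ (suc c) M))) ⊗ Σ³ M (λ i j k → t (i , j , k))) ⊕ (⊖ 1ˢ)
    defect≈ a b a₁ a₂ a₃ c t {F} {N} uF box⊆F M≤N t≈0 = +-congʳ (begin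
      mulFactors a (suc b) N _   ≈⟨ step a b _ ⟩
      p₀ ⊗ _   ≈⟨ *-congˡ {p₀} (trans (step a₁ c _) (*-congˡ {p₁} (trans (step a₂ c _) (*-congˡ {p₂} (trans (step a₃ c _)
                    (*-congˡ {p₃} (sum-over t F uF box⊆F t≈0))))))) ⟩
      p₀ ⊗ (p₁ ⊗ (p₂ ⊗ (p₃ ⊗ S)))
        ≈⟨ solve 5 (λ a b c d s → a :* (b :* (c :* (d :* s))) := (a :* (b :* (c :* d))) :* s) refl p₀ p₁ p₂ p₃ S ⟩
      (p₀ ⊗ (p₁ ⊗ (p₂ ⊗ p₃))) ⊗ S ∎)
      where
      p₀ = poch a (suc b) M
      p₁ = poch a₁ (suc c) M
      p₂ = poch a₂ (suc c) M
      p₃ = poch a₃ (suc c) M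
      S = Σ³ M (λ i j k → t (i , j , k))
      step : ∀ a b s → mulFactors a (suc b) N s ≈ poch a (suc b) M ⊗ s
      step a b s = trans (mulFactors≈ a (suc b) N s) (*-congʳ (poch-from a b M≤N))

  weaken : ∀ {a b M N} → M ℕ.≤ N → a ≈[ N ] b → a ≈[ M ] b
  weaken M≤N a≈b = agree λ n n< → at a≈b n (ℕ.<-≤-trans n< M≤N)

  size≤exponent₁ : ∀ i j k → i ℕ.+ j ℕ.+ k ℕ.≤ exponent₁ (i , j , k)
  size≤exponent₁ i j k = ℕ.+-mono-≤ (ℕ.+-mono-≤ (ℕ.≤-trans (ℕ.m≤n+m i ((i ℕ.+ 2 ℕ.* j ℕ.+ 3 ℕ.* k) C 2)) (ℕ.m≤m+n _ (j ℕ.^ 2)))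
    (ℕ.m≤n*m j 2)) (ℕ.m≤n*m k 2)

  size≤exponent₂ : ∀ i j k → i ℕ.+ j ℕ.+ k ℕ.≤ exponent₂ (i , j , k)
  size≤exponent₂ i j k = ℕ.+-mono-≤ (ℕ.+-mono-≤ (ℕ.≤-trans (ℕ.≤-trans (ℕ.m≤n*m i 3) (ℕ.m≤n+m (3 ℕ.* i) ((i ℕ.+ 2 ℕ.* j ℕ.+ 3 ℕ.* k) C 2))) (ℕ.m≤m+n _ (j ℕ.^ 2)))
    (ℕ.m≤n*m j 4)) (ℕ.m≤n*m k 7)

  module _ (d : ℕ) where
    private
      e = suc d
      -- The successor of d + 5e is 6e by computation: precision 6e for e steps of the descent.
      module M = Truncation (d ℕ.+ 5 ℕ.* e)
      open CommutativeRing M.ring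
      open Algebra.Properties.CommutativeSemiring.Exp commutativeSemiring using (_^_; ^-assocʳ)
      open FiniteSums M.ring using (Σ-cong)

    -- identity₁ carries a factor q⁴ᵉ, at the cost of 4e of the 6e known coefficients.
    defect₁-vanishes : ∀ {F N} → Unique F → box (6 ℕ.* e) ⊆ F → 6 ℕ.* e ℕ.≤ N → defect 2 3 1 6 9 12 term₁ F N ≈[ e ] 0ˢ
    defect₁-vanishes {F} {N} uF box⊆F ≤N = weaken (ℕ.m≤n*m e 2) (shift^-cancel (4 ℕ.* e) (2 ℕ.* e) D
      (≡.subst (λ m → shift^ (4 ℕ.* e) D ≈[ m ] 0ˢ) (ℕ.*-distribʳ-+ e 4 2) shifted))
      where
      D = defect 2 3 1 6 9 12 term₁ F N
      shifted : shift^ (4 ℕ.* e) D ≈ 0ˢ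
      shifted = trans (sym (M.X^⊗ (4 ℕ.* e) D)) (trans (*-cong (sym (^-assocʳ X 4 e))
        (trans (M.defect≈ 2 2 1 6 9 11 term₁ uF box⊆F ≤N (λ i j k M≤ →
            M.divide-vanish (i , j , k) _ _ (ℕ.≤-trans M≤ (size≤exponent₁ i j k))))
          (+-congʳ (*-congˡ (Σ-cong M.M (λ i → Σ-cong M.M (λ j → Σ-cong M.M (λ k → M.term₁≈ i j k))))))))
        (M.G.identity₁ e ℕ.≤-refl))

    defect₂-vanishes : ∀ {F N} → Unique F → box (6 ℕ.* e) ⊆ F → 6 ℕ.* e ℕ.≤ N → defect 1 3 5 6 9 12 term₂ F N ≈[ e ] 0ˢ
    defect₂-vanishes {F} {N} uF box⊆F ≤N = weaken (ℕ.m≤n*m e 6) (trans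
      (M.defect≈ 1 2 5 6 9 11 term₂ uF box⊆F ≤N (λ i j k M≤ →
            M.divide-vanish (i , j , k) _ _ (ℕ.≤-trans M≤ (size≤exponent₂ i j k))))
      (trans (+-congʳ (trans (*-congˡ (Σ-cong M.M (λ i → Σ-cong M.M (λ j → Σ-cong M.M (λ k → M.term₂≈ i j k)))))
        (M.G.identity₂ e ℕ.≤-refl))) (-‿inverseʳ 1ˢ)))

  -- The equation is exact although it is proved in truncated rings: coefficient n is compared at
  -- precision n + 1.
  inv⊗-unfold : ∀ m b n → (inv m ⊗ b) n ≡ (b ⊕ shift^ (suc m) (inv m ⊗ b)) n
  inv⊗-unfold m b n = at (begin
    inv m ⊗ b                                   ≈⟨ *-congʳ (agree λ i _ → inv-unfold m i) ⟩
    (1ˢ ⊕ shift^ (suc m) (inv m)) ⊗ b           ≈⟨ distribʳ b 1ˢ (shift^ (suc m) (inv m)) ⟩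
    (1ˢ ⊗ b) ⊕ (shift^ (suc m) (inv m) ⊗ b)     ≈⟨ +-cong (*-identityˡ b) (*-congʳ (sym (M.X^⊗ (suc m) (inv m)))) ⟩
    b ⊕ ((X ^ suc m ⊗ inv m) ⊗ b)               ≈⟨ +-congˡ {b} (trans (*-assoc (X ^ suc m) (inv m) b) (M.X^⊗ (suc m) (inv m ⊗ b))) ⟩
    b ⊕ shift^ (suc m) (inv m ⊗ b)              ∎) n ℕ.≤-refl
    where
    module M = Truncation n
    open CommutativeRing M.ring
    open Algebra.Properties.CommutativeSemiring.Exp commutativeSemiring using (_^_)
    open import Relation.Binary.Reasoning.Setoid setoid

-- Rational estimates: decay of powers and a positive lower bound for (s;s)ₙ.

module RationalEstimates where

  open import Defs using (0<1; 0<a*b; *-mono-≤)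
  open import Data.Nat.Base as ℕ using (ℕ; zero; suc)
  import Data.Nat.Properties as ℕ
  import Data.Integer.Base as ℤ
  import Data.Integer.Properties as ℤ
  open import Data.Rational.Base
  open import Data.Rational.Properties
  import Data.Rational.Unnormalised.Base as ℚᵘ
  import Data.Rational.Unnormalised.Properties as ℚᵘ
  open import Data.Rational.Solver using (module +-*-Solver)
  open +-*-Solver using (solve; _:+_; _:*_; _:-_; :-_; _:=_; con)
  open import Data.Product using (∃; _×_; _,_)
  open import Data.Empty using (⊥)
  open import Relation.Binary.PropositionalEquality
  open import Algebra.Properties.CommutativeSemiring.Exp (CommutativeRing.commutativeSemiring +-*-commutativeRing) public
    using (_^_; ^-homo-*)

  ≤-by : ∀ {a b} c → 0ℚ ≤ c → a + c ≡ b → a ≤ b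
  ≤-by {a} c 0≤c a+c≡b = subst (a ≤_) a+c≡b (subst (_≤ a + c) (+-identityʳ a) (+-monoʳ-≤ a 0≤c))

  ≤⇒0≤- : ∀ {a b} → a ≤ b → 0ℚ ≤ b - a
  ≤⇒0≤- {a} {b} a≤b = subst (_≤ b - a) (+-inverseʳ a) (+-monoˡ-≤ (- a) a≤b)

  <⇒0<- : ∀ {a b} → a < b → 0ℚ < b - a
  <⇒0<- {a} {b} a<b = subst (_< b - a) (+-inverseʳ a) (+-monoˡ-< (- a) a<b)

  <⇒≱ : ∀ {a b} → a < b → b ≤ a → ⊥
  <⇒≱ a<b b≤a = <-irrefl refl (<-≤-trans a<b b≤a)

  0≤* : ∀ {a b} → 0ℚ ≤ a → 0ℚ ≤ b → 0ℚ ≤ a * b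
  0≤* {a} {b} 0≤a 0≤b = *-mono-≤ {0ℚ} {a} {0ℚ} {b} 0≤a ≤-refl 0≤a 0≤b

  0≤+ : ∀ {a b} → 0ℚ ≤ a → 0ℚ ≤ b → 0ℚ ≤ a + b
  0≤+ = +-mono-≤

  *-monoˡ : ∀ {a b} c → 0ℚ ≤ c → a ≤ b → c * a ≤ c * b
  *-monoˡ c 0≤c a≤b = *-monoˡ-≤-nonNeg c {{nonNegative 0≤c}} a≤b

  *-monoʳ : ∀ {a b} c → 0ℚ ≤ c → a ≤ b → a * c ≤ b * c
  *-monoʳ c 0≤c a≤b = *-monoʳ-≤-nonNeg c {{nonNegative 0≤c}} a≤b

  natℚ : ℕ → ℚ
  natℚ zero    = 0ℚ
  natℚ (suc n) = 1ℚ + natℚ n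

  toℚᵘ-natℚ : ∀ n → toℚᵘ (natℚ n) ℚᵘ.≃ ℚᵘ.mkℚᵘ (ℤ.+ n) 0
  toℚᵘ-natℚ zero    = ℚᵘ.≃-refl
  toℚᵘ-natℚ (suc n) = ℚᵘ.≃-trans (toℚᵘ-homo-+ 1ℚ (natℚ n)) (ℚᵘ.≃-trans (ℚᵘ.+-congʳ ℚᵘ.1ℚᵘ (toℚᵘ-natℚ n))
    (ℚᵘ.*≡* (ℤ-solve 1 (λ n → (one ⊗ one ⊕ n ⊗ one) ⊗ one ⊜ (one ⊕ n) ⊗ (one ⊗ one)) refl (ℤ.+ n))))
    where
    import Data.Integer.Solver as ℤ-Solver
    open ℤ-Solver.+-*-Solver using () renaming (solve to ℤ-solve; _:+_ to _⊕_; _:*_ to _⊗_; _:=_ to _⊜_; con to ℤ-con)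
    one : ∀ {n} → ℤ-Solver.+-*-Solver.Polynomial n
    one = ℤ-con (ℤ.+ 1)

  archimedean : ∀ ε → 0ℚ < ε → ∃ λ n → 1ℚ ≤ natℚ n * ε
  archimedean ε@(mkℚ ℤ.+0 _ _)       (*<* (ℤ.+<+ ()))
  archimedean ε@(mkℚ ℤ.-[1+ _ ] _ _) (*<* ())
  archimedean ε@(mkℚ ℤ.+[1+ n ] d _) _ = suc d , toℚᵘ-cancel-≤
    (ℚᵘ.≤-respʳ-≃ (ℚᵘ.≃-sym (ℚᵘ.≃-trans (toℚᵘ-homo-* (natℚ (suc d)) ε) (ℚᵘ.*-congʳ {toℚᵘ ε} (toℚᵘ-natℚ (suc d)))))
      (ℚᵘ.*≤* (subst₂ ℤ._≤_ refl refl (ℤ.+≤+ bound))))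
    where
    bound : suc (d ℕ.+ 0) ℕ.+ 0 ℕ.≤ (suc d ℕ.* suc n) ℕ.* 1
    bound = subst₂ ℕ._≤_ (sym (trans (ℕ.+-identityʳ _) (cong suc (ℕ.+-identityʳ d)))) (sym (ℕ.*-identityʳ _)) (ℕ.m≤m*n (suc d) (suc n))

  0≤natℚ : ∀ n → 0ℚ ≤ natℚ n
  0≤natℚ zero    = ≤-refl
  0≤natℚ (suc n) = 0≤+ (<⇒≤ 0<1) (0≤natℚ n)

  module Powers (s : ℚ) (0<s : 0ℚ < s) (s<1 : s < 1ℚ) where
    0≤s : 0ℚ ≤ s
    0≤s = <⇒≤ 0<s

    s≤1 : s ≤ 1ℚ
    s≤1 = <⇒≤ s<1

    0<s^ : ∀ n → 0ℚ < s ^ n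
    0<s^ zero    = 0<1
    0<s^ (suc n) = 0<a*b 0<s (0<s^ n)

    0≤s^ : ∀ n → 0ℚ ≤ s ^ n
    0≤s^ n = <⇒≤ (0<s^ n)

    s^-suc≤ : ∀ n → s ^ suc n ≤ s ^ n
    s^-suc≤ n = subst (s * s ^ n ≤_) (*-identityˡ (s ^ n)) (*-monoʳ (s ^ n) (0≤s^ n) s≤1)

    s^-anti′ : ∀ m n → s ^ (n ℕ.+ m) ≤ s ^ m
    s^-anti′ m zero    = ≤-refl
    s^-anti′ m (suc n) = ≤-trans (s^-suc≤ (n ℕ.+ m)) (s^-anti′ m n)

    s^-anti : ∀ {m n} → m ℕ.≤ n → s ^ n ≤ s ^ m
    s^-anti {m} {n} m≤n = subst (λ k → s ^ k ≤ s ^ m) (ℕ.m∸n+n≡m m≤n) (s^-anti′ m (n ℕ.∸ m))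

    s^≤1 : ∀ n → s ^ n ≤ 1ℚ
    s^≤1 n = s^-anti {0} {n} ℕ.z≤n

    -- Bernoulli's inequality with the power cleared. The induction step gives away exactly s^n (1 +
    -- n)(1 - s)².
    bernoulli : ∀ n → s ^ n * (1ℚ + natℚ n * (1ℚ - s)) ≤ 1ℚ
    bernoulli zero    = ≤-reflexive (solve 1 (λ s → con 1ℚ :* (con 1ℚ :+ con 0ℚ :* (con 1ℚ :- s)) := con 1ℚ) refl s)
    bernoulli (suc n) = ≤-trans (≤-by (s ^ n * ((1ℚ + natℚ n) * ((1ℚ - s) * (1ℚ - s))))
        (0≤* (0≤s^ n) (0≤* (0≤natℚ (suc n)) (0≤* 0≤1-s 0≤1-s)))
        (solve 3 (λ s p n → s :* p :* (con 1ℚ :+ (con 1ℚ :+ n) :* (con 1ℚ :- s)) :+ p :* ((con 1ℚ :+ n) :* ((con 1ℚ :- s) :* (con 1ℚ :- s)))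
          := p :* (con 1ℚ :+ n :* (con 1ℚ :- s))) refl s (s ^ n) (natℚ n)))
      (bernoulli n)
      where
      0≤1-s : 0ℚ ≤ 1ℚ - s
      0≤1-s = ≤⇒0≤- s≤1

    decay : ∀ ε → 0ℚ < ε → ∃ λ T → ∀ n → T ℕ.≤ n → s ^ n ≤ ε
    decay ε 0<ε with archimedean ((1ℚ - s) * ε) (0<a*b (<⇒0<- s<1) 0<ε)
    ... | T , 1≤ = T , λ n T≤n → ≤-trans (s^-anti T≤n) (begin
      s ^ T                                          ≡⟨ sym (*-identityʳ (s ^ T)) ⟩
      s ^ T * 1ℚ                                     ≤⟨ *-monoˡ (s ^ T) (0≤s^ T) 1≤ ⟩
      s ^ T * (natℚ T * ((1ℚ - s) * ε))              ≤⟨ ≤-by (s ^ T * ε) (0≤* (0≤s^ T) (<⇒≤ 0<ε))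
        (solve 4 (λ p n t e → p :* (n :* (t :* e)) :+ p :* e := p :* (con 1ℚ :+ n :* t) :* e) refl (s ^ T) (natℚ T) (1ℚ - s) ε) ⟩
      s ^ T * (1ℚ + natℚ T * (1ℚ - s)) * ε           ≤⟨ *-monoʳ ε (<⇒≤ 0<ε) (bernoulli T) ⟩
      1ℚ * ε                                         ≡⟨ *-identityˡ ε ⟩
      ε                                              ∎)
      where open ≤-Reasoning

    poch : ℕ → ℚ
    poch zero    = 1ℚ
    poch (suc n) = poch n * (1ℚ - s ^ suc n)

    s^-suc<1 : ∀ n → s ^ suc n < 1ℚ
    s^-suc<1 n = ≤-<-trans (subst (s ^ suc n ≤_) (*-identityʳ s) (*-monoˡ s 0≤s (s^≤1 n))) s<1

    1-s^-pos : ∀ n → 0ℚ < 1ℚ - s ^ suc n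
    1-s^-pos n = <⇒0<- (s^-suc<1 n)

    0<poch : ∀ n → 0ℚ < poch n
    0<poch zero    = 0<1
    0<poch (suc n) = 0<a*b (0<poch n) (1-s^-pos n)

    poch-anti : ∀ n → poch (suc n) ≤ poch n
    poch-anti n = ≤-by (poch n * s ^ suc n) (0≤* (<⇒≤ (0<poch n)) (0≤s^ (suc n)))
      (solve 2 (λ p t → p :* (con 1ℚ :- t) :+ p :* t := p) refl (poch n) (s ^ suc n))

    poch-anti′ : ∀ m n → poch (m ℕ.+ n) ≤ poch n
    poch-anti′ zero    n = ≤-refl
    poch-anti′ (suc m) n = ≤-trans (poch-anti (m ℕ.+ n)) (poch-anti′ m n)

    private
      step : ∀ t w → 0ℚ ≤ t → t ≤ 1ℚ → 0ℚ ≤ w → w ≤ ½ * (1ℚ - s) → ½ + ½ * (s * t) ≤ (½ + ½ * t) * (1ℚ - w * t)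
      step t w 0≤t t≤1 0≤w w≤ = ≤-by (t * (½ * (1ℚ - s) - w) + w * t * (½ * (1ℚ - t)))
        (0≤+ (0≤* 0≤t (≤⇒0≤- w≤)) (0≤* (0≤* 0≤w 0≤t) (0≤* (<⇒≤ (positive⁻¹ ½)) (≤⇒0≤- t≤1))))
        (solve 3 (λ s t w → con ½ :+ con ½ :* (s :* t) :+ (t :* (con ½ :* (con 1ℚ :- s) :- w) :+ w :* t :* (con ½ :* (con 1ℚ :- t)))
          := (con ½ :+ con ½ :* t) :* (con 1ℚ :- w :* t)) refl s t w)

      -- ½ + ½sⁿ decreases more slowly than the n-th partial product beyond m.
      invariant : ∀ m → s ^ suc m ≤ ½ * (1ℚ - s) → ∀ n → poch m * (½ + ½ * s ^ n) ≤ poch (n ℕ.+ m)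
      invariant m w≤ zero    = ≤-reflexive (*-identityʳ (poch m))
      invariant m w≤ (suc n) = begin
        poch m * (½ + ½ * (s * s ^ n))
          ≤⟨ *-monoˡ (poch m) (<⇒≤ (0<poch m)) (step (s ^ n) (s ^ suc m) (0≤s^ n) (s^≤1 n) (0≤s^ (suc m)) w≤) ⟩
        poch m * ((½ + ½ * s ^ n) * (1ℚ - s ^ suc m * s ^ n))
          ≡⟨ sym (*-assoc (poch m) (½ + ½ * s ^ n) _) ⟩
        poch m * (½ + ½ * s ^ n) * (1ℚ - s ^ suc m * s ^ n)
          ≡⟨ cong (λ v → poch m * (½ + ½ * s ^ n) * (1ℚ - v)) (trans (*-comm (s ^ suc m) (s ^ n))
               (trans (sym (^-homo-* s n (suc m))) (cong (s ^_) (ℕ.+-suc n m)))) ⟩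
        poch m * (½ + ½ * s ^ n) * (1ℚ - s ^ suc (n ℕ.+ m))
          ≤⟨ *-monoʳ (1ℚ - s ^ suc (n ℕ.+ m)) (<⇒≤ (1-s^-pos (n ℕ.+ m))) (invariant m w≤ n) ⟩
        poch (n ℕ.+ m) * (1ℚ - s ^ suc (n ℕ.+ m)) ∎
        where open ≤-Reasoning

    -- Beyond an index m from which powers of s stay below ½(1 - s), the further factors cost at
    -- most a factor ½ in total; shorter partial products are larger still by monotonicity.
    poch-bounded : ∃ λ δ → 0ℚ < δ × (∀ n → δ ≤ poch n)
    poch-bounded = from (decay (½ * (1ℚ - s)) (0<a*b (positive⁻¹ ½) (<⇒0<- s<1)))
      where
      half≤ : ∀ m n → ½ * poch m ≤ poch m * (½ + ½ * s ^ n)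
      half≤ m n = ≤-by (poch m * (½ * s ^ n)) (0≤* (<⇒≤ (0<poch m)) (0≤* (<⇒≤ (positive⁻¹ ½)) (0≤s^ n)))
        (solve 2 (λ p t → con ½ :* p :+ p :* (con ½ :* t) := p :* (con ½ :+ con ½ :* t)) refl (poch m) (s ^ n))
      from : (∃ λ m → ∀ n → m ℕ.≤ n → s ^ n ≤ ½ * (1ℚ - s)) → ∃ λ δ → 0ℚ < δ × (∀ n → δ ≤ poch n)
      from (m , small) = ½ * poch m , 0<a*b (positive⁻¹ ½) (0<poch m) , λ n → ≤-trans (half≤ m n)
        (≤-trans (invariant m (small (suc m) (ℕ.n≤1+n m)) n) (subst (λ k → poch k ≤ poch n) (ℕ.+-comm m n) (poch-anti′ m n)))

-- The field ℚ(i), with bounds on absolute values expressed through squares.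

module GaussianRationals where

  open import Defs using (normSqℚ; 0≤normSqℚ; normSqℚ-*; inv-inverseʳ; 0≤a*a; 0<a*b; *-mono-≤; 0<1) renaming (inv to invℚ)
  open RationalEstimates
  open import Data.Rational.Base
  open import Data.Rational.Properties
  open import Data.Rational.Solver using (module +-*-Solver)
  open +-*-Solver using (solve; _:+_; _:*_; _:-_; :-_; _:=_; con)
  open import Data.Product using (_×_; _,_; proj₁; proj₂)
  open import Data.Empty using (⊥-elim)
  open import Data.Sum.Base using (inj₁; inj₂)
  open import Relation.Nullary using (yes; no)
  open import Relation.Binary.PropositionalEquality

  ℚ[i] : Set
  ℚ[i] = ℚ × ℚ

  infixl 6 _+ⁱ_
  infixl 7 _*ⁱ_
  infix 8 -ⁱ_
  infix 4 _≼_

  0ⁱ 1ⁱ : ℚ[i]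
  0ⁱ = 0ℚ , 0ℚ
  1ⁱ = 1ℚ , 0ℚ

  _+ⁱ_ _*ⁱ_ : ℚ[i] → ℚ[i] → ℚ[i]
  (a , b) +ⁱ (c , d) = a + c , b + d
  (a , b) *ⁱ (c , d) = a * c + - (b * d) , a * d + b * c

  -ⁱ_ : ℚ[i] → ℚ[i]
  -ⁱ (a , b) = - a , - b

  ℚ[i]-ring : CommutativeRing 0ℓ 0ℓ
  ℚ[i]-ring = record
    { Carrier = ℚ[i] ; _≈_ = _≡_ ; _+_ = _+ⁱ_ ; _*_ = _*ⁱ_ ; -_ = -ⁱ_ ; 0# = 0ⁱ ; 1# = 1ⁱ
    ; isCommutativeRing = record
      { isRing = record
        { +-isAbelianGroup = record
          { isGroup = record
            { isMonoid = record
              { isSemigroup = record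
                { isMagma = record { isEquivalence = isEquivalence ; ∙-cong = cong₂ _+ⁱ_ }
                ; assoc = λ (a , b) (c , d) (e , f) → cong₂ _,_ (+-assoc a c e) (+-assoc b d f) }
              ; identity = (λ (a , b) → cong₂ _,_ (+-identityˡ a) (+-identityˡ b))
                         , (λ (a , b) → cong₂ _,_ (+-identityʳ a) (+-identityʳ b)) }
            ; inverse = (λ (a , b) → cong₂ _,_ (+-inverseˡ a) (+-inverseˡ b))
                      , (λ (a , b) → cong₂ _,_ (+-inverseʳ a) (+-inverseʳ b))
            ; ⁻¹-cong = cong -ⁱ_ }
          ; comm = λ (a , b) (c , d) → cong₂ _,_ (+-comm a c) (+-comm b d) }
        ; *-cong = cong₂ _*ⁱ_
        ; *-assoc = λ (a , b) (c , d) (e , f) → cong₂ _,_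
            (solve 6 (λ a b c d e f → (a :* c :+ :- (b :* d)) :* e :+ :- ((a :* d :+ b :* c) :* f)
              := a :* (c :* e :+ :- (d :* f)) :+ :- (b :* (c :* f :+ d :* e))) refl a b c d e f)
            (solve 6 (λ a b c d e f → (a :* c :+ :- (b :* d)) :* f :+ (a :* d :+ b :* c) :* e
              := a :* (c :* f :+ d :* e) :+ b :* (c :* e :+ :- (d :* f))) refl a b c d e f)
        ; *-identity = (λ z → trans (*ⁱ-comm 1ⁱ z) (*ⁱ-identityʳ z)) , *ⁱ-identityʳ
        ; distrib = (λ z w v → trans (*ⁱ-comm z (w +ⁱ v)) (trans (*ⁱ-distribʳ z w v) (cong₂ _+ⁱ_ (*ⁱ-comm w z) (*ⁱ-comm v z))))
                  , *ⁱ-distribʳ }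
      ; *-comm = *ⁱ-comm } }
    where
    *ⁱ-comm : ∀ z w → z *ⁱ w ≡ w *ⁱ z
    *ⁱ-comm (a , b) (c , d) = cong₂ _,_
      (solve 4 (λ a b c d → a :* c :+ :- (b :* d) := c :* a :+ :- (d :* b)) refl a b c d)
      (solve 4 (λ a b c d → a :* d :+ b :* c := c :* b :+ d :* a) refl a b c d)
    *ⁱ-identityʳ : ∀ z → z *ⁱ 1ⁱ ≡ z
    *ⁱ-identityʳ (a , b) = cong₂ _,_
      (solve 2 (λ a b → a :* con 1ℚ :+ :- (b :* con 0ℚ) := a) refl a b)
      (solve 2 (λ a b → a :* con 0ℚ :+ b :* con 1ℚ := b) refl a b)
    *ⁱ-distribʳ : ∀ z w v → (w +ⁱ v) *ⁱ z ≡ w *ⁱ z +ⁱ v *ⁱ z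
    *ⁱ-distribʳ (a , b) (c , d) (e , f) = cong₂ _,_
      (solve 6 (λ a b c d e f → (c :+ e) :* a :+ :- ((d :+ f) :* b) := (c :* a :+ :- (d :* b)) :+ (e :* a :+ :- (f :* b))) refl a b c d e f)
      (solve 6 (λ a b c d e f → (c :+ e) :* b :+ (d :+ f) :* a := (c :* b :+ d :* a) :+ (e :* b :+ f :* a)) refl a b c d e f)

  norm² : ℚ[i] → ℚ
  norm² (a , b) = normSqℚ a b

  0≤norm² : ∀ z → 0ℚ ≤ norm² z
  0≤norm² (a , b) = 0≤normSqℚ a b

  norm²-* : ∀ z w → norm² (z *ⁱ w) ≡ norm² z * norm² w
  norm²-* (a , b) (c , d) = normSqℚ-* a b c d

  -- |z| ≤ B, stated without square roots
  record _≼_ (z : ℚ[i]) (B : ℚ) : Set where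
    constructor bounded
    field
      nonneg : 0ℚ ≤ B
      norm≤  : norm² z ≤ B * B
  open _≼_ public

  square-cancel : ∀ {x y} → 0ℚ ≤ y → x * x ≤ y * y → x ≤ y
  square-cancel {x} {y} 0≤y xx≤yy with x ≤? y
  ... | yes x≤y = x≤y
  ... | no  x≰y = ⊥-elim (<⇒≱ (≤-<-trans (*-monoˡ y 0≤y (<⇒≤ y<x)) (*-monoˡ-<-pos x {{positive (≤-<-trans 0≤y y<x)}} y<x)) xx≤yy)
    where
    y<x : y < x
    y<x = ≰⇒> x≰y

  ≼-mono : ∀ {z A B} → A ≤ B → z ≼ A → z ≼ B
  ≼-mono A≤B (bounded 0≤A p) = bounded (≤-trans 0≤A A≤B) (≤-trans p (*-mono-≤ (≤-trans 0≤A A≤B) 0≤A A≤B A≤B))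

  ≼-* : ∀ {z w A B} → z ≼ A → w ≼ B → z *ⁱ w ≼ A * B
  ≼-* {z} {w} {A} {B} (bounded 0≤A p) (bounded 0≤B r) = bounded (0≤* 0≤A 0≤B) (begin
    norm² (z *ⁱ w)         ≡⟨ norm²-* z w ⟩
    norm² z * norm² w      ≤⟨ *-mono-≤ (0≤* 0≤A 0≤A) (0≤norm² w) p r ⟩
    (A * A) * (B * B)      ≡⟨ solve 2 (λ a b → (a :* a) :* (b :* b) := (a :* b) :* (a :* b)) refl A B ⟩
    (A * B) * (A * B)      ∎)
    where open ≤-Reasoning

  -- The triangle inequality without square roots: Cauchy-Schwarz bounds the square of the inner
  -- product by (AB)², and `square-cancel` removes the squares.
  ≼-+ : ∀ {z w A B} → z ≼ A → w ≼ B → z +ⁱ w ≼ A + B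
  ≼-+ {a , b} {c , d} {A} {B} (bounded 0≤A p) (bounded 0≤B r) = bounded (0≤+ 0≤A 0≤B) (begin
    (a + c) * (a + c) + (b + d) * (b + d)
      ≡⟨ solve 4 (λ a b c d → (a :+ c) :* (a :+ c) :+ (b :+ d) :* (b :+ d)
           := (a :* a :+ b :* b) :+ (c :* c :+ d :* d) :+ ((a :* c :+ b :* d) :+ (a :* c :+ b :* d))) refl a b c d ⟩
    normSqℚ a b + normSqℚ c d + (dot + dot)   ≤⟨ +-mono-≤ (+-mono-≤ p r) (+-mono-≤ dot≤ dot≤) ⟩
    A * A + B * B + (A * B + A * B)
      ≡⟨ solve 2 (λ a b → a :* a :+ b :* b :+ (a :* b :+ a :* b) := (a :+ b) :* (a :+ b)) refl A B ⟩
    (A + B) * (A + B) ∎)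
    where
    open ≤-Reasoning
    dot = a * c + b * d
    cauchy-schwarz : dot * dot ≤ normSqℚ a b * normSqℚ c d
    cauchy-schwarz = ≤-by ((a * d - b * c) * (a * d - b * c)) (0≤a*a (a * d - b * c))
      (solve 4 (λ a b c d → (a :* c :+ b :* d) :* (a :* c :+ b :* d) :+ (a :* d :- b :* c) :* (a :* d :- b :* c)
        := (a :* a :+ b :* b) :* (c :* c :+ d :* d)) refl a b c d)
    dot≤ : dot ≤ A * B
    dot≤ = square-cancel (0≤* 0≤A 0≤B) (≤-trans cauchy-schwarz
      (subst (normSqℚ a b * normSqℚ c d ≤_) (solve 2 (λ a b → (a :* a) :* (b :* b) := (a :* b) :* (a :* b)) refl A B)
        (*-mono-≤ (0≤* 0≤A 0≤A) (0≤normSqℚ c d) p r)))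

  ≼-neg : ∀ {z A} → z ≼ A → -ⁱ z ≼ A
  ≼-neg {a , b} (bounded 0≤A p) = bounded 0≤A (subst (_≤ _)
    (solve 2 (λ a b → a :* a :+ b :* b := (:- a) :* (:- a) :+ (:- b) :* (:- b)) refl a b) p)

  ≼-0 : 0ⁱ ≼ 0ℚ
  ≼-0 = bounded ≤-refl ≤-refl

  ∣c∣² : ∀ c → ∣ c ∣ * ∣ c ∣ ≡ c * c
  ∣c∣² c with ∣p∣≡p∨∣p∣≡-p c
  ... | inj₁ e = cong₂ _*_ e e
  ... | inj₂ e = trans (cong₂ _*_ e e) (solve 1 (λ x → (:- x) :* (:- x) := x :* x) refl c)

  ≼-ℚ : ∀ c → (c , 0ℚ) ≼ ∣ c ∣
  ≼-ℚ c = bounded (0≤∣p∣ c) (≤-reflexive (trans (+-identityʳ (c * c)) (sym (∣c∣² c))))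

  ∣re∣≤ : ∀ {z B} → z ≼ B → ∣ proj₁ z ∣ ≤ B
  ∣re∣≤ {a , b} (bounded 0≤B p) = square-cancel 0≤B (≤-trans (≤-reflexive (∣c∣² a)) (≤-trans (≤-by (b * b) (0≤a*a b) refl) p))

  ∣im∣≤ : ∀ {z B} → z ≼ B → ∣ proj₂ z ∣ ≤ B
  ∣im∣≤ {a , b} (bounded 0≤B p) = square-cancel 0≤B (≤-trans (≤-reflexive (∣c∣² b)) (≤-trans (≤-by (a * a) (0≤a*a a) (+-comm (b * b) (a * a))) p))

  1/4≤norm² : ∀ {z} → z +ⁱ -ⁱ 1ⁱ ≼ ½ → ½ * ½ ≤ norm² z
  1/4≤norm² {a , b} (bounded 0≤½ p) = ≤-trans (*-mono-≤ (≤-trans 0≤½ ½≤a) 0≤½ ½≤a ½≤a) (≤-by (b * b) (0≤a*a b) refl)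
    where
    1-a≤½ : 1ℚ - a ≤ ½
    1-a≤½ = square-cancel 0≤½ (≤-trans (≤-by ((b + - 0ℚ) * (b + - 0ℚ)) (0≤a*a (b + - 0ℚ))
      (solve 2 (λ a b → (con 1ℚ :- a) :* (con 1ℚ :- a) :+ b :* b := (a :+ :- con 1ℚ) :* (a :+ :- con 1ℚ) :+ b :* b) refl a (b + - 0ℚ))) p)
    ½≤a : ½ ≤ a
    ½≤a = ≤-by (½ - (1ℚ - a)) (≤⇒0≤- 1-a≤½) (solve 1 (λ a → con ½ :+ (con ½ :- (con 1ℚ :- a)) := a) refl a)

  -- A rational upper bound for |z| that avoids the root, from n ≤ (1 + n)² with n = |z|².
  ≼-crude : ∀ z → z ≼ 1ℚ + norm² z
  ≼-crude z = bounded (0≤+ (<⇒≤ 0<1) (0≤norm² z)) (≤-by (1ℚ + norm² z + norm² z * norm² z)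
    (0≤+ (0≤+ (<⇒≤ 0<1) (0≤norm² z)) (0≤* (0≤norm² z) (0≤norm² z)))
    (solve 1 (λ n → n :+ (con 1ℚ :+ n :+ n :* n) := (con 1ℚ :+ n) :* (con 1ℚ :+ n)) refl (norm² z)))

  recipⁱ : ℚ[i] → ℚ[i]
  recipⁱ (a , b) = a * r , - b * r
    where r = invℚ (normSqℚ a b)

  *-recipⁱ : ∀ z → 0ℚ < norm² z → z *ⁱ recipⁱ z ≡ 1ⁱ
  *-recipⁱ (a , b) 0<n = cong₂ _,_
    (trans (solve 3 (λ a b r → a :* (a :* r) :+ :- (b :* (:- b :* r)) := (a :* a :+ b :* b) :* r) refl a b r) (inv-inverseʳ (normSqℚ a b) 0<n))
    (solve 3 (λ a b r → a :* (:- b :* r) :+ b :* (a :* r) := con 0ℚ) refl a b r)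
    where r = invℚ (normSqℚ a b)

  0<norm²[1-z] : ∀ {z B} → z ≼ B → B < 1ℚ → 0ℚ < norm² (1ⁱ +ⁱ -ⁱ z)
  0<norm²[1-z] {a , b} {B} (bounded 0≤B p) B<1 = <-≤-trans (0<a*b 0<1-a 0<1-a)
    (≤-by ((0ℚ - b) * (0ℚ - b)) (0≤a*a (0ℚ - b)) refl)
    where
    a≤B : a ≤ B
    a≤B = square-cancel 0≤B (≤-trans (≤-by (b * b) (0≤a*a b) refl) p)
    0<1-a : 0ℚ < 1ℚ - a
    0<1-a = <⇒0<- (≤-<-trans a≤B B<1)

  recip-unique : ∀ {z w} → 0ℚ < norm² z → z *ⁱ w ≡ 1ⁱ → w ≡ recipⁱ z
  recip-unique {z} {w} 0<n zw≡1 = begin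
    w                      ≡⟨ sym (R.*-identityʳ w) ⟩
    w *ⁱ 1ⁱ                ≡⟨ cong (w *ⁱ_) (sym (*-recipⁱ z 0<n)) ⟩
    w *ⁱ (z *ⁱ recipⁱ z)   ≡⟨ sym (R.*-assoc w z (recipⁱ z)) ⟩
    w *ⁱ z *ⁱ recipⁱ z     ≡⟨ cong (_*ⁱ recipⁱ z) (trans (R.*-comm w z) zw≡1) ⟩
    1ⁱ *ⁱ recipⁱ z         ≡⟨ R.*-identityˡ (recipⁱ z) ⟩
    recipⁱ z               ∎
    where
    open ≡-Reasoning
    module R = CommutativeRing ℚ[i]-ring

-- Majorants of power series, and their values at a point of ℚ(i).

module Evaluation where

  open import Defs using (0<1; 0<a*b)
  open PowerSeries using (Series; tail; 0ˢ; 1ˢ; _⊕_; ⊖_; _⊗_; shift; shift^; inv; _≈[_]_; at)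
  open FormalIdentities
  open RationalEstimates
  open GaussianRationals
  open import Data.Nat.Base as ℕ using (ℕ; zero; suc)
  import Data.Nat.Properties as ℕ
  open import Data.Rational.Base
  open import Data.Rational.Properties
  open import Data.Rational.Solver using (module +-*-Solver)
  open +-*-Solver using (solve; _:+_; _:*_; _:-_; :-_; _:=_; con)
  open import Data.Product using (∃; _,_; proj₁; proj₂)
  open import Relation.Binary.PropositionalEquality
  import Algebra.Properties.CommutativeSemiring.Exp

  drop : ℕ → Series → Series
  drop n c m = c (n ℕ.+ m)

  module Majorant (s : ℚ) (0<s : 0ℚ < s) (s<1 : s < 1ℚ) where
    open Powers s 0<s s<1

    -- Σ_{n<T} |cₙ| sⁿ
    maj : ℕ → Series → ℚ
    maj zero    c = 0ℚ
    maj (suc T) c = ∣ c 0 ∣ + s * maj T (tail c)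

    maj-cong : ∀ T {c c′} → (∀ n → c n ≡ c′ n) → maj T c ≡ maj T c′
    maj-cong zero    c≡ = refl
    maj-cong (suc T) c≡ = cong₂ (λ a b → ∣ a ∣ + s * b) (c≡ 0) (maj-cong T (λ n → c≡ (suc n)))

    0≤maj : ∀ T c → 0ℚ ≤ maj T c
    0≤maj zero    c = ≤-refl
    0≤maj (suc T) c = 0≤+ (0≤∣p∣ (c 0)) (0≤* 0≤s (0≤maj T (tail c)))

    maj-suc : ∀ T c → maj T c ≤ maj (suc T) c
    maj-suc zero    c = 0≤maj 1 c
    maj-suc (suc T) c = +-monoʳ-≤ ∣ c 0 ∣ (*-monoˡ s 0≤s (maj-suc T (tail c)))

    maj-zero : ∀ T {c} → (∀ n → c n ≡ 0ℚ) → maj T c ≡ 0ℚ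
    maj-zero zero    c≡0 = refl
    maj-zero (suc T) c≡0 = trans (cong₂ (λ a b → ∣ a ∣ + s * b) (c≡0 0) (maj-zero T (λ n → c≡0 (suc n))))
      (trans (+-identityˡ (s * 0ℚ)) (*-zeroʳ s))

    maj-1 : ∀ T → maj T 1ˢ ≤ 1ℚ
    maj-1 zero    = <⇒≤ 0<1
    maj-1 (suc T) = ≤-reflexive (trans (cong (λ m → 1ℚ + s * m) (maj-zero T (λ _ → refl))) (trans (cong (1ℚ +_) (*-zeroʳ s)) (+-identityʳ 1ℚ)))

    maj-⊕ : ∀ T a b → maj T (a ⊕ b) ≤ maj T a + maj T b
    maj-⊕ zero    a b = ≤-refl
    maj-⊕ (suc T) a b = ≤-trans (+-mono-≤ (∣p+q∣≤∣p∣+∣q∣ (a 0) (b 0)) (*-monoˡ s 0≤s (maj-⊕ T (tail a) (tail b))))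
      (≤-reflexive (solve 5 (λ x y s u v → x :+ y :+ s :* (u :+ v) := x :+ s :* u :+ (y :+ s :* v)) refl
        ∣ a 0 ∣ ∣ b 0 ∣ s (maj T (tail a)) (maj T (tail b))))

    maj-⊖ : ∀ T a → maj T (⊖ a) ≡ maj T a
    maj-⊖ zero    a = refl
    maj-⊖ (suc T) a = cong₂ (λ x y → x + s * y) (∣-p∣≡∣p∣ (a 0)) (maj-⊖ T (tail a))

    maj-shift : ∀ T a → maj T (shift a) ≤ s * maj T a
    maj-shift zero    a = ≤-reflexive (sym (*-zeroʳ s))
    maj-shift (suc T) a = ≤-trans (≤-reflexive (+-identityˡ (s * maj T a))) (*-monoˡ s 0≤s (maj-suc T a))

    maj-shift^ : ∀ k T a → maj T (shift^ k a) ≤ s ^ k * maj T a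
    maj-shift^ zero    T a = ≤-reflexive (sym (*-identityˡ (maj T a)))
    maj-shift^ (suc k) T a = ≤-trans (maj-shift T (shift^ k a)) (≤-trans (*-monoˡ s 0≤s (maj-shift^ k T a))
      (≤-reflexive (sym (*-assoc s (s ^ k) (maj T a)))))

    -- The quotient c satisfies c = b + X^(m+1) c, which bounds its majorant by that of b plus
    -- s^(m+1) times itself; majorants being finite sums, the last term can be subtracted.
    maj-inv⊗ : ∀ m T b → maj T (inv m ⊗ b) * (1ℚ - s ^ suc m) ≤ maj T b
    maj-inv⊗ m T b = begin
      c * (1ℚ - s ^ suc m)     ≡⟨ solve 2 (λ c t → c :* (con 1ℚ :- t) := c :- t :* c) refl c (s ^ suc m) ⟩
      c - s ^ suc m * c        ≤⟨ +-monoˡ-≤ (- (s ^ suc m * c)) c≤ ⟩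
      maj T b + s ^ suc m * c - s ^ suc m * c   ≡⟨ solve 2 (λ b t → b :+ t :- t := b) refl (maj T b) (s ^ suc m * c) ⟩
      maj T b                  ∎
      where
      open ≤-Reasoning
      c = maj T (inv m ⊗ b)
      c≤ : c ≤ maj T b + s ^ suc m * c
      c≤ = ≤-trans (≤-reflexive (maj-cong T (inv⊗-unfold m b))) (≤-trans (maj-⊕ T b _) (+-monoʳ-≤ (maj T b) (maj-shift^ (suc m) T (inv m ⊗ b))))

    -- A larger exponent makes 1 - s^m larger, so a single bound in terms of (s;s)ₙ serves for every
    -- base.
    maj-divPoch : ∀ c n T b → maj T (divPoch c n b) * poch n ≤ maj T b
    maj-divPoch c zero    T b = ≤-reflexive (*-identityʳ (maj T b))
    maj-divPoch c (suc n) T b = begin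
      w * (poch n * (1ℚ - s ^ suc n))       ≡⟨ solve 3 (λ w p t → w :* (p :* t) := w :* t :* p) refl w (poch n) (1ℚ - s ^ suc n) ⟩
      w * (1ℚ - s ^ suc n) * poch n
        ≤⟨ *-monoʳ (poch n) (<⇒≤ (0<poch n)) (*-monoˡ w (0≤maj T _) (+-monoʳ-≤ 1ℚ (neg-antimono-≤ (s^-anti (ℕ.s≤s (ℕ.m≤m+n n (c ℕ.* suc n))))))) ⟩
      w * (1ℚ - s ^ suc (n ℕ.+ c ℕ.* suc n)) * poch n
        ≤⟨ *-monoʳ (poch n) (<⇒≤ (0<poch n)) (maj-inv⊗ (n ℕ.+ c ℕ.* suc n) T (divPoch c n b)) ⟩
      maj T (divPoch c n b) * poch n        ≤⟨ maj-divPoch c n T b ⟩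
      maj T b                               ∎
      where
      open ≤-Reasoning
      w = maj T (divPoch c (suc n) b)

    maj-mulFactor : ∀ k T c → maj T (mulFactor k c) ≤ (1ℚ + s ^ k) * maj T c
    maj-mulFactor k T c = begin
      maj T (c ⊕ (⊖ shift^ k c))           ≤⟨ maj-⊕ T c (⊖ shift^ k c) ⟩
      maj T c + maj T (⊖ shift^ k c)       ≤⟨ +-monoʳ-≤ (maj T c) (≤-trans (≤-reflexive (maj-⊖ T (shift^ k c))) (maj-shift^ k T c)) ⟩
      maj T c + s ^ k * maj T c            ≡⟨ solve 2 (λ m t → m :+ t :* m := (con 1ℚ :+ t) :* m) refl (maj T c) (s ^ k) ⟩
      (1ℚ + s ^ k) * maj T c               ∎
      where open ≤-Reasoning

    -- A factor 1 - X^k costs at most 1 + t with t = s^(N+1), and (1 + t)(1 - t) ≤ 1. Multiplication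
    -- is thus controlled by the same (s;s)_N as division.
    maj-mulFactors : ∀ a b N T c → maj T (mulFactors (suc a) (suc b) N c) * poch N ≤ maj T c
    maj-mulFactors a b zero    T c = ≤-reflexive (*-identityʳ (maj T c))
    maj-mulFactors a b (suc N) T c = begin
      maj T (mulFactor k w) * (poch N * (1ℚ - t))
        ≤⟨ *-monoʳ (poch N * (1ℚ - t)) (<⇒≤ (0<poch (suc N))) (≤-trans (maj-mulFactor k T w)
             (*-monoʳ (maj T w) (0≤maj T w) (+-monoʳ-≤ 1ℚ (s^-anti N<k)))) ⟩
      (1ℚ + t) * maj T w * (poch N * (1ℚ - t))
        ≡⟨ solve 3 (λ t m p → (con 1ℚ :+ t) :* m :* (p :* (con 1ℚ :- t)) := m :* p :* (con 1ℚ :- t :* t)) refl t (maj T w) (poch N) ⟩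
      maj T w * poch N * (1ℚ - t * t)
        ≤⟨ ≤-by (maj T w * poch N * (t * t)) (0≤* (0≤* (0≤maj T w) (<⇒≤ (0<poch N))) (0≤* (0≤s^ (suc N)) (0≤s^ (suc N))))
             (solve 2 (λ m t → m :* (con 1ℚ :- t :* t) :+ m :* (t :* t) := m) refl (maj T w * poch N) t) ⟩
      maj T w * poch N          ≤⟨ maj-mulFactors a b N T c ⟩
      maj T c                   ∎
      where
      open ≤-Reasoning
      k = suc a ℕ.+ suc b ℕ.* N
      w = mulFactors (suc a) (suc b) N c
      t = s ^ suc N
      N<k : suc N ℕ.≤ k
      N<k = ℕ.s≤s (ℕ.≤-trans (ℕ.m≤m+n N (b ℕ.* N)) (ℕ.m≤n+m _ a))

    maj-drop : ∀ m T c → maj (m ℕ.+ T) c ≡ maj m c + s ^ m * maj T (drop m c)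
    maj-drop zero    T c = trans (sym (*-identityˡ (maj T c))) (sym (+-identityˡ (1ℚ * maj T c)))
    maj-drop (suc m) T c = trans (cong (λ v → ∣ c 0 ∣ + s * v) (maj-drop m T (tail c)))
      (solve 5 (λ a s u p v → a :+ s :* (u :+ p :* v) := a :+ s :* u :+ s :* p :* v) refl ∣ c 0 ∣ s (maj m (tail c)) (s ^ m) (maj T (drop m (tail c))))

    -- A bound uniform in T expresses absolute convergence at s without asking for a limit.
    record Bounded (c : Series) (B : ℚ) : Set where
      field bound : ∀ T → maj T c ≤ B
    open Bounded public

    module Value (x : ℚ[i]) (x≼ : x ≼ s * s) where
      module R = CommutativeRing ℚ[i]-ring
      open Algebra.Properties.CommutativeSemiring.Exp R.commutativeSemiring using () renaming (_^_ to _^ⁱ_)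
      open IntegerSolver ℚ[i]-ring using () renaming (solve to solveⁱ; _:+_ to _⊞_; _:*_ to _⊠_; _:-_ to _⊟_; :-_ to ⊟_; _:=_ to _⊜_; con to conⁱ)
      open import Data.Integer.Base using (+_)

      eval : ℕ → Series → ℚ[i]
      eval zero    c = 0ⁱ
      eval (suc T) c = (c 0 , 0ℚ) +ⁱ x *ⁱ eval T (tail c)

      eval-cong : ∀ T {c c′} → (∀ n → n ℕ.< T → c n ≡ c′ n) → eval T c ≡ eval T c′
      eval-cong zero    c≡ = refl
      eval-cong (suc T) c≡ = cong₂ (λ a b → (a , 0ℚ) +ⁱ x *ⁱ b) (c≡ 0 (ℕ.s≤s ℕ.z≤n)) (eval-cong T (λ n n< → c≡ (suc n) (ℕ.s≤s n<)))

      eval-⊕ : ∀ T a b → eval T (a ⊕ b) ≡ eval T a +ⁱ eval T b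
      eval-⊕ zero    a b = refl
      eval-⊕ (suc T) a b = trans (cong (λ v → (a 0 + b 0 , 0ℚ) +ⁱ x *ⁱ v) (eval-⊕ T (tail a) (tail b)))
        (solveⁱ 5 (λ α β x u v → (α ⊞ β) ⊞ x ⊠ (u ⊞ v) ⊜ (α ⊞ x ⊠ u) ⊞ (β ⊞ x ⊠ v)) refl (a 0 , 0ℚ) (b 0 , 0ℚ) x (eval T (tail a)) (eval T (tail b)))

      eval-⊖ : ∀ T a → eval T (⊖ a) ≡ -ⁱ eval T a
      eval-⊖ zero    a = refl
      eval-⊖ (suc T) a = trans (cong (λ v → (- a 0 , 0ℚ) +ⁱ x *ⁱ v) (eval-⊖ T (tail a)))
        (solveⁱ 3 (λ α x u → (⊟ α) ⊞ x ⊠ (⊟ u) ⊜ ⊟ (α ⊞ x ⊠ u)) refl (a 0 , 0ℚ) x (eval T (tail a)))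

      eval-zero : ∀ T → eval T 0ˢ ≡ 0ⁱ
      eval-zero zero    = refl
      eval-zero (suc T) = trans (R.+-identityˡ _) (trans (cong (x *ⁱ_) (eval-zero T)) (R.zeroʳ x))

      eval-shift^ : ∀ k T a → eval (k ℕ.+ T) (shift^ k a) ≡ (x ^ⁱ k) *ⁱ eval T a
      eval-shift^ zero    T a = sym (R.*-identityˡ (eval T a))
      eval-shift^ (suc k) T a = trans (R.+-identityˡ _) (trans (cong (x *ⁱ_) (eval-shift^ k T a)) (sym (R.*-assoc x (x ^ⁱ k) (eval T a))))

      eval-drop : ∀ m T c → eval (m ℕ.+ T) c ≡ eval m c +ⁱ (x ^ⁱ m) *ⁱ eval T (drop m c)
      eval-drop zero    T c = trans (sym (R.*-identityˡ (eval T c))) (sym (R.+-identityˡ _))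
      eval-drop (suc m) T c = trans (cong (λ v → (c 0 , 0ℚ) +ⁱ x *ⁱ v) (eval-drop m T (tail c)))
        (solveⁱ 5 (λ a x u p v → a ⊞ x ⊠ (u ⊞ p ⊠ v) ⊜ a ⊞ x ⊠ u ⊞ x ⊠ p ⊠ v) refl (c 0 , 0ℚ) x (eval m (tail c)) (x ^ⁱ m) (eval T (drop m (tail c))))

      x≼s : x ≼ s
      x≼s = ≼-mono (subst (s * s ≤_) (*-identityʳ s) (*-monoˡ s 0≤s s≤1)) x≼

      x^≼s^ : ∀ k → x ^ⁱ k ≼ s ^ k
      x^≼s^ zero    = bounded (<⇒≤ 0<1) ≤-refl
      x^≼s^ (suc k) = ≼-* x≼s (x^≼s^ k)

      x^≼s^² : ∀ k → x ^ⁱ k ≼ s ^ k * s ^ k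
      x^≼s^² zero    = bounded (<⇒≤ 0<1) ≤-refl
      x^≼s^² (suc k) = subst (x ^ⁱ suc k ≼_) (solve 2 (λ s p → (s :* s) :* (p :* p) := (s :* p) :* (s :* p)) refl s (s ^ k)) (≼-* x≼ (x^≼s^² k))

      eval≼maj : ∀ T c → eval T c ≼ maj T c
      eval≼maj zero    c = ≼-0
      eval≼maj (suc T) c = ≼-+ (≼-ℚ (c 0)) (≼-* x≼s (eval≼maj T (tail c)))

      -- This is why |x| ≤ s² is assumed: of the bound s^m · s^m on x^m, one factor turns the
      -- majorant of the dropped series into part of the majorant of c, and the other remains as
      -- decay.
      tail-small : ∀ {c B} → Bounded c B → ∀ m T → (x ^ⁱ m) *ⁱ eval T (drop m c) ≼ s ^ m * B
      tail-small {c} {B} c≤ m T = ≼-mono (begin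
        s ^ m * s ^ m * maj T (drop m c)     ≡⟨ *-assoc (s ^ m) (s ^ m) _ ⟩
        s ^ m * (s ^ m * maj T (drop m c))   ≤⟨ *-monoˡ (s ^ m) (0≤s^ m) (≤-by (maj m c) (0≤maj m c)
          (trans (+-comm (s ^ m * maj T (drop m c)) (maj m c)) (sym (maj-drop m T c)))) ⟩
        s ^ m * maj (m ℕ.+ T) c              ≤⟨ *-monoˡ (s ^ m) (0≤s^ m) (bound c≤ (m ℕ.+ T)) ⟩
        s ^ m * B                            ∎)
        (≼-* (x^≼s^² m) (eval≼maj T (drop m c)))
        where open ≤-Reasoning

      -- The value is named in advance: for the series below it is an explicit rational expression
      -- in x, so the limit is never constructed.
      record HasValue (c : Series) (v : ℚ[i]) : Set where
        field approximation : ∀ η → 0ℚ < η → ∃ λ T₀ → ∀ T → T₀ ℕ.≤ T → eval T c +ⁱ -ⁱ v ≼ η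
      open HasValue public

      value-1 : HasValue 1ˢ 1ⁱ
      value-1 .approximation η 0<η = 1 , λ { (suc T) _ → subst (_≼ η) (sym (trans (cong (λ v → (1ⁱ +ⁱ x *ⁱ v) +ⁱ -ⁱ 1ⁱ) (eval-zero T))
        (solveⁱ 2 (λ o x → (o ⊞ x ⊠ conⁱ (+ 0)) ⊞ ⊟ o ⊜ conⁱ (+ 0)) refl 1ⁱ x))) (≼-mono (<⇒≤ 0<η) ≼-0) }

      value-⊕ : ∀ {a b v w} → HasValue a v → HasValue b w → HasValue (a ⊕ b) (v +ⁱ w)
      value-⊕ {a} {b} {v} {w} ha hb .approximation η 0<η with approximation ha (½ * η) (0<a*b (positive⁻¹ ½) 0<η) | approximation hb (½ * η) (0<a*b (positive⁻¹ ½) 0<η)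
      ... | T₁ , h₁ | T₂ , h₂ = T₁ ℕ.⊔ T₂ , λ T T≥ → subst₂ _≼_
        (trans (solveⁱ 4 (λ a b v w → (a ⊞ ⊟ v) ⊞ (b ⊞ ⊟ w) ⊜ (a ⊞ b) ⊞ ⊟ (v ⊞ w)) refl (eval T a) (eval T b) v w)
          (cong (_+ⁱ -ⁱ (v +ⁱ w)) (sym (eval-⊕ T a b))))
        (solve 1 (λ e → con ½ :* e :+ con ½ :* e := e) refl η)
        (≼-+ (h₁ T (ℕ.m⊔n≤o⇒m≤o T₁ T₂ T≥)) (h₂ T (ℕ.m⊔n≤o⇒n≤o T₁ T₂ T≥)))

      value-⊖ : ∀ {a v} → HasValue a v → HasValue (⊖ a) (-ⁱ v)
      value-⊖ {a} {v} ha .approximation η 0<η with approximation ha η 0<η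
      ... | T₁ , h₁ = T₁ , λ T T≥ → subst (_≼ η)
        (trans (solveⁱ 2 (λ a v → ⊟ (a ⊞ ⊟ v) ⊜ (⊟ a) ⊞ ⊟ (⊟ v)) refl (eval T a) v) (cong (_+ⁱ -ⁱ (-ⁱ v)) (sym (eval-⊖ T a))))
        (≼-neg (h₁ T T≥))

      value-shift^ : ∀ k {a v} → HasValue a v → HasValue (shift^ k a) ((x ^ⁱ k) *ⁱ v)
      value-shift^ k {a} {v} ha .approximation η 0<η with approximation ha η 0<η
      ... | T₁ , h₁ = k ℕ.+ T₁ , λ T T≥ → subst₂ _≼_
        (trans (trans (solveⁱ 3 (λ p a v → p ⊠ (a ⊞ ⊟ v) ⊜ p ⊠ a ⊞ ⊟ (p ⊠ v)) refl (x ^ⁱ k) (eval (T ℕ.∸ k) a) v)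
            (cong (_+ⁱ -ⁱ ((x ^ⁱ k) *ⁱ v)) (sym (eval-shift^ k (T ℕ.∸ k) a))))
          (cong (λ m → eval m (shift^ k a) +ⁱ -ⁱ ((x ^ⁱ k) *ⁱ v)) (ℕ.m+[n∸m]≡n (ℕ.≤-trans (ℕ.m≤m+n k T₁) T≥))))
        (*-identityˡ η)
        (≼-* (≼-mono (s^≤1 k) (x^≼s^ k)) (h₁ (T ℕ.∸ k) (ℕ.≤-trans (ℕ.≤-reflexive (sym (ℕ.m+n∸m≡n k T₁))) (ℕ.∸-monoˡ-≤ k T≥))))

      1-x^ : ℕ → ℚ[i]
      1-x^ k = 1ⁱ +ⁱ -ⁱ (x ^ⁱ k)

      1-x^-unit : ∀ m → 1-x^ (suc m) *ⁱ recipⁱ (1-x^ (suc m)) ≡ 1ⁱ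
      1-x^-unit m = *-recipⁱ (1-x^ (suc m)) (0<norm²[1-z] (x^≼s^ (suc m)) (s^-suc<1 m))

      value-mulFactor : ∀ k {a v} → HasValue a v → HasValue (mulFactor k a) (1-x^ k *ⁱ v)
      value-mulFactor k {a} {v} ha = subst (HasValue (mulFactor k a))
        (solveⁱ 2 (λ p v → v ⊞ ⊟ (p ⊠ v) ⊜ (conⁱ (+ 1) ⊞ ⊟ p) ⊠ v) refl (x ^ⁱ k) v)
        (value-⊕ {a} {⊖ shift^ k a} ha (value-⊖ {shift^ k a} (value-shift^ k {a} ha)))

      -- Evaluating (1 - X^k) c = b to degree k + T gives the relation of the values up to the top k
      -- terms of c. These are small by `tail-small`, which is where the bound B enters.
      value-inv⊗ : ∀ m {b v B} → HasValue b v → Bounded (inv m ⊗ b) B → HasValue (inv m ⊗ b) (recipⁱ (1-x^ (suc m)) *ⁱ v)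
      value-inv⊗ m {b} {v} {B} hb c≤ .approximation η 0<η = T₁ ℕ.⊔ T₂ , λ T T≥ → subst (_≼ η) (sym (remainder T))
        (≼-mono (small T (ℕ.m⊔n≤o⇒n≤o T₁ T₂ T≥)) (≼-* (≼-crude y) (≼-+
          (h₁ (k ℕ.+ T) (ℕ.≤-trans (ℕ.m⊔n≤o⇒m≤o T₁ T₂ T≥) (ℕ.m≤n+m T k)))
          (≼-neg (tail-small {c} {B} c≤ T k)))))
        where
        k = suc m
        c = inv m ⊗ b
        y = recipⁱ (1-x^ k)
        Y = 1ℚ + norm² y
        0<Y : 0ℚ < Y
        0<Y = +-mono-<-≤ 0<1 (0≤norm² y)
        0≤B : 0ℚ ≤ B
        0≤B = bound c≤ 0
        -- The two errors are at most ζ and ζB, and Y bounds the factor y in front of them; ζ is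
        -- chosen with Y(1 + B)ζ = η.
        Z = Y * (1ℚ + B)
        0<Z : 0ℚ < Z
        0<Z = 0<a*b 0<Y (+-mono-<-≤ 0<1 0≤B)
        sc = Defs.scale {Z} {η} 0<Z 0<η
        ζ = proj₁ sc
        0<ζ = proj₁ (proj₂ sc)
        Zζ≡η : Z * ζ ≡ η
        Zζ≡η = proj₂ (proj₂ sc)
        T₁ = proj₁ (approximation hb ζ 0<ζ)
        h₁ = proj₂ (approximation hb ζ 0<ζ)
        T₂ = proj₁ (decay ζ 0<ζ)
        small : ∀ T → T₂ ℕ.≤ T → Y * (ζ + s ^ T * B) ≤ η
        small T T≥ = ≤-trans (*-monoˡ Y (<⇒≤ 0<Y) (+-monoʳ-≤ ζ (*-monoʳ B 0≤B (proj₂ (decay ζ 0<ζ) T T≥))))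
          (≤-reflexive (trans (solve 3 (λ y z b → y :* (z :+ z :* b) := y :* (con 1ℚ :+ b) :* z) refl Y ζ B) Zζ≡η))
        remainder : ∀ T → eval T c +ⁱ -ⁱ (y *ⁱ v)
          ≡ y *ⁱ ((eval (k ℕ.+ T) b +ⁱ -ⁱ v) +ⁱ -ⁱ ((x ^ⁱ T) *ⁱ eval k (drop T c)))
        remainder T = begin
          E +ⁱ -ⁱ (y *ⁱ v)                     ≡⟨ cong (λ u → u +ⁱ -ⁱ (y *ⁱ v)) (sym (trans (cong (_*ⁱ E) (1-x^-unit m)) (R.*-identityˡ E))) ⟩
          1-x^ k *ⁱ y *ⁱ E +ⁱ -ⁱ (y *ⁱ v)
            ≡⟨ solveⁱ 4 (λ p y e v → (conⁱ (+ 1) ⊞ ⊟ p) ⊠ y ⊠ e ⊞ ⊟ (y ⊠ v) ⊜ y ⊠ (e ⊞ ⊟ (p ⊠ e) ⊞ ⊟ v)) refl (x ^ⁱ k) y E v ⟩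
          y *ⁱ (E +ⁱ -ⁱ ((x ^ⁱ k) *ⁱ E) +ⁱ -ⁱ v)
            ≡⟨ cong (λ u → y *ⁱ (E +ⁱ -ⁱ u +ⁱ -ⁱ v)) (R.trans (sym (solveⁱ 2 (λ b p → (b ⊞ p) ⊞ ⊟ b ⊜ p) refl Eb ((x ^ⁱ k) *ⁱ E)))
                 (cong (_+ⁱ -ⁱ Eb) (trans (sym Ec) (trans (cong (λ n → eval n c) (ℕ.+-comm k T)) (eval-drop T k c))))) ⟩
          y *ⁱ (E +ⁱ -ⁱ ((E +ⁱ r) +ⁱ -ⁱ Eb) +ⁱ -ⁱ v)
            ≡⟨ solveⁱ 5 (λ y e r b v → y ⊠ (e ⊞ ⊟ ((e ⊞ r) ⊞ ⊟ b) ⊞ ⊟ v) ⊜ y ⊠ ((b ⊞ ⊟ v) ⊞ ⊟ r)) refl y E r Eb v ⟩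
          y *ⁱ ((Eb +ⁱ -ⁱ v) +ⁱ -ⁱ r)          ∎
          where
          open ≡-Reasoning
          E = eval T c
          Eb = eval (k ℕ.+ T) b
          r = (x ^ⁱ T) *ⁱ eval k (drop T c)
          Ec : eval (k ℕ.+ T) c ≡ Eb +ⁱ (x ^ⁱ k) *ⁱ E
          Ec = trans (eval-cong (k ℕ.+ T) (λ n _ → inv⊗-unfold m b n)) (trans (eval-⊕ (k ℕ.+ T) b (shift^ k c))
            (cong (Eb +ⁱ_) (eval-shift^ k T c)))

      -- The bridge from congruences to inequalities. If the first M coefficients vanish, evaluation
      -- consists of a tail of size at most s^M B; the extra s^M is the tolerance to which v is
      -- approximated.
      value-vanishing : ∀ {c v B M} → c ≈[ M ] 0ˢ → Bounded c B → HasValue c v → v ≼ s ^ M * (1ℚ + B)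
      value-vanishing {c} {v} {B} {M} c≈0 c≤ hc with approximation hc (s ^ M) (0<s^ M)
      ... | T₀ , h = subst₂ _≼_
        (trans (cong (λ u → u +ⁱ -ⁱ (eval (M ℕ.+ T₀) c +ⁱ -ⁱ v)) (sym (trans (eval-drop M T₀ c) (trans (cong (_+ⁱ r) (trans (eval-cong M (at c≈0)) (eval-zero M))) (R.+-identityˡ r)))))
          (solveⁱ 2 (λ e v → e ⊞ ⊟ (e ⊞ ⊟ v) ⊜ v) refl (eval (M ℕ.+ T₀) c) v))
        (solve 2 (λ p b → p :* b :+ p := p :* (con 1ℚ :+ b)) refl (s ^ M) B)
        (≼-+ (tail-small {c} {B} c≤ M T₀) (≼-neg (h (M ℕ.+ T₀) (ℕ.m≤n+m T₀ M))))
        where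
        r = (x ^ⁱ M) *ⁱ eval T₀ (drop M c)

-- Uniform bounds for the sums, products and defects.

module Estimation where

  open import Defs using (0<1; *-mono-≤; scale)
  open PowerSeries using (Series; 0ˢ; 1ˢ; _⊕_; ⊖_; shift^; _≈[_]_; agree; at; shift^-vanish)
  open FormalIdentities
  open RationalEstimates
  open GaussianRationals
  open Evaluation
  open import Data.Nat.Base as ℕ using (ℕ; zero; suc)
  import Data.Nat.Properties as ℕ
  open import Data.Rational.Base
  open import Data.Rational.Properties
  open import Data.Rational.Solver using (module +-*-Solver)
  open +-*-Solver using (solve; _:+_; _:*_; _:-_; :-_; _:=_; con)
  open import Data.Product using (∃; _×_; _,_; proj₁; proj₂)
  open import Data.Sum.Base using (inj₁; inj₂)
  open import Data.Empty using (⊥-elim)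
  open import Relation.Nullary using (yes; no)
  open import Data.List.Base using (List; []; _∷_; _++_; map; foldr; applyUpTo; upTo; cartesianProduct)
  open import Data.List.Properties using (map-∘)
  open import Data.List.Membership.Propositional using (_∈_)
  open import Data.List.Membership.Propositional.Properties using (∈-∃++; ∈-++⁻; ∈-++⁺ˡ; ∈-++⁺ʳ; ∈-upTo⁺; ∈-cartesianProduct⁺)
  open import Data.List.Relation.Unary.Any using (here; there)
  import Data.List.Relation.Unary.All as All
  open import Data.List.Relation.Unary.AllPairs using ([]; _∷_)
  open import Data.List.Relation.Unary.Unique.Propositional using (Unique)
  open import Data.List.Relation.Binary.Subset.Propositional using (_⊆_)
  open import Relation.Binary.PropositionalEquality
  import Algebra.Properties.CommutativeSemiring.Exp

  sumℚ : ∀ {A : Set} → (A → ℚ) → List A → ℚ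
  sumℚ w F = foldr _+_ 0ℚ (map w F)

  sumℚ-++ : ∀ {A : Set} (w : A → ℚ) xs ys → sumℚ w (xs ++ ys) ≡ sumℚ w xs + sumℚ w ys
  sumℚ-++ w []       ys = sym (+-identityˡ (sumℚ w ys))
  sumℚ-++ w (x ∷ xs) ys = trans (cong (w x +_) (sumℚ-++ w xs ys)) (sym (+-assoc (w x) (sumℚ w xs) (sumℚ w ys)))

  0≤sumℚ : ∀ {A : Set} (w : A → ℚ) → (∀ a → 0ℚ ≤ w a) → ∀ F → 0ℚ ≤ sumℚ w F
  0≤sumℚ w 0≤w []      = ≤-refl
  0≤sumℚ w 0≤w (a ∷ F) = 0≤+ (0≤w a) (0≤sumℚ w 0≤w F)

  sumℚ-⊆ : ∀ {A : Set} (w : A → ℚ) → (∀ a → 0ℚ ≤ w a) → ∀ {F B} → Unique F → F ⊆ B → sumℚ w F ≤ sumℚ w B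
  sumℚ-⊆ w 0≤w {[]}    {B} []       F⊆B = 0≤sumℚ w 0≤w B
  sumℚ-⊆ w 0≤w {a ∷ F} {B} (a∉ ∷ u) F⊆B with ∈-∃++ (F⊆B (here refl))
  ... | ys , zs , refl = ≤-trans (+-monoʳ-≤ (w a) (sumℚ-⊆ w 0≤w u sub)) (≤-reflexive (begin
    w a + sumℚ w (ys ++ zs)             ≡⟨ cong (w a +_) (sumℚ-++ w ys zs) ⟩
    w a + (sumℚ w ys + sumℚ w zs)       ≡⟨ solve 3 (λ a y z → a :+ (y :+ z) := y :+ (a :+ z)) refl (w a) (sumℚ w ys) (sumℚ w zs) ⟩
    sumℚ w ys + (w a + sumℚ w zs)       ≡⟨ sym (sumℚ-++ w ys (a ∷ zs)) ⟩
    sumℚ w (ys ++ a ∷ zs)               ∎))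
    where
    open ≡-Reasoning
    sub : F ⊆ ys ++ zs
    sub {b} b∈F with ∈-++⁻ ys (F⊆B (there b∈F))
    ... | inj₁ b∈ys          = ∈-++⁺ˡ b∈ys
    ... | inj₂ (here b≡a)    = ⊥-elim (All.lookup a∉ b∈F (sym b≡a))
    ... | inj₂ (there b∈zs)  = ∈-++⁺ʳ ys b∈zs

  sumℚ-* : ∀ {A : Set} c (w : A → ℚ) F → sumℚ (λ a → c * w a) F ≡ c * sumℚ w F
  sumℚ-* c w []      = sym (*-zeroʳ c)
  sumℚ-* c w (a ∷ F) = trans (cong (c * w a +_) (sumℚ-* c w F)) (sym (*-distribˡ-+ c (w a) (sumℚ w F)))

  sumℚ-product : ∀ {A B : Set} (w : A → ℚ) (v : B → ℚ) xs ys →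
    sumℚ (λ (a , b) → w a * v b) (cartesianProduct xs ys) ≡ sumℚ w xs * sumℚ v ys
  sumℚ-product w v []       ys = sym (*-zeroˡ (sumℚ v ys))
  sumℚ-product w v (x ∷ xs) ys = begin
    sumℚ wv (map (x ,_) ys ++ cartesianProduct xs ys)   ≡⟨ sumℚ-++ wv (map (x ,_) ys) (cartesianProduct xs ys) ⟩
    sumℚ wv (map (x ,_) ys) + sumℚ wv (cartesianProduct xs ys)
      ≡⟨ cong₂ _+_ (trans (cong (foldr _+_ 0ℚ) (sym (map-∘ ys))) (sumℚ-* (w x) v ys)) (sumℚ-product w v xs ys) ⟩
    w x * sumℚ v ys + sumℚ w xs * sumℚ v ys             ≡⟨ sym (*-distribʳ-+ (sumℚ v ys) (w x) (sumℚ w xs)) ⟩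
    (w x + sumℚ w xs) * sumℚ v ys                       ∎
    where
    open ≡-Reasoning
    wv = λ (a , b) → w a * v b

  ⊆-box : (F : List Index) → ∃ λ N → F ⊆ box N
  ⊆-box [] = 0 , λ ()
  ⊆-box ((i , j , k) ∷ F) = N , λ
    { (here refl) → mem i j k (ℕ.≤-trans (ℕ.m≤m+n i j) (ℕ.m≤m+n (i ℕ.+ j) k)) (ℕ.≤-trans (ℕ.m≤n+m j i) (ℕ.m≤m+n (i ℕ.+ j) k)) (ℕ.m≤n+m k (i ℕ.+ j))
    ; (there I∈F) → mono (proj₂ (⊆-box F) I∈F) }
    where
    open import Data.List.Membership.Propositional.Properties using (∈-upTo⁻; ∈-cartesianProduct⁻)
    n = proj₁ (⊆-box F)
    t = i ℕ.+ j ℕ.+ k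
    N = suc t ℕ.+ n
    mem : ∀ i′ j′ k′ → i′ ℕ.≤ t → j′ ℕ.≤ t → k′ ℕ.≤ t → (i′ , j′ , k′) ∈ box N
    mem i′ j′ k′ i≤ j≤ k≤ = ∈-cartesianProduct⁺ (up i≤) (∈-cartesianProduct⁺ (up j≤) (up k≤))
      where
      up : ∀ {m} → m ℕ.≤ t → m ∈ upTo N
      up m≤t = ∈-upTo⁺ (ℕ.s≤s (ℕ.≤-trans m≤t (ℕ.m≤m+n t n)))
    mono : ∀ {I} → I ∈ box n → I ∈ box N
    mono {i′ , j′ , k′} I∈ with ∈-cartesianProduct⁻ (upTo n) (cartesianProduct (upTo n) (upTo n)) I∈
    ... | i∈ , jk∈ with ∈-cartesianProduct⁻ (upTo n) (upTo n) jk∈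
    ... | j∈ , k∈ = ∈-cartesianProduct⁺ (up i∈) (∈-cartesianProduct⁺ (up j∈) (up k∈))
      where
      up : ∀ {m} → m ∈ upTo n → m ∈ upTo N
      up m∈ = ∈-upTo⁺ (ℕ.<-≤-trans (∈-upTo⁻ m∈) (ℕ.m≤n+m n (suc t)))

  pochⁱ : ℚ[i] → ℚ[i] → ℕ → ℚ[i]
  pochⁱ a p zero    = 1ⁱ
  pochⁱ a p (suc n) = pochⁱ a p n *ⁱ (1ⁱ +ⁱ -ⁱ (a *ⁱ p ^ⁱ n))
    where open Algebra.Properties.CommutativeSemiring.Exp (CommutativeRing.commutativeSemiring ℚ[i]-ring) using () renaming (_^_ to _^ⁱ_)

  sumⁱ : (Index → ℚ[i]) → List Index → ℚ[i]
  sumⁱ t F = foldr _+ⁱ_ 0ⁱ (map t F)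

  module _ where
    open Algebra.Properties.CommutativeSemiring.Exp (CommutativeRing.commutativeSemiring ℚ[i]-ring) using () renaming (_^_ to _^ⁱ_)

    -- The first base is written as a first power so that all three factors have the shape treated
    -- by `poch-unpoch`.
    denominatorⁱ : ℚ[i] → Index → ℚ[i]
    denominatorⁱ x (i , j , k) = pochⁱ (x ^ⁱ 1) (x ^ⁱ 1) i *ⁱ pochⁱ (x ^ⁱ 2) (x ^ⁱ 2) j *ⁱ pochⁱ (x ^ⁱ 3) (x ^ⁱ 3) k

    termⁱ : ℚ[i] → (Index → ℕ) → (Index → ℚ[i]) → Index → ℚ[i]
    termⁱ x e φ I = (φ I *ⁱ x ^ⁱ e I) *ⁱ recipⁱ (denominatorⁱ x I)

  unit⇒0<norm² : ∀ {z w} → z *ⁱ w ≡ 1ⁱ → 0ℚ < norm² z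
  unit⇒0<norm² {z} {w} zw≡1 with 0ℚ <? norm² z
  ... | yes p = p
  ... | no ¬p = ⊥-elim (<⇒≱ 0<1 (≤-trans (≤-reflexive (trans (cong norm² (sym zw≡1)) (norm²-* z w)))
    (≤-trans (*-monoʳ (norm² w) (0≤norm² w) (≮⇒≥ ¬p)) (≤-reflexive (*-zeroˡ (norm² w))))))

  module Estimates (s : ℚ) (0<s : 0ℚ < s) (s<1 : s < 1ℚ) where
    open Powers s 0<s s<1
    open Majorant s 0<s s<1

    private
      inverse : ∀ {p} → 0ℚ < p → ∃ λ r → 0ℚ < r × p * r ≡ 1ℚ
      inverse 0<p = scale 0<p 0<1
      δ-inverse = inverse (proj₁ (proj₂ poch-bounded))
      geometric = inverse (<⇒0<- s<1)

    -- 1/K bounds all partial products of (s;s)∞ from below.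
    K : ℚ
    K = proj₁ δ-inverse

    0<K : 0ℚ < K
    0<K = proj₁ (proj₂ δ-inverse)

    0≤K : 0ℚ ≤ K
    0≤K = <⇒≤ 0<K

    poch-cancel : ∀ n {a b} → 0ℚ ≤ a → a * poch n ≤ b → a ≤ b * K
    poch-cancel n {a} {b} 0≤a a*p≤b = begin
      a                  ≡⟨ sym (*-identityʳ a) ⟩
      a * 1ℚ             ≡⟨ cong (a *_) (sym (proj₂ (proj₂ δ-inverse))) ⟩
      a * (proj₁ poch-bounded * K)   ≤⟨ *-monoˡ a 0≤a (*-monoʳ K 0≤K (proj₂ (proj₂ poch-bounded) n)) ⟩
      a * (poch n * K)   ≡⟨ sym (*-assoc a (poch n) K) ⟩
      a * poch n * K     ≤⟨ *-monoʳ K 0≤K a*p≤b ⟩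
      b * K              ∎
      where open ≤-Reasoning

    Bounded-divPoch : ∀ c n {b B} → Bounded b B → Bounded (divPoch c n b) (B * K)
    Bounded-divPoch c n {b} b≤ .bound T = poch-cancel n (0≤maj T _) (≤-trans (maj-divPoch c n T b) (bound b≤ T))

    Bounded-mulFactors : ∀ a b N {c B} → Bounded c B → Bounded (mulFactors (suc a) (suc b) N c) (B * K)
    Bounded-mulFactors a b N {c} c≤ .bound T = poch-cancel N (0≤maj T _) (≤-trans (maj-mulFactors a b N T c) (bound c≤ T))

    Bounded-⊕ : ∀ {a b A B} → Bounded a A → Bounded b B → Bounded (a ⊕ b) (A + B)
    Bounded-⊕ {a} {b} a≤ b≤ .bound T = ≤-trans (maj-⊕ T a b) (+-mono-≤ (bound a≤ T) (bound b≤ T))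

    Bounded-⊖ : ∀ {a A} → Bounded a A → Bounded (⊖ a) A
    Bounded-⊖ {a} a≤ .bound T = ≤-trans (≤-reflexive (maj-⊖ T a)) (bound a≤ T)

    Bounded-shift^ : ∀ k {a A} → Bounded a A → Bounded (shift^ k a) (s ^ k * A)
    Bounded-shift^ k {a} a≤ .bound T = ≤-trans (maj-shift^ k T a) (*-monoˡ (s ^ k) (0≤s^ k) (bound a≤ T))

    Bounded-1 : Bounded 1ˢ 1ℚ
    Bounded-1 .bound = maj-1

    Bounded-X^ : ∀ k → Bounded (shift^ k 1ˢ) 1ℚ
    Bounded-X^ k .bound T = ≤-trans (bound (Bounded-shift^ k Bounded-1) T) (≤-trans (≤-reflexive (*-identityʳ (s ^ k))) (s^≤1 k))

    Bounded-sum : ∀ {t : Index → Series} {w : Index → ℚ} → (∀ I → Bounded (t I) (w I)) → ∀ F → Bounded (sumˢ t F) (sumℚ w F)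
    Bounded-sum t≤ []      .bound T = ≤-reflexive (maj-zero T (λ _ → refl))
    Bounded-sum {t} t≤ (I ∷ F) = Bounded-⊕ {t I} {sumˢ t F} (t≤ I) (Bounded-sum t≤ F)

    weight : Index → ℚ
    weight (i , j , k) = s ^ i * (s ^ j * s ^ k)

    0≤weight : ∀ I → 0ℚ ≤ weight I
    0≤weight (i , j , k) = 0≤* (0≤s^ i) (0≤* (0≤s^ j) (0≤s^ k))

    private
      Γ = proj₁ geometric

      0≤Γ : 0ℚ ≤ Γ
      0≤Γ = <⇒≤ (proj₁ (proj₂ geometric))

      geometric-sum : ∀ N (h : ℕ → ℕ) → (∀ i → h (suc i) ≡ suc (h i)) → (1ℚ - s) * sumℚ (s ^_) (applyUpTo h N) ≤ s ^ h 0
      geometric-sum zero    h h-suc = ≤-trans (≤-reflexive (*-zeroʳ (1ℚ - s))) (0≤s^ (h 0))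
      geometric-sum (suc N) h h-suc = ≤-trans (≤-reflexive (*-distribˡ-+ (1ℚ - s) (s ^ h 0) _))
        (≤-trans (+-monoʳ-≤ ((1ℚ - s) * s ^ h 0) (geometric-sum N (λ i → h (suc i)) (λ i → h-suc (suc i))))
        (≤-reflexive (trans (cong (λ m → (1ℚ - s) * s ^ h 0 + s ^ m) (h-suc 0))
          (solve 2 (λ s p → (con 1ℚ :- s) :* p :+ s :* p := p) refl s (s ^ h 0)))))

      sum-upTo≤ : ∀ N → sumℚ (s ^_) (upTo N) ≤ Γ
      sum-upTo≤ N = begin
        Σs                       ≡⟨ sym (*-identityˡ Σs) ⟩
        1ℚ * Σs                  ≡⟨ cong (_* Σs) (trans (sym (proj₂ (proj₂ geometric))) (*-comm (1ℚ - s) Γ)) ⟩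
        Γ * (1ℚ - s) * Σs        ≡⟨ *-assoc Γ (1ℚ - s) Σs ⟩
        Γ * ((1ℚ - s) * Σs)      ≤⟨ *-monoˡ Γ 0≤Γ (geometric-sum N (λ i → i) (λ _ → refl)) ⟩
        Γ * 1ℚ                   ≡⟨ *-identityʳ Γ ⟩
        Γ                        ∎
        where
        open ≤-Reasoning
        Σs = sumℚ (s ^_) (upTo N)

    -- A duplicate-free list lies in some box, over which the weights factor into three geometric
    -- sums; the resulting bound does not depend on the list.
    weight-sum : ∀ {F} → Unique F → sumℚ weight F ≤ Γ * (Γ * Γ)
    weight-sum {F} uF with ⊆-box F
    ... | N , F⊆ = begin
      sumℚ weight F          ≤⟨ sumℚ-⊆ weight 0≤weight uF F⊆ ⟩
      sumℚ weight (box N)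
        ≡⟨ trans (sumℚ-product (s ^_) (λ (j , k) → s ^ j * s ^ k) (upTo N) _) (cong (sumℚ (s ^_) (upTo N) *_) (sumℚ-product (s ^_) (s ^_) (upTo N) (upTo N))) ⟩
      Σs * (Σs * Σs)
        ≤⟨ *-mono-≤ 0≤Γ (0≤* 0≤Σs 0≤Σs) (sum-upTo≤ N) (*-mono-≤ 0≤Γ 0≤Σs (sum-upTo≤ N) (sum-upTo≤ N)) ⟩
      Γ * (Γ * Γ)            ∎
      where
      open ≤-Reasoning
      Σs = sumℚ (s ^_) (upTo N)
      0≤Σs : 0ℚ ≤ Σs
      0≤Σs = 0≤sumℚ (s ^_) 0≤s^ (upTo N)

    -- 3 for the three monomials of a numerator, K for each of the three divisions, and Γ³ for the
    -- sum of all s^(i+j+k).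
    sumBound : ℚ
    sumBound = (1ℚ + 1ℚ + 1ℚ) * K * K * K * (Γ * (Γ * Γ))

    Bounded-terms : ∀ (e : Index → ℕ) (f : Index → Series) → (∀ i j k → i ℕ.+ j ℕ.+ k ℕ.≤ e (i , j , k)) →
      (∀ I → Bounded (f I) (1ℚ + 1ℚ + 1ℚ)) → ∀ {F} → Unique F → Bounded (sumˢ (λ I → divide I (shift^ (e I) (f I))) F) sumBound
    Bounded-terms e f size≤e f≤ {F} uF .bound T = begin
      maj T (sumˢ _ F)       ≤⟨ bound (Bounded-sum term≤ F) T ⟩
      sumℚ (λ I → three * weight I) F   ≡⟨ sumℚ-* three weight F ⟩
      three * sumℚ weight F  ≤⟨ *-monoˡ three 0≤three (weight-sum uF) ⟩
      sumBound               ∎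
      where
      open ≤-Reasoning
      three = (1ℚ + 1ℚ + 1ℚ) * K * K * K
      0≤3 : 0ℚ ≤ 1ℚ + 1ℚ + 1ℚ
      0≤3 = nonNegative⁻¹ (1ℚ + 1ℚ + 1ℚ)
      0≤three : 0ℚ ≤ three
      0≤three = 0≤* (0≤* (0≤* 0≤3 0≤K) 0≤K) 0≤K
      term≤ : ∀ I → Bounded (divide I (shift^ (e I) (f I))) (three * weight I)
      term≤ (i , j , k) .bound T = ≤-trans (bound (Bounded-divPoch 0 i (Bounded-divPoch 1 j (Bounded-divPoch 2 k (Bounded-shift^ (e (i , j , k)) (f≤ (i , j , k)))))) T)
        (≤-trans (*-monoʳ K 0≤K (*-monoʳ K 0≤K (*-monoʳ K 0≤K (*-monoʳ (1ℚ + 1ℚ + 1ℚ) 0≤3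
          (≤-trans (s^-anti (size≤e i j k)) (≤-reflexive (trans (^-homo-* s (i ℕ.+ j) k) (cong (_* s ^ k) (^-homo-* s i j)))))))))
        (≤-reflexive (solve 5 (λ a b c t K → a :* b :* c :* t :* K :* K :* K := t :* K :* K :* K :* (a :* (b :* c))) refl (s ^ i) (s ^ j) (s ^ k) (1ℚ + 1ℚ + 1ℚ) K)))

    defectBound : ℚ
    defectBound = sumBound * K * K * K * K + 1ℚ

    Bounded-defect : ∀ a b a₁ a₂ a₃ c t F N → Bounded (sumˢ t F) sumBound →
      Bounded (defect (suc a) (suc b) (suc a₁) (suc a₂) (suc a₃) (suc c) t F N) defectBound
    Bounded-defect a b a₁ a₂ a₃ c t F N Σ≤ = Bounded-⊕ {mulFactors (suc a) (suc b) N _}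
      (Bounded-mulFactors a b N (Bounded-mulFactors a₁ c N (Bounded-mulFactors a₂ c N (Bounded-mulFactors a₃ c N Σ≤))))
      (Bounded-⊖ Bounded-1)

    Bounded-product : ∀ a b N → Bounded (mulFactors (suc a) (suc b) N 1ˢ) (1ℚ * K)
    Bounded-product a b N = Bounded-mulFactors a b N Bounded-1

    mulFactors-stable : ∀ a b N n → mulFactors a (suc b) (n ℕ.+ N) 1ˢ ≈[ N ] mulFactors a (suc b) N 1ˢ
    mulFactors-stable a b N zero    = agree λ _ _ → refl
    mulFactors-stable a b N (suc n) = agree λ i i<N → trans
      (trans (cong (λ v → mulFactors a (suc b) (n ℕ.+ N) 1ˢ i - v)
        (at (shift^-vanish (a ℕ.+ suc b ℕ.* (n ℕ.+ N)) _) i (ℕ.<-≤-trans i<N (ℕ.≤-trans (ℕ.m≤n+m N n) (ℕ.≤-trans (ℕ.m≤m+n (n ℕ.+ N) _) (ℕ.m≤n+m _ a))))))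
        (+-identityʳ _))
      (at (mulFactors-stable a b N n) i i<N)

    module AtPoint (x : ℚ[i]) (x≼ : x ≼ s * s) where
      open Value x x≼
      open Algebra.Properties.CommutativeSemiring.Exp R.commutativeSemiring using () renaming (_^_ to _^ⁱ_; ^-homo-* to ^ⁱ-homo; ^-assocʳ to ^ⁱ-assoc)
      open IntegerSolver ℚ[i]-ring using () renaming (solve to solveⁱ; _:+_ to _⊞_; _:*_ to _⊠_; :-_ to ⊟_; _:=_ to _⊜_; con to conⁱ)
      open import Data.Integer.Base using (+_)

      unpoch : ℕ → ℕ → ℚ[i]
      unpoch c zero    = 1ⁱ
      unpoch c (suc n) = recipⁱ (1-x^ (suc c ℕ.* suc n)) *ⁱ unpoch c n

      poch-unpoch : ∀ c n → pochⁱ (x ^ⁱ suc c) (x ^ⁱ suc c) n *ⁱ unpoch c n ≡ 1ⁱ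
      poch-unpoch c zero    = refl
      poch-unpoch c (suc n) = begin
        p *ⁱ (1ⁱ +ⁱ -ⁱ (x ^ⁱ suc c *ⁱ (x ^ⁱ suc c) ^ⁱ n)) *ⁱ (r *ⁱ unpoch c n)
          ≡⟨ cong (λ v → p *ⁱ (1ⁱ +ⁱ -ⁱ v) *ⁱ (r *ⁱ unpoch c n)) (^ⁱ-assoc x (suc c) (suc n)) ⟩
        p *ⁱ 1-x^ k *ⁱ (r *ⁱ unpoch c n)
          ≡⟨ solveⁱ 4 (λ p f r y → p ⊠ f ⊠ (r ⊠ y) ⊜ (p ⊠ y) ⊠ (f ⊠ r)) refl p (1-x^ k) r (unpoch c n) ⟩
        (p *ⁱ unpoch c n) *ⁱ (1-x^ k *ⁱ r)   ≡⟨ cong₂ _*ⁱ_ (poch-unpoch c n) (1-x^-unit (n ℕ.+ c ℕ.* suc n)) ⟩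
        1ⁱ *ⁱ 1ⁱ                             ≡⟨ R.*-identityˡ 1ⁱ ⟩
        1ⁱ                                   ∎
        where
        open ≡-Reasoning
        k = suc c ℕ.* suc n
        p = pochⁱ (x ^ⁱ suc c) (x ^ⁱ suc c) n
        r = recipⁱ (1-x^ k)

      value-divPoch : ∀ c n {b v B} → Bounded b B → HasValue b v → HasValue (divPoch c n b) (unpoch c n *ⁱ v)
      value-divPoch c zero    {b} {v} b≤ hb = subst (HasValue b) (sym (R.*-identityˡ v)) hb
      value-divPoch c (suc n) {b} {v} b≤ hb = subst (HasValue (divPoch c (suc n) b)) (sym (R.*-assoc (recipⁱ (1-x^ (suc c ℕ.* suc n))) (unpoch c n) v))
        (value-inv⊗ (n ℕ.+ c ℕ.* suc n) {divPoch c n b} {unpoch c n *ⁱ v} (value-divPoch c n b≤ hb) (Bounded-divPoch c (suc n) b≤))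

      value-mulFactors : ∀ a b N {c v} → HasValue c v → HasValue (mulFactors a b N c) (pochⁱ (x ^ⁱ a) (x ^ⁱ b) N *ⁱ v)
      value-mulFactors a b zero    {c} {v} hc = subst (HasValue c) (sym (R.*-identityˡ v)) hc
      value-mulFactors a b (suc N) {c} {v} hc = subst (HasValue (mulFactors a b (suc N) c))
        (trans (cong (λ u → (1ⁱ +ⁱ -ⁱ u) *ⁱ (p *ⁱ v)) (trans (^ⁱ-homo x a (b ℕ.* N)) (cong (x ^ⁱ a *ⁱ_) (sym (^ⁱ-assoc x b N)))))
          (solveⁱ 3 (λ f p v → f ⊠ (p ⊠ v) ⊜ (p ⊠ f) ⊠ v) refl (1ⁱ +ⁱ -ⁱ (x ^ⁱ a *ⁱ (x ^ⁱ b) ^ⁱ N)) p v))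
        (value-mulFactor (a ℕ.+ b ℕ.* N) {mulFactors a b N c} (value-mulFactors a b N hc))
        where p = pochⁱ (x ^ⁱ a) (x ^ⁱ b) N

      value-0 : HasValue 0ˢ 0ⁱ
      value-0 .approximation η 0<η = 0 , λ T _ → subst (_≼ η) (sym (trans (cong (_+ⁱ -ⁱ 0ⁱ) (eval-zero T)) (R.-‿inverseʳ 0ⁱ))) (≼-mono (<⇒≤ 0<η) ≼-0)

      value-sum : ∀ {t : Index → Series} {τ : Index → ℚ[i]} → (∀ I → HasValue (t I) (τ I)) → ∀ F → HasValue (sumˢ t F) (sumⁱ τ F)
      value-sum h []      = value-0
      value-sum {t} h (I ∷ F) = value-⊕ {t I} {sumˢ t F} (h I) (value-sum h F)

      value-X^ : ∀ k → HasValue (shift^ k 1ˢ) (x ^ⁱ k)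
      value-X^ k = subst (HasValue (shift^ k 1ˢ)) (R.*-identityʳ (x ^ⁱ k)) (value-shift^ k {1ˢ} value-1)

      -- The series is divided factor by factor, whereas the target has a single reciprocal of the
      -- whole denominator; uniqueness of inverses identifies the two.
      value-term : ∀ e (f : Index → Series) (φ : Index → ℚ[i]) I → Bounded (f I) (1ℚ + 1ℚ + 1ℚ) → HasValue (f I) (φ I) →
        HasValue (divide I (shift^ (e I) (f I))) (termⁱ x e φ I)
      value-term e f φ I@(i , j , k) f≤ hf = subst (HasValue (divide I (shift^ (e I) (f I))))
        (trans (solveⁱ 5 (λ a b c p v → a ⊠ (b ⊠ (c ⊠ (p ⊠ v))) ⊜ (v ⊠ p) ⊠ (a ⊠ (b ⊠ c))) refl y₁ y₂ y₃ (x ^ⁱ e I) (φ I))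
          (cong ((φ I *ⁱ x ^ⁱ e I) *ⁱ_) (recip-unique {denominatorⁱ x I} (unit⇒0<norm² {denominatorⁱ x I} {y₁ *ⁱ (y₂ *ⁱ y₃)} unit) unit)))
        (value-divPoch 0 i {v = y₂ *ⁱ (y₃ *ⁱ v₀)} (Bounded-divPoch 1 j (Bounded-divPoch 2 k num≤))
          (value-divPoch 1 j {v = y₃ *ⁱ v₀} (Bounded-divPoch 2 k num≤) (value-divPoch 2 k {v = v₀} num≤ (value-shift^ (e I) {f I} {φ I} hf))))
        where
        v₀ = x ^ⁱ e I *ⁱ φ I
        y₁ = unpoch 0 i
        y₂ = unpoch 1 j
        y₃ = unpoch 2 k
        num≤ = Bounded-shift^ (e I) f≤
        unit : denominatorⁱ x I *ⁱ (y₁ *ⁱ (y₂ *ⁱ y₃)) ≡ 1ⁱ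
        unit = trans (solveⁱ 6 (λ a b c u v w → (a ⊠ b ⊠ c) ⊠ (u ⊠ (v ⊠ w)) ⊜ (a ⊠ u) ⊠ ((b ⊠ v) ⊠ (c ⊠ w))) refl (pochⁱ (x ^ⁱ 1) (x ^ⁱ 1) i) (pochⁱ (x ^ⁱ 2) (x ^ⁱ 2) j) (pochⁱ (x ^ⁱ 3) (x ^ⁱ 3) k) y₁ y₂ y₃)
          (cong₂ _*ⁱ_ (poch-unpoch 0 i) (cong₂ _*ⁱ_ (poch-unpoch 1 j) (poch-unpoch 2 k)))

      -- Two partial products with at least N factors agree modulo X^N, so their difference is the
      -- value of a series divisible by X^N.
      product-cauchy : ∀ a b {N m n} → N ℕ.≤ m → N ℕ.≤ n →
        pochⁱ (x ^ⁱ suc a) (x ^ⁱ suc b) m +ⁱ -ⁱ pochⁱ (x ^ⁱ suc a) (x ^ⁱ suc b) n ≼ s ^ N * (1ℚ + (1ℚ * K + 1ℚ * K))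
      product-cauchy a b {N} {m} {n} N≤m N≤n = value-vanishing {Pr m ⊕ (⊖ Pr n)} vanish
        (Bounded-⊕ {Pr m} {⊖ Pr n} (Bounded-product a b m) (Bounded-⊖ {Pr n} (Bounded-product a b n)))
        (value-⊕ {Pr m} {⊖ Pr n} (value m) (value-⊖ {Pr n} (value n)))
        where
        Pr : ℕ → Series
        Pr k = mulFactors (suc a) (suc b) k 1ˢ
        value : ∀ k → HasValue (Pr k) (pochⁱ (x ^ⁱ suc a) (x ^ⁱ suc b) k)
        value k = subst (HasValue (Pr k)) (R.*-identityʳ _) (value-mulFactors (suc a) (suc b) k value-1)
        from : ∀ {k} → N ℕ.≤ k → Pr k ≈[ N ] Pr N
        from {k} N≤k = subst (λ j → Pr j ≈[ N ] Pr N) (ℕ.m∸n+n≡m N≤k) (mulFactors-stable (suc a) b N (k ℕ.∸ N))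
        vanish : (Pr m ⊕ (⊖ Pr n)) ≈[ N ] 0ˢ
        vanish = agree λ i i<N → trans (cong₂ _-_ (at (from N≤m) i i<N) (at (from N≤n) i i<N)) (+-inverseʳ (Pr N i))

      module Estimate (a b a₁ a₂ a₃ c : ℕ) (e : Index → ℕ) (f : Index → Series) (φ : Index → ℚ[i])
        (size≤e : ∀ i j k → i ℕ.+ j ℕ.+ k ℕ.≤ e (i , j , k)) (f≤ : ∀ I → Bounded (f I) (1ℚ + 1ℚ + 1ℚ)) (hf : ∀ I → HasValue (f I) (φ I))
        where

        t : Index → Series
        t I = divide I (shift^ (e I) (f I))

        S : List Index → ℚ[i]
        S = sumⁱ (termⁱ x e φ)

        product : ℕ → ℚ[i]
        product N = pochⁱ (x ^ⁱ suc a) (x ^ⁱ suc b) N *ⁱ (pochⁱ (x ^ⁱ suc a₁) (x ^ⁱ suc c) N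
          *ⁱ (pochⁱ (x ^ⁱ suc a₂) (x ^ⁱ suc c) N *ⁱ pochⁱ (x ^ⁱ suc a₃) (x ^ⁱ suc c) N))

        value-S : ∀ F → HasValue (sumˢ t F) (S F)
        value-S = value-sum (λ I → value-term e f φ I (f≤ I) (hf I))

        -- With M = 0 the congruence in `value-vanishing` is vacuous and the conclusion is a plain
        -- bound on the value.
        S-bounded : ∀ {F} → Unique F → S F ≼ 1ℚ * (1ℚ + sumBound)
        S-bounded {F} uF = value-vanishing {sumˢ t F} {M = 0} (agree λ _ ()) (Bounded-terms e f size≤e f≤ uF) (value-S F)

        estimate : ∀ {F N M} → Unique F → defect (suc a) (suc b) (suc a₁) (suc a₂) (suc a₃) (suc c) t F N ≈[ M ] 0ˢ →
          product N *ⁱ S F +ⁱ -ⁱ 1ⁱ ≼ s ^ M * (1ℚ + defectBound)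
        estimate {F} {N} uF vanish = value-vanishing vanish
          (Bounded-defect a b a₁ a₂ a₃ c t F N (Bounded-terms e f size≤e f≤ uF))
          (subst (HasValue _) (cong (_+ⁱ -ⁱ 1ⁱ) (solveⁱ 5 (λ a b c d s → a ⊠ (b ⊠ (c ⊠ (d ⊠ s))) ⊜ (a ⊠ (b ⊠ (c ⊠ d))) ⊠ s) refl (pochⁱ (x ^ⁱ suc a) (x ^ⁱ suc b) N) (pochⁱ (x ^ⁱ suc a₁) (x ^ⁱ suc c) N) (pochⁱ (x ^ⁱ suc a₂) (x ^ⁱ suc c) N) (pochⁱ (x ^ⁱ suc a₃) (x ^ⁱ suc c) N) (S F)))
            (value-⊕ {mulFactors (suc a) (suc b) N _} (value-mulFactors (suc a) (suc b) N (value-mulFactors (suc a₁) (suc c) N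
              (value-mulFactors (suc a₂) (suc c) N (value-mulFactors (suc a₃) (suc c) N (value-S F))))) (value-⊖ {1ˢ} value-1)))

-- Passage to complex numbers along rational approximations of q.

module ComplexLimits where

  open import Defs hiding (*-mono-≤)
  open PowerSeries using (Series; 0ˢ; _≈[_]_)
  open FormalIdentities using (Index; box; box-unique; defect; divide)
  open RationalEstimates
  open GaussianRationals
  open Evaluation
  open Estimation
  open import Data.Nat.Base as ℕ using (ℕ; zero; suc)
  import Data.Nat.Properties as ℕ
  open import Data.Rational.Base
  open import Data.Rational.Properties
  open import Data.Rational.Solver using (module +-*-Solver)
  open +-*-Solver using (solve; _:+_; _:*_; _:-_; :-_; _:=_; con)
  open import Data.Product using (∃; ∃-syntax; Σ-syntax; _×_; _,_; proj₁; proj₂)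
  open import Data.List.Base using (List; []; _∷_; map)
  open import Data.List.Relation.Unary.Unique.Propositional using (Unique)
  open import Data.List.Relation.Binary.Subset.Propositional using (_⊆_)
  open import Data.List.Relation.Binary.Pointwise using ([]; _∷_)
  open import Relation.Binary.PropositionalEquality
  import Algebra.Properties.CommutativeSemiring.Exp
  open Algebra.Properties.CommutativeSemiring.Exp (CommutativeRing.commutativeSemiring ℚ[i]-ring) using () renaming (_^_ to _^ⁱ_)
  open IntegerSolver ℚ[i]-ring using () renaming (solve to solveⁱ; _:+_ to _⊞_; _:*_ to _⊠_; :-_ to ⊟_; _:=_ to _⊜_; con to conⁱ)
  open import Data.Integer.Base using (+_)
  private module R = CommutativeRing ℚ[i]-ring

  -- Operations on ℂ act termwise on the approximating sequences, so taking the n-th term commutes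
  -- with them by computation; facts about ℚ(i) can be applied at each n.
  _!_ : ℂ → ℕ → ℚ[i]
  z ! n = seq (re z) n , seq (im z) n

  infix 9 _!_

  !-^ : ∀ z k n → (z ^ᶜ k) ! n ≡ (z ! n) ^ⁱ k
  !-^ z zero    n = refl
  !-^ z (suc k) n = cong (z ! n *ⁱ_) (!-^ z k n)

  !-poch : ∀ α β k n → (⟨ α ⨾ β ⟩ k) ! n ≡ pochⁱ (α ! n) (β ! n) k
  !-poch α β zero    n = refl
  !-poch α β (suc k) n = cong₂ (λ p b → p *ⁱ (1ⁱ +ⁱ -ⁱ (α ! n *ⁱ b))) (!-poch α β k n) (!-^ β k n)

  !-sum : ∀ (t : Index → ℂ) τ n → (∀ I → t I ! n ≡ τ I) → ∀ F → sumᶜ (map t F) ! n ≡ sumⁱ τ F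
  !-sum t τ n t≡τ []      = refl
  !-sum t τ n t≡τ (I ∷ F) = cong₂ _+ⁱ_ (t≡τ I) (!-sum t τ n t≡τ F)

  ≼⇒∣∣< : ∀ {z B r} N → 0ℚ ≤ B → B < r → (∀ n → N ℕ.≤ n → z ! n ≼ B) → ∣ z ∣< r
  ≼⇒∣∣< {z} {B} {r} N 0≤B B<r z≼B = r * r - B * B , <⇒0<- BB<rr , N , λ n n≥ →
    ≤-trans (+-monoˡ-≤ (r * r - B * B) (norm≤ (z≼B n n≥))) (≤-reflexive (solve 2 (λ b r → b :+ (r :- b) := r) refl (B * B) (r * r)))
    where
    BB<rr : B * B < r * r
    BB<rr = ≤-<-trans (*-monoˡ B 0≤B (<⇒≤ B<r)) (*-monoˡ-<-pos r {{positive (≤-<-trans 0≤B B<r)}} B<r)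

  0<½* : ∀ {ε} → 0ℚ < ε → 0ℚ < ½ * ε
  0<½* = 0<a*b (positive⁻¹ ½)

  half< : ∀ {ε} → 0ℚ < ε → ½ * ε < ε
  half< {ε} 0<ε = subst₂ _<_ (+-identityʳ (½ * ε)) (solve 1 (λ e → con ½ :* e :+ con ½ :* e := e) refl ε) (+-monoʳ-< (½ * ε) (0<½* 0<ε))

  -- Eventually |q|² ≤ 1 - ε. With t = ε/4 and s = 1 - t one has s⁴ ≥ 1 - 4t = 1 - ε, hence |q| ≤
  -- s².
  radius : ∀ q → ∣ q ∣< 1ℚ → ∃ λ s → 0ℚ < s × s < 1ℚ × ∃ λ N → ∀ n → N ℕ.≤ n → q ! n ≼ s * s
  radius q (ε , 0<ε , N , h) = from (½ * (½ * ε)) (0<½* (0<½* 0<ε)) refl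
    where
    ε≤1 : ε ≤ 1ℚ
    ε≤1 = ≤-trans (≤-by (norm² (q ! N)) (0≤norm² (q ! N)) (+-comm ε (norm² (q ! N)))) (h N ℕ.≤-refl)
    from : ∀ t → 0ℚ < t → ½ * (½ * ε) ≡ t → ∃ λ s → 0ℚ < s × s < 1ℚ × ∃ λ N → ∀ n → N ℕ.≤ n → q ! n ≼ s * s
    from t 0<t eq = s , 0<s , s<1 , N , λ n n≥ → bounded (0≤* (<⇒≤ 0<s) (<⇒≤ 0<s)) (bound n n≥)
      where
      s = 1ℚ - t
      4t≡ε : (1ℚ + 1ℚ + 1ℚ + 1ℚ) * t ≡ ε
      4t≡ε = trans (cong ((1ℚ + 1ℚ + 1ℚ + 1ℚ) *_) (sym eq)) (solve 1 (λ e → (con 1ℚ :+ con 1ℚ :+ con 1ℚ :+ con 1ℚ) :* (con ½ :* (con ½ :* e)) := e) refl ε)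
      t<1 : t < 1ℚ
      t<1 = <-≤-trans (subst (_< ε) eq (<-trans (half< (0<½* 0<ε)) (half< 0<ε))) ε≤1
      0<s : 0ℚ < s
      0<s = <⇒0<- t<1
      s<1 : s < 1ℚ
      s<1 = subst (s <_) (+-identityʳ 1ℚ) (+-monoʳ-< 1ℚ (neg-antimono-< 0<t))
      bound : ∀ n → N ℕ.≤ n → norm² (q ! n) ≤ s * s * (s * s)
      bound n n≥ = ≤-trans (≤-by (1ℚ - (norm² (q ! n) + ε)) (≤⇒0≤- (h n n≥)) (solve 2 (λ x e → x :+ (con 1ℚ :- (x :+ e)) := con 1ℚ :- e) refl (norm² (q ! n)) ε))
        (≤-trans (≤-reflexive (cong (λ e → 1ℚ - e) (sym 4t≡ε)))
        (≤-by (t * t * (1ℚ + 1ℚ + (1ℚ + 1ℚ + 1ℚ + 1ℚ) * (1ℚ - t) + t * t))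
          (0≤* (0≤a*a t) (0≤+ (0≤+ (nonNegative⁻¹ (1ℚ + 1ℚ)) (0≤* (nonNegative⁻¹ (1ℚ + 1ℚ + 1ℚ + 1ℚ)) (<⇒≤ 0<s))) (0≤a*a t)))
          (solve 1 (λ t → (con 1ℚ :- (con 1ℚ :+ con 1ℚ :+ con 1ℚ :+ con 1ℚ) :* t) :+ t :* t :* (con 1ℚ :+ con 1ℚ :+ (con 1ℚ :+ con 1ℚ :+ con 1ℚ :+ con 1ℚ) :* (con 1ℚ :- t) :+ t :* t)
            := (con 1ℚ :- t) :* (con 1ℚ :- t) :* ((con 1ℚ :- t) :* (con 1ℚ :- t))) refl t)))

  ≈ʳ-refl : ∀ x → x ≈ʳ x
  ≈ʳ-refl x ε 0<ε = 0 , λ n _ → ≤-trans (≤-reflexive (cong ∣_∣ (+-inverseʳ (seq x n)))) (<⇒≤ 0<ε)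

  module Disc (q : ℂ) (s : ℚ) (0<s : 0ℚ < s) (s<1 : s < 1ℚ) (N₀ : ℕ) (q≼ : ∀ n → N₀ ℕ.≤ n → q ! n ≼ s * s) where
    open Powers s 0<s s<1
    open Majorant s 0<s s<1
    open Estimates s 0<s s<1

    decay-scaled : ∀ C → 0ℚ < C → ∀ η → 0ℚ < η → ∃ λ T → ∀ n → T ℕ.≤ n → s ^ n * C ≤ η
    decay-scaled C 0<C η 0<η = from (scale 0<C 0<η)
      where
      from : (∃ λ ζ → 0ℚ < ζ × C * ζ ≡ η) → ∃ λ T → ∀ n → T ℕ.≤ n → s ^ n * C ≤ η
      from (ζ , 0<ζ , Cζ≡η) = proj₁ (decay ζ 0<ζ) , λ n n≥ → ≤-trans (*-monoʳ C (<⇒≤ 0<C) (proj₂ (decay ζ 0<ζ) n n≥))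
        (≤-reflexive (trans (*-comm ζ C) Cζ≡η))

    C₀ : ℚ
    C₀ = 1ℚ + (1ℚ * K + 1ℚ * K)

    0<C₀ : 0ℚ < C₀
    0<C₀ = +-mono-<-≤ 0<1 (0≤+ (0≤* (<⇒≤ 0<1) 0≤K) (0≤* (<⇒≤ 0<1) 0≤K))

    -- The diagonal of the approximations of the partial products.
    module InfiniteProduct (a b : ℕ) where
      P : ℕ → ℕ → ℚ[i]
      P n k = pochⁱ ((q ! n) ^ⁱ suc a) ((q ! n) ^ⁱ suc b) k

      P-close : ∀ n → N₀ ℕ.≤ n → ∀ {N k l} → N ℕ.≤ k → N ℕ.≤ l → P n k +ⁱ -ⁱ P n l ≼ s ^ N * C₀
      P-close n n≥ = AtPoint.product-cauchy (q ! n) (q≼ n n≥) a b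

      partial : ℕ → ℂ
      partial k = ⟨ q ^ᶜ suc a ⨾ q ^ᶜ suc b ⟩ k

      partial≡ : ∀ k n → partial k ! n ≡ P n k
      partial≡ k n = trans (!-poch (q ^ᶜ suc a) (q ^ᶜ suc b) k n) (cong₂ (λ u v → pochⁱ u v k) (!-^ q (suc a) n) (!-^ q (suc b) n))

      -- From P m m to P n n one passes through P m T and P n T for a fixed T. The outer steps are
      -- small uniformly in m and n, the middle one because the T-th partial product is a Cauchy
      -- sequence. π is the real or the imaginary part.
      diagonal-cauchy : (π : ℚ[i] → ℚ) → (∀ {z B} → z ≼ B → ∣ π z ∣ ≤ B) → (∀ z w → π (z +ⁱ -ⁱ w) ≡ π z - π w) →
        (∀ k → Cauchy (λ n → π (partial k ! n))) → Cauchy (λ n → π (P n n))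
      diagonal-cauchy π ∣π∣≤ π-diff partial-cauchy ε 0<ε = from (scale {1ℚ + 1ℚ + 1ℚ} (positive⁻¹ (1ℚ + 1ℚ + 1ℚ)) 0<ε)
        where
        from : (∃ λ η → 0ℚ < η × (1ℚ + 1ℚ + 1ℚ) * η ≡ ε) → ∃ λ N → ∀ m n → N ℕ.≤ m → N ℕ.≤ n → ∣ π (P m m) - π (P n n) ∣ ≤ ε
        from (η , 0<η , 3η≡ε) = N₀ ℕ.⊔ (T ℕ.⊔ N₁) , λ m n m≥ n≥ →
          let m≥N₀ = ℕ.m⊔n≤o⇒m≤o N₀ (T ℕ.⊔ N₁) m≥
              n≥N₀ = ℕ.m⊔n≤o⇒m≤o N₀ (T ℕ.⊔ N₁) n≥
              m≥T = ℕ.m⊔n≤o⇒m≤o T N₁ (ℕ.m⊔n≤o⇒n≤o N₀ (T ℕ.⊔ N₁) m≥)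
              n≥T = ℕ.m⊔n≤o⇒m≤o T N₁ (ℕ.m⊔n≤o⇒n≤o N₀ (T ℕ.⊔ N₁) n≥)
              m≥N₁ = ℕ.m⊔n≤o⇒n≤o T N₁ (ℕ.m⊔n≤o⇒n≤o N₀ (T ℕ.⊔ N₁) m≥)
              n≥N₁ = ℕ.m⊔n≤o⇒n≤o T N₁ (ℕ.m⊔n≤o⇒n≤o N₀ (T ℕ.⊔ N₁) n≥)
          in begin
          ∣ π (P m m) - π (P n n) ∣
            ≡⟨ cong ∣_∣ (solve 4 (λ a b c d → a :- d := (a :- b) :+ (b :- c) :+ (c :- d)) refl (π (P m m)) (π (P m T)) (π (P n T)) (π (P n n))) ⟩
          ∣ (π (P m m) - π (P m T)) + (π (P m T) - π (P n T)) + (π (P n T) - π (P n n)) ∣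
            ≤⟨ ≤-trans (∣p+q∣≤∣p∣+∣q∣ ((π (P m m) - π (P m T)) + (π (P m T) - π (P n T))) (π (P n T) - π (P n n))) (+-monoˡ-≤ ∣ π (P n T) - π (P n n) ∣ (∣p+q∣≤∣p∣+∣q∣ (π (P m m) - π (P m T)) (π (P m T) - π (P n T)))) ⟩
          ∣ π (P m m) - π (P m T) ∣ + ∣ π (P m T) - π (P n T) ∣ + ∣ π (P n T) - π (P n n) ∣
            ≤⟨ +-mono-≤ (+-mono-≤ (close m m≥N₀ m≥T ℕ.≤-refl)
                 (subst₂ (λ u v → ∣ π u - π v ∣ ≤ η) (partial≡ T m) (partial≡ T n) (proj₂ (partial-cauchy T η 0<η) m n m≥N₁ n≥N₁)))
                 (close n n≥N₀ ℕ.≤-refl n≥T) ⟩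
          η + η + η       ≡⟨ solve 1 (λ e → e :+ e :+ e := (con 1ℚ :+ con 1ℚ :+ con 1ℚ) :* e) refl η ⟩
          (1ℚ + 1ℚ + 1ℚ) * η   ≡⟨ 3η≡ε ⟩
          ε               ∎
          where
          open ≤-Reasoning
          T = proj₁ (decay-scaled C₀ 0<C₀ η 0<η)
          N₁ = proj₁ (partial-cauchy T η 0<η)
          close : ∀ n → N₀ ℕ.≤ n → ∀ {k l} → T ℕ.≤ k → T ℕ.≤ l → ∣ π (P n k) - π (P n l) ∣ ≤ η
          close n n≥ {k} {l} T≤k T≤l = subst (λ v → ∣ v ∣ ≤ η) (π-diff (P n k) (P n l))
            (≤-trans (∣π∣≤ (P-close n n≥ {T} T≤k T≤l)) (proj₂ (decay-scaled C₀ 0<C₀ η 0<η) T ℕ.≤-refl))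

      limit : ℂ
      limit = real (λ n → proj₁ (P n n)) (diagonal-cauchy proj₁ ∣re∣≤ (λ _ _ → refl) (λ k → cauchy (re (partial k))))
           +i real (λ n → proj₂ (P n n)) (diagonal-cauchy proj₂ ∣im∣≤ (λ _ _ → refl) (λ k → cauchy (im (partial k))))

      -- α need only agree with the power of q term by term, so that q itself may stand for its
      -- first power.
      converges : ∀ α → (∀ n → α ! n ≡ (q ! n) ^ⁱ suc a) → (⟨ α ⨾ q ^ᶜ suc b ⟩_) ⟶ limit
      converges α α≡ ε 0<ε = T , λ k k≥ → ≼⇒∣∣< {⟨ α ⨾ q ^ᶜ suc b ⟩ k -ᶜ limit} (N₀ ℕ.⊔ k) (<⇒≤ (0<½* 0<ε)) (half< 0<ε) (λ n n≥ →
        ≼-mono (proj₂ (decay-scaled C₀ 0<C₀ (½ * ε) (0<½* 0<ε)) T ℕ.≤-refl)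
          (subst (λ v → v +ⁱ -ⁱ P n n ≼ s ^ T * C₀)
            (sym (trans (!-poch α (q ^ᶜ suc b) k n) (cong₂ (λ u v → pochⁱ u v k) (α≡ n) (!-^ q (suc b) n))))
            (P-close n (ℕ.m⊔n≤o⇒m≤o N₀ k n≥) {T} k≥ (ℕ.≤-trans k≥ (ℕ.m⊔n≤o⇒n≤o N₀ k n≥)))))
        where
        T = proj₁ (decay-scaled C₀ 0<C₀ (½ * ε) (0<½* 0<ε))

    module Identity (a b a₁ a₂ a₃ c : ℕ) (e : Index → ℕ) (f : Index → Series) (φ : ℚ[i] → Index → ℚ[i])
      (size≤e : ∀ i j k → i ℕ.+ j ℕ.+ k ℕ.≤ e (i , j , k)) (f≤ : ∀ I → Bounded (f I) (1ℚ + 1ℚ + 1ℚ))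
      (hf : ∀ x (x≼ : x ≼ s * s) I → Value.HasValue x x≼ (f I) (φ x I))
      (vanishes : ∀ d {F N} → Unique F → box (6 ℕ.* suc d) ⊆ F → 6 ℕ.* suc d ℕ.≤ N →
        defect (suc a) (suc b) (suc a₁) (suc a₂) (suc a₃) (suc c) (λ I → divide I (PowerSeries.shift^ (e I) (f I))) F N ≈[ suc d ] 0ˢ)
      (α α₁ α₂ α₃ : ℂ) (α≡ : ∀ n → α ! n ≡ (q ! n) ^ⁱ suc a) (α₁≡ : ∀ n → α₁ ! n ≡ (q ! n) ^ⁱ suc a₁)
      (α₂≡ : ∀ n → α₂ ! n ≡ (q ! n) ^ⁱ suc a₂) (α₃≡ : ∀ n → α₃ ! n ≡ (q ! n) ^ⁱ suc a₃) where

      module A₀ = InfiniteProduct a b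
      module A₁ = InfiniteProduct a₁ c
      module A₂ = InfiniteProduct a₂ c
      module A₃ = InfiniteProduct a₃ c

      A B : ℂ
      A = productᶜ (A₀.limit ∷ [])
      B = productᶜ (A₁.limit ∷ A₂.limit ∷ A₃.limit ∷ [])

      π : ℕ → ℚ[i]
      π n = (A *ᶜ B) ! n

      S : ℕ → List Index → ℚ[i]
      S n = sumⁱ (termⁱ (q ! n) e (φ (q ! n)))

      C₁ C₂ : ℚ
      C₁ = 1ℚ + defectBound
      C₂ = 1ℚ * (1ℚ + sumBound)

      0≤sumBound : 0ℚ ≤ sumBound
      0≤sumBound = bound (Bounded-terms e f size≤e f≤ (box-unique 0)) 0

      0<C₁ : 0ℚ < C₁
      0<C₁ = +-mono-<-≤ 0<1 (bound (Bounded-defect a b a₁ a₂ a₃ c (λ I → divide I (PowerSeries.shift^ (e I) (f I))) (box 0) 0 (Bounded-terms e f size≤e f≤ (box-unique 0))) 0)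

      0<C₂ : 0ℚ < C₂
      0<C₂ = 0<a*b 0<1 (+-mono-<-≤ 0<1 0≤sumBound)

      S-bounded : ∀ n → N₀ ℕ.≤ n → ∀ {F} → Unique F → S n F ≼ C₂
      S-bounded n n≥ = AtPoint.Estimate.S-bounded (q ! n) (q≼ n n≥) a b a₁ a₂ a₃ c e f (φ (q ! n)) size≤e f≤ (hf (q ! n) (q≼ n n≥))

      -- As A and B are built from diagonals, n is at once the index of the approximation to q and
      -- the number of factors in each product; from n = 6(d + 1) on there are enough factors for
      -- the congruence.
      estimate : ∀ n d {F} → N₀ ℕ.≤ n → 6 ℕ.* suc d ℕ.≤ n → Unique F → box (6 ℕ.* suc d) ⊆ F →
        π n *ⁱ S n F +ⁱ -ⁱ 1ⁱ ≼ s ^ suc d * C₁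
      estimate n d {F} n≥N₀ n≥d uF box⊆F = subst (_≼ s ^ suc d * C₁)
        (cong (λ v → v *ⁱ S n F +ⁱ -ⁱ 1ⁱ) (solveⁱ 4 (λ a b c d → a ⊠ (b ⊠ (c ⊠ d)) ⊜ (a ⊠ conⁱ (+ 1)) ⊠ (b ⊠ (c ⊠ (d ⊠ conⁱ (+ 1))))) refl
          (A₀.P n n) (A₁.P n n) (A₂.P n n) (A₃.P n n)))
        (AtPoint.Estimate.estimate (q ! n) (q≼ n n≥N₀) a b a₁ a₂ a₃ c e f (φ (q ! n)) size≤e f≤ (hf (q ! n) (q≼ n n≥N₀)) {F} {n} uF
          (vanishes d uF box⊆F n≥d))

      depth : ∀ η → 0ℚ < η → ∃ λ d → s ^ suc d * C₁ ≤ η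
      depth η 0<η = T , proj₂ (decay-scaled C₁ 0<C₁ η 0<η) (suc T) (ℕ.n≤1+n T)
        where T = proj₁ (decay-scaled C₁ 0<C₁ η 0<η)

      -- The identity keeps A·B away from 0: |πS - 1| ≤ ½ forces |πS|² ≥ ¼, and |S| ≤ C₂, so |π|² is
      -- at least ¼ / C₂².
      lower-bound : ∃ λ η → 0ℚ < η × ∃ λ N → N₀ ℕ.≤ N × (∀ n → N ℕ.≤ n → η ≤ norm² (π n))
      lower-bound = from (scale (0<a*b 0<C₂ 0<C₂) (positive⁻¹ (½ * ½)))
        where
        from : (∃ λ η → 0ℚ < η × C₂ * C₂ * η ≡ ½ * ½) → ∃ λ η → 0ℚ < η × ∃ λ N → N₀ ℕ.≤ N × (∀ n → N ℕ.≤ n → η ≤ norm² (π n))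
        from (η , 0<η , eq) = η , 0<η , N₀ ℕ.⊔ 6 ℕ.* suc d , ℕ.m≤m⊔n N₀ _ , λ n n≥ →
          let n≥N₀ = ℕ.m⊔n≤o⇒m≤o N₀ (6 ℕ.* suc d) n≥
              n≥d = ℕ.m⊔n≤o⇒n≤o N₀ (6 ℕ.* suc d) n≥
              uF = box-unique (6 ℕ.* suc d)
              F = box (6 ℕ.* suc d)
          in *-cancelʳ-≤-pos (C₂ * C₂) {{positive (0<a*b 0<C₂ 0<C₂)}} (begin
            η * (C₂ * C₂)              ≡⟨ trans (*-comm η (C₂ * C₂)) eq ⟩
            ½ * ½                      ≤⟨ 1/4≤norm² {π n *ⁱ S n F} (≼-mono (proj₂ (depth ½ (positive⁻¹ ½))) (estimate n d n≥N₀ n≥d uF (λ I∈ → I∈))) ⟩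
            norm² (π n *ⁱ S n F)       ≡⟨ norm²-* (π n) (S n F) ⟩
            norm² (π n) * norm² (S n F)   ≤⟨ *-monoˡ (norm² (π n)) (0≤norm² (π n)) (norm≤ (S-bounded n n≥N₀ uF)) ⟩
            norm² (π n) * (C₂ * C₂)    ∎)
          where
          open ≤-Reasoning
          d = proj₁ (depth ½ (positive⁻¹ ½))

      η = proj₁ lower-bound
      0<η = proj₁ (proj₂ lower-bound)
      N₁ = proj₁ (proj₂ (proj₂ lower-bound))
      N₀≤N₁ = proj₁ (proj₂ (proj₂ (proj₂ lower-bound)))
      η≤ = proj₂ (proj₂ (proj₂ (proj₂ lower-bound)))

      AB#0 : (A *ᶜ B) #0
      AB#0 = η , 0<η , N₁ , λ n n≥ → ≤-trans (≤-reflexive (+-identityˡ η)) (η≤ n n≥)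

      recip-bounded : ∃ λ ρ → 0ℚ < ρ × (∀ n → N₁ ℕ.≤ n → recipⁱ (π n) ≼ ρ)
      recip-bounded = from (scale 0<η 0<1)
        where
        from : (∃ λ ρ → 0ℚ < ρ × η * ρ ≡ 1ℚ) → ∃ λ ρ → 0ℚ < ρ × (∀ n → N₁ ℕ.≤ n → recipⁱ (π n) ≼ ρ)
        -- Only the square of the reciprocal is known to be at most ρ; since ρ ≤ (1 + ρ)², the
        -- reciprocal itself is bounded by 1 + ρ.
        from (ρ , 0<ρ , ηρ≡1) = 1ℚ + ρ , +-mono-<-≤ 0<1 (<⇒≤ 0<ρ) , λ n n≥ → bounded (<⇒≤ (+-mono-<-≤ 0<1 (<⇒≤ 0<ρ))) (begin
          r n                    ≡⟨ sym (*-identityˡ (r n)) ⟩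
          1ℚ * r n               ≡⟨ cong (_* r n) (trans (sym ηρ≡1) (*-comm η ρ)) ⟩
          ρ * η * r n            ≡⟨ *-assoc ρ η (r n) ⟩
          ρ * (η * r n)          ≤⟨ *-monoˡ ρ (<⇒≤ 0<ρ) (*-monoʳ (r n) (0≤norm² (recipⁱ (π n))) (η≤ n n≥)) ⟩
          ρ * (norm² (π n) * r n)
            ≡⟨ cong (ρ *_) (trans (sym (norm²-* (π n) (recipⁱ (π n)))) (cong norm² (*-recipⁱ (π n) (<-≤-trans 0<η (η≤ n n≥))))) ⟩
          ρ * 1ℚ                 ≤⟨ ≤-by (1ℚ + ρ + ρ * ρ) (0≤+ (0≤+ (<⇒≤ 0<1) (<⇒≤ 0<ρ)) (0≤a*a ρ))
            (solve 1 (λ r → r :* con 1ℚ :+ (con 1ℚ :+ r :+ r :* r) := (con 1ℚ :+ r) :* (con 1ℚ :+ r)) refl ρ) ⟩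
          (1ℚ + ρ) * (1ℚ + ρ)    ∎)
          where
          open ≤-Reasoning
          r : ℕ → ℚ
          r n = norm² (recipⁱ (π n))

      -- S - 1/π = (1/π)(πS - 1), where 1/π is bounded and πS - 1 is at most s^(d+1) C₁ for every
      -- list containing the box of side 6(d + 1).
      has-sum : ∀ {t} → (∀ n I → t I ! n ≡ termⁱ (q ! n) e (φ (q ! n)) I) → HasSum t (1ᶜ /ᶜ (A *ᶜ B) [ AB#0 ])
      has-sum {t} t≡ ε 0<ε = from (scale 0<ρ (0<½* 0<ε))
        where
        ρ = proj₁ recip-bounded
        0<ρ = proj₁ (proj₂ recip-bounded)
        recip≼ = proj₂ (proj₂ recip-bounded)
        total = 1ᶜ /ᶜ (A *ᶜ B) [ AB#0 ]
        from : (∃ λ ζ → 0ℚ < ζ × ρ * ζ ≡ ½ * ε) → ∃ λ F₀ → ∀ F → Unique F → F₀ ⊆ F → ∣ sumᶜ (map t F) -ᶜ total ∣< ε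
        from (ζ , 0<ζ , ρζ≡) = box (6 ℕ.* suc d) , λ F uF box⊆F →
          ≼⇒∣∣< {sumᶜ (map t F) -ᶜ total} (N₁ ℕ.⊔ 6 ℕ.* suc d) (<⇒≤ (0<½* 0<ε)) (half< 0<ε) (λ n n≥ →
            let n≥N₁ = ℕ.m⊔n≤o⇒m≤o N₁ (6 ℕ.* suc d) n≥
                n≥d = ℕ.m⊔n≤o⇒n≤o N₁ (6 ℕ.* suc d) n≥
            in subst₂ _≼_ (sym (difference n F n≥N₁)) ρζ≡ (≼-* (recip≼ n n≥N₁)
              (≼-mono (proj₂ (depth ζ 0<ζ)) (estimate n d (ℕ.≤-trans N₀≤N₁ n≥N₁) n≥d uF box⊆F))))
          where
          d = proj₁ (depth ζ 0<ζ)
          difference : ∀ n F → N₁ ℕ.≤ n → (sumᶜ (map t F) -ᶜ total) ! n ≡ recipⁱ (π n) *ⁱ (π n *ⁱ S n F +ⁱ -ⁱ 1ⁱ)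
          difference n F n≥ = begin
            sumᶜ (map t F) ! n +ⁱ -ⁱ (1ⁱ *ⁱ r)    ≡⟨ cong (_+ⁱ -ⁱ (1ⁱ *ⁱ r)) (!-sum t _ n (t≡ n) F) ⟩
            S n F +ⁱ -ⁱ (1ⁱ *ⁱ r)                  ≡⟨ cong (_+ⁱ -ⁱ (1ⁱ *ⁱ r)) (sym (R.*-identityˡ (S n F))) ⟩
            1ⁱ *ⁱ S n F +ⁱ -ⁱ (1ⁱ *ⁱ r)
              ≡⟨ cong (λ v → v *ⁱ S n F +ⁱ -ⁱ (1ⁱ *ⁱ r)) (sym (*-recipⁱ (π n) (<-≤-trans 0<η (η≤ n n≥)))) ⟩
            π n *ⁱ r *ⁱ S n F +ⁱ -ⁱ (1ⁱ *ⁱ r)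
              ≡⟨ solveⁱ 3 (λ p r s → p ⊠ r ⊠ s ⊞ ⊟ (conⁱ (+ 1) ⊠ r) ⊜ r ⊠ (p ⊠ s ⊞ ⊟ conⁱ (+ 1))) refl (π n) r (S n F) ⟩
            r *ⁱ (π n *ⁱ S n F +ⁱ -ⁱ 1ⁱ)           ∎
            where
            open ≡-Reasoning
            r = recipⁱ (π n)

      conclusion : ∀ {t} → (∀ n I → t I ! n ≡ termⁱ (q ! n) e (φ (q ! n)) I) → ∃[ A ] ∃[ B ] Σ[ AB#0 ∈ (A *ᶜ B) #0 ]
        ⟨ α ∷ [] ⨾ q ^ᶜ suc b ⟩∞≈ A × ⟨ α₁ ∷ α₂ ∷ α₃ ∷ [] ⨾ q ^ᶜ suc c ⟩∞≈ B × HasSum t (1ᶜ /ᶜ (A *ᶜ B) [ AB#0 ])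
      conclusion t≡ = A , B , AB#0
        , (A₀.limit ∷ [] , A₀.converges α α≡ ∷ [] , ≈ʳ-refl (re A) , ≈ʳ-refl (im A))
        , (A₁.limit ∷ A₂.limit ∷ A₃.limit ∷ [] , A₁.converges α₁ α₁≡ ∷ A₂.converges α₂ α₂≡ ∷ A₃.converges α₃ α₃≡ ∷ []
          , ≈ʳ-refl (re B) , ≈ʳ-refl (im B))
        , has-sum t≡

-- The numerators and summands of the two identities at each approximation of q.

open import Defs
open import Data.Nat.Base using (ℕ; _+_; _*_; _^_)
open import Data.Nat.Combinatorics using (_C_)
open import Data.Rational.Base using (1ℚ)
open import Data.Product using (Σ-syntax; ∃-syntax; _×_; _,_)
open import Data.List.Base using ([]; _∷_)
import Data.Rational.Base as ℚ
import Algebra.Properties.CommutativeSemiring.Exp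
open import Relation.Binary.PropositionalEquality using (_≡_; sym; trans; cong; cong₂; subst)
open import Data.Product using (proj₁; proj₂)
open PowerSeries using (shift; 1ˢ)
open FormalIdentities
open GaussianRationals
open Evaluation
open Estimation
open ComplexLimits
private module R = CommutativeRing ℚ[i]-ring
open Algebra.Properties.CommutativeSemiring.Exp R.commutativeSemiring using () renaming (_^_ to _^ⁱ_)

φ₁ φ₂ : ℚ[i] → Index → ℚ[i]
φ₁ x (i , j , k) = 1ⁱ +ⁱ x ^ⁱ (2 * i + 4 * j + 6 * k + 2) +ⁱ -ⁱ x ^ⁱ (3 * i + 6 * j + 9 * k + 5)
φ₂ x (i , j , k) = 1ⁱ +ⁱ x +ⁱ x ^ⁱ (2 * j + 3 * k + 2)

!-denominator : ∀ q n i j k → denominator q i j k ! n ≡ denominatorⁱ (q ! n) (i , j , k)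
!-denominator q n i j k = cong₂ _*ⁱ_ (cong₂ _*ⁱ_
  (trans (!-poch q q i n) (cong (λ x → pochⁱ x x i) (sym (R.*-identityʳ (q ! n)))))
  (trans (!-poch (q ^ᶜ 2) (q ^ᶜ 2) j n) (cong (λ x → pochⁱ x x j) (!-^ q 2 n))))
  (trans (!-poch (q ^ᶜ 3) (q ^ᶜ 3) k n) (cong (λ x → pochⁱ x x k) (!-^ q 3 n)))

!-quotient : ∀ z q h i j k n {v} → z ! n ≡ v →
  (z /ᶜ denominator q i j k [ denominator#0 q h i j k ]) ! n ≡ v *ⁱ recipⁱ (denominatorⁱ (q ! n) (i , j , k))
!-quotient z q h i j k n z≡v = cong₂ (λ u w → u *ⁱ recipⁱ w) z≡v (!-denominator q n i j k)

module Values (s : ℚ.ℚ) (0<s : ℚ.0ℚ ℚ.< s) (s<1 : s ℚ.< 1ℚ) where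
  open Estimates s 0<s s<1
  open Majorant s 0<s s<1

  value-φ₁ : ∀ x (x≼ : x ≼ s ℚ.* s) I → Value.HasValue x x≼ (factor₁ I) (φ₁ x I)
  value-φ₁ x x≼ (i , j , k) =
    value-⊕ {v = 1ⁱ +ⁱ x ^ⁱ m} {w = -ⁱ x ^ⁱ n} (value-⊕ {v = 1ⁱ} {w = x ^ⁱ m} value-1 (value-X^ m)) (value-⊖ {v = x ^ⁱ n} (value-X^ n))
    where
    open AtPoint x x≼ using (value-X^)
    open Value x x≼ using (value-1; value-⊕; value-⊖)
    m = 2 * i + 4 * j + 6 * k + 2
    n = 3 * i + 6 * j + 9 * k + 5

  value-φ₂ : ∀ x (x≼ : x ≼ s ℚ.* s) I → Value.HasValue x x≼ (factor₂ I) (φ₂ x I)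
  value-φ₂ x x≼ (i , j , k) =
    value-⊕ {v = 1ⁱ +ⁱ x} {w = x ^ⁱ m} (value-⊕ {v = 1ⁱ} {w = x} value-1 (subst (HasValue (shift 1ˢ)) (R.*-identityʳ x) (value-X^ 1))) (value-X^ m)
    where
    open AtPoint x x≼ using (value-X^)
    open Value x x≼ using (HasValue; value-1; value-⊕)
    m = 2 * j + 3 * k + 2

  Bounded-factor₁ : ∀ I → Bounded (factor₁ I) (1ℚ ℚ.+ 1ℚ ℚ.+ 1ℚ)
  Bounded-factor₁ (i , j , k) = Bounded-⊕ (Bounded-⊕ Bounded-1 (Bounded-X^ (2 * i + 4 * j + 6 * k + 2))) (Bounded-⊖ (Bounded-X^ (3 * i + 6 * j + 9 * k + 5)))

  Bounded-factor₂ : ∀ I → Bounded (factor₂ I) (1ℚ ℚ.+ 1ℚ ℚ.+ 1ℚ)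
  Bounded-factor₂ (i , j , k) = Bounded-⊕ (Bounded-⊕ Bounded-1 (Bounded-X^ 1)) (Bounded-X^ (2 * j + 3 * k + 2))

!-term₁ : ∀ q (∣q∣<1 : ∣ q ∣< 1ℚ) (n : ℕ) (I : Index) → let (i , j , k) = I in
          (((1ᶜ +ᶜ q ^ᶜ (2 * i + 4 * j + 6 * k + 2) -ᶜ q ^ᶜ (3 * i + 6 * j + 9 * k + 5))
            *ᶜ q ^ᶜ (((i + 2 * j + 3 * k) C 2) + i + j ^ 2 + 2 * j + 2 * k))
          /ᶜ denominator q i j k [ denominator#0 q ∣q∣<1 i j k ]) ! n ≡ termⁱ (q ! n) exponent₁ (φ₁ (q ! n)) I
!-term₁ q ∣q∣<1 n (i , j , k) = !-quotient
        ((1ᶜ +ᶜ q ^ᶜ (2 * i + 4 * j + 6 * k + 2) -ᶜ q ^ᶜ (3 * i + 6 * j + 9 * k + 5))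
          *ᶜ q ^ᶜ (((i + 2 * j + 3 * k) C 2) + i + j ^ 2 + 2 * j + 2 * k)) q ∣q∣<1 i j k n
        (cong₂ _*ⁱ_ (cong₂ (λ y z → 1ⁱ +ⁱ y +ⁱ -ⁱ z) (!-^ q (2 * i + 4 * j + 6 * k + 2) n) (!-^ q (3 * i + 6 * j + 9 * k + 5) n))
          (!-^ q (exponent₁ (i , j , k)) n))

!-term₂ : ∀ q (∣q∣<1 : ∣ q ∣< 1ℚ) (n : ℕ) (I : Index) → let (i , j , k) = I in
          (((1ᶜ +ᶜ q +ᶜ q ^ᶜ (2 * j + 3 * k + 2))
            *ᶜ q ^ᶜ (((i + 2 * j + 3 * k) C 2) + 3 * i + j ^ 2 + 4 * j + 7 * k))
          /ᶜ denominator q i j k [ denominator#0 q ∣q∣<1 i j k ]) ! n ≡ termⁱ (q ! n) exponent₂ (φ₂ (q ! n)) I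
!-term₂ q ∣q∣<1 n (i , j , k) = !-quotient
        ((1ᶜ +ᶜ q +ᶜ q ^ᶜ (2 * j + 3 * k + 2))
            *ᶜ q ^ᶜ (((i + 2 * j + 3 * k) C 2) + 3 * i + j ^ 2 + 4 * j + 7 * k)) q ∣q∣<1 i j k n
        (cong₂ _*ⁱ_ (cong (λ y → 1ⁱ +ⁱ q ! n +ⁱ y) (!-^ q (2 * j + 3 * k + 2) n)) (!-^ q (exponent₂ (i , j , k)) n))

theorem1p1 : (q : ℂ) (∣q∣<1 : ∣ q ∣< 1ℚ) →
    (∃[ A ] ∃[ B ] Σ[ AB#0 ∈ (A *ᶜ B) #0 ]
    ⟨ q ^ᶜ 2 ∷ [] ⨾ q ^ᶜ 3 ⟩∞≈ A ×
    ⟨ q ∷ q ^ᶜ 6 ∷ q ^ᶜ 9 ∷ [] ⨾ q ^ᶜ 12 ⟩∞≈ B ×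
    HasSum {ℕ × ℕ × ℕ}
    (λ (i , j , k) →
    ((1ᶜ +ᶜ q ^ᶜ (2 * i + 4 * j + 6 * k + 2) -ᶜ q ^ᶜ (3 * i + 6 * j + 9 * k + 5))
    *ᶜ q ^ᶜ (((i + 2 * j + 3 * k) C 2) + i + j ^ 2 + 2 * j + 2 * k))
    /ᶜ denominator q i j k [ denominator#0 q ∣q∣<1 i j k ])
    (1ᶜ /ᶜ (A *ᶜ B) [ AB#0 ]))
    ×
    (∃[ A ] ∃[ B ] Σ[ AB#0 ∈ (A *ᶜ B) #0 ]
    ⟨ q ∷ [] ⨾ q ^ᶜ 3 ⟩∞≈ A ×
    ⟨ q ^ᶜ 5 ∷ q ^ᶜ 6 ∷ q ^ᶜ 9 ∷ [] ⨾ q ^ᶜ 12 ⟩∞≈ B ×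
    HasSum {ℕ × ℕ × ℕ}
    (λ (i , j , k) →
    ((1ᶜ +ᶜ q +ᶜ q ^ᶜ (2 * j + 3 * k + 2))
    *ᶜ q ^ᶜ (((i + 2 * j + 3 * k) C 2) + 3 * i + j ^ 2 + 4 * j + 7 * k))
    /ᶜ denominator q i j k [ denominator#0 q ∣q∣<1 i j k ])
    (1ᶜ /ᶜ (A *ᶜ B) [ AB#0 ]))
theorem1p1 q ∣q∣<1 =
    -- The numbers are one less than the exponents 2 and 3 of A, then 1, 6, 9 and 12 of B; in the
    -- second identity one less than 1, 3, 5, 6, 9, 12.
    Identity.conclusion 1 2 0 5 8 11 exponent₁ factor₁ φ₁ size≤exponent₁ Bounded-factor₁ value-φ₁ defect₁-vanishes
      (q ^ᶜ 2) q (q ^ᶜ 6) (q ^ᶜ 9) (!-^ q 2) q≡q^1 (!-^ q 6) (!-^ q 9) (!-term₁ q ∣q∣<1)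
  , Identity.conclusion 0 2 4 5 8 11 exponent₂ factor₂ φ₂ size≤exponent₂ Bounded-factor₂ value-φ₂ defect₂-vanishes
      q (q ^ᶜ 5) (q ^ᶜ 6) (q ^ᶜ 9) q≡q^1 (!-^ q 5) (!-^ q 6) (!-^ q 9) (!-term₂ q ∣q∣<1)
  where
  ρ = radius q ∣q∣<1
  0<s = proj₁ (proj₂ ρ)
  s<1 = proj₁ (proj₂ (proj₂ ρ))
  open Disc q (proj₁ ρ) 0<s s<1 (proj₁ (proj₂ (proj₂ (proj₂ ρ)))) (proj₂ (proj₂ (proj₂ (proj₂ ρ))))
  open Values (proj₁ ρ) 0<s s<1
  q≡q^1 : ∀ n → q ! n ≡ (q ! n) ^ⁱ 1
  q≡q^1 n = sym (R.*-identityʳ (q ! n))
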